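{- Let $\alpha(x)$ be an eventually positive sub-polynomial of the form $$\alpha(x)=c\,p(x)+r(x),$$ where $c>0$ is real, $p\in\mathbb{Z}[x]$ has degree $\geq 2$, and $\lim_{x\to+\infty}\frac{|r(x)|}{\log(x)}<+\infty$. Then there exists $A\subseteq\mathbb{N}$ such that $\overline{d}(A)>0$ and there are no $x,y\in A$, $n\in\mathbb{N}$ such that $x+y=\lfloor\alpha(n)\rfloor$.
   Context: $\mathbb{N}=\{1,2,\dots\}$. For $A\subseteq\mathbb{N}$, $\overline{d}(A)=\limsup_{N\to\infty}\frac{|A\cap[1,N]|}{N}$. Let $\mathcal{G}$ be the ring (under pointwise addition and multiplication) of germs at $+\infty$ of continuous real-valued functions defined on half-lines $(a,+\infty)$; two functions have the same germ if they agree for all sufficiently large $x$. A Hardy field is a subfield of $\mathcal{G}$ closed under differentiation (each element is eventually differentiable and its derivative's germ lies in the field). A sub-polynomial is a function $\alpha$ whose germ belongs to some Hardy field and which satisfies $\lim_{x\to+\infty}\alpha(x)/x^l=0$ for some $l>0$. Functions and germs are not distinguished; when values $\alpha(n)$, $n\in\mathbb{N}$, appear, $\alpha$ denotes a fixed real-valued representative defined on $[1,+\infty)$. -}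

module Defs where

open import Level using (0ℓ)
open import Algebra.Bundles using (CommutativeRing; Semiring)
open import Algebra.Structures using (IsCommutativeRing)
import Algebra.Definitions.RawSemiring as RawSemiringDefs
open import Data.Integer.Base as ℤ using (ℤ; -[1+_])
open import Data.List.Base using (List; []; _∷_; length; filter; applyUpTo; foldr)
open import Data.Nat.Base as ℕ using (ℕ; zero; suc; _!)
open import Data.Product.Base using (∃; ∃-syntax; _×_; _,_; proj₁)
open import Data.Sum.Base using (_⊎_; inj₁; inj₂)
open import Relation.Binary.Core using (Rel)
open import Relation.Binary.Definitions using (tri<; tri≈; tri>)
open import Relation.Binary.PropositionalEquality using (_≡_; _≢_; refl; sym; trans; cong; cong₂; subst)
open import Relation.Binary.Structures using (IsStrictTotalOrder)
open import Relation.Nullary using (¬_)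
open import Relation.Unary using (Pred; Decidable; _∈_)

module Bounds {X : Set} (_<_ : Rel X 0ℓ) where
  infix 4 _≤_
  _≤_ : Rel X 0ℓ
  x ≤ y = x < y ⊎ x ≡ y

  IsUpperBound IsLowerBound IsLUB IsGLB : Pred X 0ℓ → Pred X 0ℓ
  IsUpperBound S b = ∀ x → x ∈ S → x ≤ b
  IsLowerBound S b = ∀ x → x ∈ S → b ≤ x
  IsLUB S s = IsUpperBound S s × (∀ b → IsUpperBound S b → s ≤ b)
  IsGLB S s = IsLowerBound S s × (∀ b → IsLowerBound S b → b ≤ s)

-- The real numbers, given axiomatically: a Dedekind-complete ordered field,
-- which is unique up to isomorphism.  Decidable trichotomy together with
-- completeness for arbitrary predicates is the classical notion of ℝ; results
-- about it are meant to be read together with excluded middle.  The inverse is total; the value of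
-- 0# ⁻¹ is left unspecified.
record CompleteOrderedField : Set₁ where
  infix  8 _⁻¹ -_
  infixl 7 _*_
  infixl 6 _+_
  infix  4 _<_
  field
    ℝ                  : Set
    _<_                : Rel ℝ 0ℓ
    _+_ _*_            : ℝ → ℝ → ℝ
    -_ _⁻¹             : ℝ → ℝ
    0# 1#              : ℝ
    isCommutativeRing  : IsCommutativeRing _≡_ _+_ _*_ -_ 0# 1#
    isStrictTotalOrder : IsStrictTotalOrder _≡_ _<_
    0≢1                : 0# ≢ 1#
    ⁻¹-inverseʳ        : ∀ x → x ≢ 0# → x * x ⁻¹ ≡ 1#
    +-monoʳ-<          : ∀ z {x y} → x < y → z + x < z + y
    *-pos              : ∀ {x y} → 0# < x → 0# < y → 0# < x * y

  open Bounds _<_ public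

  field
    complete : (S : Pred ℝ 0ℓ) → ∃ S → ∃ (IsUpperBound S) → ∃ (IsLUB S)

module RealAnalysis (R : CompleteOrderedField) where
  open CompleteOrderedField R public

  commutativeRing : CommutativeRing 0ℓ 0ℓ
  commutativeRing = record { isCommutativeRing = isCommutativeRing }

  private
    module CR = CommutativeRing commutativeRing
    module O  = IsStrictTotalOrder isStrictTotalOrder

  open RawSemiringDefs (Semiring.rawSemiring CR.semiring) public using (_^_) renaming (_×_ to _·_)

  infixl 6 _-_
  infixl 7 _÷_

  _-_ _÷_ : ℝ → ℝ → ℝ
  x - y = x + - y
  x ÷ y = x * y ⁻¹

  ∣_∣ : ℝ → ℝ
  ∣ x ∣ with O.compare x 0#
  ... | tri< _ _ _ = - x
  ... | tri≈ _ _ _ = x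
  ... | tri> _ _ _ = x

  fromℕ : ℕ → ℝ
  fromℕ n = n · 1#

  fromℤ : ℤ → ℝ
  fromℤ (ℤ.+ n) = fromℕ n
  fromℤ -[1+ n ] = - fromℕ (suc n)

  infix 4 ⌊_⌋≡_
  ⌊_⌋≡_ : ℝ → ℤ → Set
  ⌊ x ⌋≡ m = fromℤ m ≤ x × x < fromℤ m + 1#

  -- A function on a half-line (a, +∞) is represented by any extension of it
  -- to ℝ, and germs at +∞ by functions ℝ → ℝ modulo ≈∞.
  Eventually : Pred ℝ 0ℓ → Set
  Eventually P = ∃[ a ] ∀ x → a < x → P x

  infix 4 _≈∞_
  _≈∞_ : Rel (ℝ → ℝ) 0ℓ
  f ≈∞ g = Eventually λ x → f x ≡ g x

  Lim∞ : (ℝ → ℝ) → ℝ → Set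
  Lim∞ f ℓ = ∀ ε → 0# < ε → Eventually λ x → ∣ f x - ℓ ∣ < ε

  ContinuousAt : (ℝ → ℝ) → ℝ → Set
  ContinuousAt f x =
    ∀ ε → 0# < ε → ∃[ δ ] (0# < δ × (∀ y → ∣ y - x ∣ < δ → ∣ f y - f x ∣ < ε))

  HasDerivativeAt : (ℝ → ℝ) → ℝ → ℝ → Set
  HasDerivativeAt f d x =
    ∀ ε → 0# < ε → ∃[ δ ] (0# < δ ×
      (∀ h → h ≢ 0# → ∣ h ∣ < δ → ∣ (f (x + h) - f x) ÷ h - d ∣ < ε))

  record IsHardyField (H : Pred (ℝ → ℝ) 0ℓ) : Set where
    field
      respects-≈∞ : ∀ {f g} → f ≈∞ g → f ∈ H → g ∈ H
      continuous  : ∀ {f} → f ∈ H → Eventually (ContinuousAt f)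
      0-closed    : (λ _ → 0#) ∈ H
      1-closed    : (λ _ → 1#) ∈ H
      +-closed    : ∀ {f g} → f ∈ H → g ∈ H → (λ x → f x + g x) ∈ H
      neg-closed  : ∀ {f} → f ∈ H → (λ x → - f x) ∈ H
      *-closed    : ∀ {f g} → f ∈ H → g ∈ H → (λ x → f x * g x) ∈ H
      inv-closed  : ∀ {f} → f ∈ H → ¬ (f ≈∞ λ _ → 0#) →
                    ∃[ g ] (g ∈ H × (λ x → f x * g x) ≈∞ (λ _ → 1#))
      der-closed  : ∀ {f} → f ∈ H →
                    ∃[ f′ ] (f′ ∈ H × Eventually (λ x → HasDerivativeAt f (f′ x) x))

  -- It is immaterial whether the exponent l ranges over positive integers or
  -- positive reals, since a real exponent may be rounded up.
  SubPolynomial : (ℝ → ℝ) → Set₁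
  SubPolynomial α =
    (∃[ H ] (IsHardyField H × α ∈ H)) ×
    (∃[ l ] (0 ℕ.< l × Lim∞ (λ x → α x ÷ x ^ l) 0#))

  -- Integer polynomials as coefficient lists, constant coefficient first.
  coeff : List ℤ → ℕ → ℤ
  coeff []      _       = ℤ.+ 0
  coeff (a ∷ p) zero    = a
  coeff (a ∷ p) (suc k) = coeff p k

  HasDegree : List ℤ → ℕ → Set
  HasDegree p d = coeff p d ≢ ℤ.+ 0 × (∀ k → d ℕ.< k → coeff p k ≡ ℤ.+ 0)

  eval : List ℤ → ℝ → ℝ
  eval p x = foldr (λ a v → fromℤ a + x * v) 0# p

  -- Σ_{k ≤ n} y^k / k!
  expSum : ℝ → ℕ → ℝ
  expSum y zero    = 1#
  expSum y (suc n) = expSum y n + y ^ suc n ÷ fromℕ (suc n !)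

  -- {y ≥ 0 : e^y ≤ x}; for y ≥ 0 the partial sums increase to e^y.
  ExpBelow : ℝ → Pred ℝ 0ℓ
  ExpBelow x y = 0# ≤ y × (∀ n → expSum y n ≤ x)

  expSum-0 : ∀ n → expSum 0# n ≡ 1#
  expSum-0 zero    = refl
  expSum-0 (suc n) =
    trans (cong₂ _+_ (expSum-0 n)
            (trans (cong (_* fromℕ (suc n !) ⁻¹) (CR.zeroˡ (0# ^ n))) (CR.zeroˡ _)))
          (CR.+-identityʳ 1#)

  expSum-1 : ∀ y → expSum y 1 ≡ 1# + y
  expSum-1 y = cong (1# +_)
    (trans (cong₂ _*_ (CR.*-identityʳ y) 1⁻¹) (CR.*-identityʳ y))
    where
    1⁻¹ : fromℕ 1 ⁻¹ ≡ 1#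
    1⁻¹ = trans (cong _⁻¹ (CR.+-identityʳ 1#))
                (trans (sym (CR.*-identityˡ (1# ⁻¹)))
                       (⁻¹-inverseʳ 1# (λ e → 0≢1 (sym e))))

  -1+1+ : ∀ y → - 1# + (1# + y) ≡ y
  -1+1+ y = trans (sym (CR.+-assoc (- 1#) 1# y))
                  (trans (cong (_+ y) (CR.-‿inverseˡ 1#)) (CR.+-identityˡ y))

  ExpBelow-inhabited : ∀ x → 1# ≤ x → ∃ (ExpBelow x)
  ExpBelow-inhabited x 1≤x =
    0# , inj₂ refl , λ n → subst (_≤ x) (sym (expSum-0 n)) 1≤x

  ExpBelow-bounded : ∀ x → ∃ (IsUpperBound (ExpBelow x))
  ExpBelow-bounded x = - 1# + x , λ y (_ , e) → step y (subst (_≤ x) (expSum-1 y) (e 1))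
    where
    step : ∀ y → 1# + y ≤ x → y ≤ - 1# + x
    step y (inj₁ lt) = inj₁ (subst (_< - 1# + x) (-1+1+ y) (+-monoʳ-< (- 1#) lt))
    step y (inj₂ eq) = inj₂ (trans (sym (-1+1+ y)) (cong (- 1# +_) eq))

  logFrom1 : ∀ x → 1# ≤ x → ∃ (IsLUB (ExpBelow x))
  logFrom1 x 1≤x = complete (ExpBelow x) (ExpBelow-inhabited x 1≤x) (ExpBelow-bounded x)

  log⁺ : ℝ → ℝ
  log⁺ x with O.compare 1# x
  ... | tri< 1<x _ _ = proj₁ (logFrom1 x (inj₁ 1<x))
  ... | tri≈ _ 1≡x _ = proj₁ (logFrom1 x (inj₂ 1≡x))
  ... | tri> _ _ _   = 0#

  -- The natural logarithm for x > 0: the second summand vanishes for x ≥ 1,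
  -- the first one for 0 < x ≤ 1.  The value for x ≤ 0 is irrelevant.
  log : ℝ → ℝ
  log x = log⁺ x - log⁺ (x ⁻¹)

  -- lim sup u = inf_M sup_{N ≥ M} u N
  IsLimSup : (ℕ → ℝ) → ℝ → Set
  IsLimSup u = IsGLB λ t → ∃[ M ] IsLUB (λ s → ∃[ N ] (M ℕ.≤ N × s ≡ u N)) t

  -- ∣ A ∩ [1 , N] ∣; classically every A is decidable, and the value does not
  -- depend on the decision procedure.
  count : {A : Pred ℕ 0ℓ} → Decidable A → ℕ → ℕ
  count A? N = length (filter A? (applyUpTo suc N))

  -- The term at N = 0 does not affect the lim sup.
  IsUpperDensity : {A : Pred ℕ 0ℓ} → Decidable A → ℝ → Set
  IsUpperDensity A? = IsLimSup λ N → fromℕ (count A? N) ÷ fromℕ N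

module Submission where

-- Write α = c p + g.  All derivatives of elements of a Hardy field have eventually constant sign,
-- hence so have those of g up to the order deg p + 1, and g is eventually monotone.  Since
-- g(2^m) = O(m), there are infinitely many m for which g varies by at most a constant V on
-- [2^m , 2^(m+1)], and among these infinitely many for which g(2^m) lies in a fixed unit interval
-- modulo any prescribed period.
--
-- As deg p ≥ 2, the values of p avoid arbitrarily long intervals modulo suitable Q: if q > 1
-- divides p(n + 1) - p(n), then p is not injective, hence not surjective, modulo q, and the
-- missed residues modulo coprime such q are aligned as in the Chinese remainder theorem.  So
-- c p(n) avoids an interval of length greater than 2V + 5 modulo cQ.  The set A consists of
-- integers near half of this interval, shifted by g(2^m), modulo cQ, taken from a window in
-- which sums of two elements can equal ⌊α(n)⌋ only for n in [2^m , 2^(m+1)].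

open import Defs
open import Level using (0ℓ)
open import Axiom.ExcludedMiddle using (ExcludedMiddle)
open import Algebra.Bundles using (CommutativeRing)
import Algebra.Properties.Ring as RingProperties
import Algebra.Properties.Semiring.Mult as SemiringMult
import Algebra.Solver.Ring
open import Algebra.Solver.Ring.AlmostCommutativeRing using (fromCommutativeRing; _-Raw-AlmostCommutative⟶_)
open import Data.Empty using (⊥; ⊥-elim)
open import Data.Fin.Base using (Fin; toℕ; fromℕ<; punchOut)
import Data.Fin.Properties as FinP
open import Data.Integer.Base as ℤ using (ℤ; -[1+_])
import Data.Integer.Properties as ℤP
import Data.Integer.Solver as ℤSolver
open import Data.List.Base using (List; []; _∷_; [_]; _++_; length; foldr; map; filter; applyUpTo)
import Data.List.Properties as ListP
open import Data.Maybe.Base using (Maybe; just; nothing)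
open import Data.Nat.Base as ℕ using (ℕ; zero; suc; NonZero; _!)
import Data.Nat.Divisibility as ℕD
import Data.Nat.DivMod as ℕM
import Data.Nat.Properties as ℕP
import Data.Nat.Solver as ℕSolver
open import Data.Product.Base using (∃; ∃-syntax; _×_; _,_; proj₁; proj₂)
open import Data.Sum.Base using (_⊎_; inj₁; inj₂)
import Relation.Binary.Construct.StrictToNonStrict as ToNonStrict
open import Relation.Binary.Definitions using (tri<; tri≈; tri>)
open import Relation.Binary.PropositionalEquality hiding ([_])
open import Relation.Binary.Structures using (IsStrictTotalOrder; IsTotalOrder)
open import Relation.Nullary using (¬_; Dec; yes; no)
open import Relation.Nullary.Decidable using (decidable-stable)
open import Relation.Unary using (Pred; Decidable; _∈_; _⊆_)

-- The remainder `g` may be unbounded, and its drift could smear a gap of `c p` modulo `cQ` over all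
-- residues. The gap therefore has to exceed the drift within one scale, and the phase `g (2^m)` has
-- to be nearly the same for all scales in use, since one residue condition on `A` serves them all.
-- Infinitely many such scales suffice because the upper density is a lim sup.
--
-- `g` need not belong to the Hardy field of `α`, which may contain neither the identity nor the
-- constant `c`. Its monotonicity comes from differentiating until the polynomial has vanished and
-- climbing back from the signs.
--
-- Degree at least 2 matters twice. It makes the increments of `p` unbounded, which provides the
-- divisors `q`; and it makes `c p` at least triple when its argument doubles. With `u = c p (2^m)`
-- and an error of one tenth, `α` is at most 1.1 `u` up to `2^m` and at least 2.7 `u` from `2^(m+1)`
-- on. If `10hL` is just below `u`, sums in `(12hL , 26hL]` fit between these bounds with room for
-- rounding; hence the constants 10, 12, 13 and 26.

module OrderedField (R : CompleteOrderedField) where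
  open RealAnalysis R
  private
    module CR = CommutativeRing commutativeRing
    module O = IsStrictTotalOrder isStrictTotalOrder
    module RP = RingProperties CR.ring
    module M = SemiringMult CR.semiring
    module N = ToNonStrict _≡_ _<_

  -- Integer numerals in ℝ and a ring solver for ℝ.

  fromℕ-+ : ∀ m n → fromℕ (m ℕ.+ n) ≡ fromℕ m + fromℕ n
  fromℕ-+ = M.×-homo-+ 1#

  fromℕ-* : ∀ m n → fromℕ (m ℕ.* n) ≡ fromℕ m * fromℕ n
  fromℕ-* = M.×1-homo-*

  fromℤ-⊖ : ∀ m n → fromℤ (m ℤ.⊖ n) ≡ fromℕ m - fromℕ n
  fromℤ-⊖ zero zero = sym (CR.-‿inverseʳ 0#)
  fromℤ-⊖ zero (suc n) = sym (CR.+-identityˡ _)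
  fromℤ-⊖ (suc m) zero = sym (trans (cong (fromℕ (suc m) +_) RP.-0#≈0#) (CR.+-identityʳ _))
  fromℤ-⊖ (suc m) (suc n) = begin
    fromℤ (suc m ℤ.⊖ suc n)                    ≡⟨ cong fromℤ (ℤP.[1+m]⊖[1+n]≡m⊖n m n) ⟩
    fromℤ (m ℤ.⊖ n)                            ≡⟨ fromℤ-⊖ m n ⟩
    a - b                                      ≡⟨ cong (_- b) (CR.+-identityˡ a) ⟨
    0# + a - b                                 ≡⟨ cong (λ z → z + a - b) (CR.-‿inverseʳ 1#) ⟨
    1# - 1# + a - b                            ≡⟨ cong (_- b) (CR.+-assoc 1# (- 1#) a) ⟩
    1# + (- 1# + a) - b                        ≡⟨ cong (λ z → 1# + z - b) (CR.+-comm (- 1#) a) ⟩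
    1# + (a - 1#) - b                          ≡⟨ cong (_- b) (CR.+-assoc 1# a (- 1#)) ⟨
    1# + a - 1# - b                            ≡⟨ CR.+-assoc (1# + a) (- 1#) (- b) ⟩
    1# + a + (- 1# - b)                        ≡⟨ cong (1# + a +_) (RP.-‿+-comm 1# b) ⟩
    1# + a - (1# + b)                          ∎
    where
    open ≡-Reasoning
    a = fromℕ m
    b = fromℕ n

  fromℤ-neg : ∀ i → fromℤ (ℤ.- i) ≡ - fromℤ i
  fromℤ-neg (ℤ.+ zero) = sym RP.-0#≈0#
  fromℤ-neg (ℤ.+ suc n) = refl
  fromℤ-neg -[1+ n ] = sym (RP.-‿involutive _)

  fromℤ-+ : ∀ i j → fromℤ (i ℤ.+ j) ≡ fromℤ i + fromℤ j
  fromℤ-+ (ℤ.+ m) (ℤ.+ n) = fromℕ-+ m n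
  fromℤ-+ (ℤ.+ m) -[1+ n ] = fromℤ-⊖ m (suc n)
  fromℤ-+ -[1+ m ] (ℤ.+ n) = trans (fromℤ-⊖ n (suc m)) (CR.+-comm _ _)
  fromℤ-+ -[1+ m ] -[1+ n ] = begin
    - fromℕ (suc (suc (m ℕ.+ n)))      ≡⟨ cong (λ k → - fromℕ (suc k)) (ℕP.+-suc m n) ⟨
    - fromℕ (suc m ℕ.+ suc n)          ≡⟨ cong -_ (fromℕ-+ (suc m) (suc n)) ⟩
    - (fromℕ (suc m) + fromℕ (suc n))  ≡⟨ RP.-‿+-comm _ _ ⟨
    - fromℕ (suc m) - fromℕ (suc n)    ∎
    where open ≡-Reasoning

  fromℤ-* : ∀ i j → fromℤ (i ℤ.* j) ≡ fromℤ i * fromℤ j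
  fromℤ-* (ℤ.+ m) (ℤ.+ n) = trans (cong fromℤ (ℤP.+◃n≡+n (m ℕ.* n))) (fromℕ-* m n)
  fromℤ-* (ℤ.+ zero) -[1+ n ] = sym (CR.zeroˡ _)
  fromℤ-* (ℤ.+ suc m) -[1+ n ] =
    trans (cong -_ (fromℕ-* (suc m) (suc n))) (RP.-‿distribʳ-* _ _)
  fromℤ-* -[1+ m ] (ℤ.+ zero) =
    trans (cong (λ k → fromℤ (ℤ.sign -[1+ m ] ℤ.◃ k)) (ℕP.*-zeroʳ m)) (sym (CR.zeroʳ _))
  fromℤ-* -[1+ m ] (ℤ.+ suc n) =
    trans (cong -_ (fromℕ-* (suc m) (suc n))) (RP.-‿distribˡ-* _ _)
  fromℤ-* -[1+ m ] -[1+ n ] =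
    trans (fromℕ-* (suc m) (suc n)) (sym (trans (sym (RP.-‿distribˡ-* _ _))
      (trans (cong -_ (sym (RP.-‿distribʳ-* _ _))) (RP.-‿involutive _))))

  -- A variant of fromℤ sending 1 to 1# on the nose, so that the solver below recognises 1#.
  private
    embed : ℤ → ℝ
    embed (ℤ.+ suc zero) = 1#
    embed i            = fromℤ i

    embed≡fromℤ : ∀ i → embed i ≡ fromℤ i
    embed≡fromℤ (ℤ.+ zero)        = refl
    embed≡fromℤ (ℤ.+ suc zero)    = sym (CR.+-identityʳ 1#)
    embed≡fromℤ (ℤ.+ suc (suc n)) = refl
    embed≡fromℤ -[1+ n ]        = refl

    embedding : ℤ.+-*-rawRing -Raw-AlmostCommutative⟶ fromCommutativeRing commutativeRing
    embedding = record
      { ⟦_⟧    = embed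
      ; +-homo = λ i j → trans (embed≡fromℤ (i ℤ.+ j))
          (trans (fromℤ-+ i j) (sym (cong₂ _+_ (embed≡fromℤ i) (embed≡fromℤ j))))
      ; *-homo = λ i j → trans (embed≡fromℤ (i ℤ.* j))
          (trans (fromℤ-* i j) (sym (cong₂ _*_ (embed≡fromℤ i) (embed≡fromℤ j))))
      ; -‿homo = λ i → trans (embed≡fromℤ (ℤ.- i))
          (trans (fromℤ-neg i) (sym (cong -_ (embed≡fromℤ i))))
      ; 0-homo = refl
      ; 1-homo = refl
      }

    embed≟ : ∀ i j → Maybe (embed i ≡ embed j)
    embed≟ i j with i ℤP.≟ j
    ... | yes i≡j = just (cong embed i≡j)
    ... | no  _   = nothing

  open Algebra.Solver.Ring ℤ.+-*-rawRing (fromCommutativeRing commutativeRing) embedding embed≟ public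
    using (solve; con; _:+_; _:*_; :-_; _:-_; _:=_; Polynomial)

  num : ∀ {n} → ℕ → Polynomial n
  num k = con (ℤ.+ k)

  -- Order, division and absolute value.

  open IsTotalOrder (N.isTotalOrder isStrictTotalOrder) public
    using () renaming (refl to ≤-refl; trans to ≤-trans; antisym to ≤-antisym; total to ≤-total)

  <-trans : ∀ {x y z} → x < y → y < z → x < z
  <-trans = O.trans

  <-irrefl : ∀ {x} → ¬ x < x
  <-irrefl = O.irrefl refl

  <-≤-trans : ∀ {x y z} → x < y → y ≤ z → x < z
  <-≤-trans = N.<-≤-trans O.trans O.<-respʳ-≈

  ≤-<-trans : ∀ {x y z} → x ≤ y → y < z → x < z
  ≤-<-trans = N.≤-<-trans sym O.trans O.<-respˡ-≈

  ≤-or-> : ∀ x y → x ≤ y ⊎ y < x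
  ≤-or-> x y with O.compare x y
  ... | tri< x<y _ _ = inj₁ (inj₁ x<y)
  ... | tri≈ _ x≡y _ = inj₁ (inj₂ x≡y)
  ... | tri> _ _ y<x = inj₂ y<x

  ≤⇒≯ : ∀ {x y} → x ≤ y → ¬ y < x
  ≤⇒≯ x≤y y<x = <-irrefl (≤-<-trans x≤y y<x)

  ≮⇒≥ : ∀ {x y} → ¬ x < y → y ≤ x
  ≮⇒≥ {x} {y} x≮y with ≤-or-> y x
  ... | inj₁ y≤x = y≤x
  ... | inj₂ x<y = ⊥-elim (x≮y x<y)

  ≰⇒> : ∀ {x y} → ¬ x ≤ y → y < x
  ≰⇒> {x} {y} x≰y with ≤-or-> x y
  ... | inj₁ x≤y = ⊥-elim (x≰y x≤y)
  ... | inj₂ y<x = y<x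

  -- Inequalities are proved by exhibiting the difference of the two sides as a combination
  -- of nonnegative terms; the ring solver checks the identity.
  gap< : ∀ {x y} → x < y → 0# < y - x
  gap< {x} {y} x<y = subst₂ _<_ (CR.-‿inverseˡ x) (CR.+-comm (- x) y) (+-monoʳ-< (- x) x<y)

  gap≤ : ∀ {x y} → x ≤ y → 0# ≤ y - x
  gap≤ (inj₁ x<y) = inj₁ (gap< x<y)
  gap≤ {x} (inj₂ refl) = inj₂ (sym (CR.-‿inverseʳ x))

  by< : ∀ {x y e} → 0# < e → e ≡ y - x → x < y
  by< {x} {y} 0<e refl = subst₂ _<_ (CR.+-identityʳ x)
    (solve 2 (λ x y → x :+ (y :- x) := y) refl x y) (+-monoʳ-< x 0<e)

  by≤ : ∀ {x y e} → 0# ≤ e → e ≡ y - x → x ≤ y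
  by≤ (inj₁ 0<e) eq = inj₁ (by< 0<e eq)
  by≤ {x} {y} (inj₂ refl) eq = inj₂ (sym (trans (solve 2 (λ x y → y := (y :- x) :+ x) refl x y)
    (trans (cong (_+ x) (sym eq)) (CR.+-identityˡ x))))

  by⊥ : ∀ {e} → 0# < e → e ≡ 0# → ⊥
  by⊥ 0<e refl = <-irrefl 0<e

  infixl 6 _⊕_ _≤⊕<_ _<⊕≤_
  infixl 7 _⊗_

  _<⊕≤_ : ∀ {x y} → 0# < x → 0# ≤ y → 0# < x + y
  _<⊕≤_ {x} {y} 0<x 0≤y = <-≤-trans 0<x
    (by≤ 0≤y (solve 2 (λ x y → y := x :+ y :- x) refl x y))

  _≤⊕<_ : ∀ {x y} → 0# ≤ x → 0# < y → 0# < x + y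
  _≤⊕<_ {x} {y} 0≤x 0<y = subst (0# <_) (CR.+-comm y x) (0<y <⊕≤ 0≤x)

  _⊕_ : ∀ {x y} → 0# ≤ x → 0# ≤ y → 0# ≤ x + y
  inj₁ 0<x  ⊕ 0≤y = inj₁ (0<x <⊕≤ 0≤y)
  inj₂ refl ⊕ 0≤y = subst (0# ≤_) (sym (CR.+-identityˡ _)) 0≤y

  _⊗_ : ∀ {x y} → 0# ≤ x → 0# ≤ y → 0# ≤ x * y
  inj₁ 0<x  ⊗ inj₁ 0<y  = inj₁ (*-pos 0<x 0<y)
  inj₁ 0<x  ⊗ inj₂ refl = inj₂ (sym (CR.zeroʳ _))
  inj₂ refl ⊗ _         = inj₂ (sym (CR.zeroˡ _))

  +-mono-≤ : ∀ {w x y z} → w ≤ x → y ≤ z → w + y ≤ x + z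
  +-mono-≤ {w} {x} {y} {z} w≤x y≤z = by≤ (gap≤ w≤x ⊕ gap≤ y≤z)
    (solve 4 (λ w x y z → x :- w :+ (z :- y) := x :+ z :- (w :+ y)) refl w x y z)

  ≡⇒≤ : ∀ {x y} → x ≡ y → x ≤ y
  ≡⇒≤ = inj₂

  ≡⇒≥ : ∀ {x y} → x ≡ y → y ≤ x
  ≡⇒≥ eq = inj₂ (sym eq)

  0<1 : 0# < 1#
  0<1 with O.compare 0# 1#
  ... | tri< 0<1 _ _ = 0<1
  ... | tri≈ _ 0≡1 _ = ⊥-elim (0≢1 0≡1)
  ... | tri> _ _ 1<0 = by< (*-pos (gap< 1<0) (gap< 1<0))
        (solve 0 ((num 0 :- num 1) :* (num 0 :- num 1) := num 1 :- num 0) refl)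

  0≤1 : 0# ≤ 1#
  0≤1 = inj₁ 0<1

  ^-nonneg : ∀ {x} → 0# ≤ x → ∀ n → 0# ≤ x ^ n
  ^-nonneg 0≤x zero    = 0≤1
  ^-nonneg 0≤x (suc n) = 0≤x ⊗ ^-nonneg 0≤x n

  fromℕ-nonneg : ∀ n → 0# ≤ fromℕ n
  fromℕ-nonneg zero    = ≤-refl
  fromℕ-nonneg (suc n) = 0≤1 ⊕ fromℕ-nonneg n

  fromℕ-pos : ∀ {n} → 0 ℕ.< n → 0# < fromℕ n
  fromℕ-pos (ℕ.s≤s {n = n} _) = 0<1 <⊕≤ fromℕ-nonneg n

  fromℕ-1≤ : ∀ {n} → 1 ℕ.≤ n → 1# ≤ fromℕ n
  fromℕ-1≤ (ℕ.s≤s {n = n} _) = by≤ (fromℕ-nonneg n) (solve 1 (λ n → n := num 1 :+ n :- num 1) refl (fromℕ n))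

  fromℕ-mono : ∀ {m n} → m ℕ.≤ n → fromℕ m ≤ fromℕ n
  fromℕ-mono (ℕ.z≤n {n}) = fromℕ-nonneg n
  fromℕ-mono (ℕ.s≤s m≤n) = by≤ (gap≤ (fromℕ-mono m≤n))
    (solve 2 (λ m n → n :- m := num 1 :+ n :- (num 1 :+ m)) refl _ _)

  fromℕ-mono-< : ∀ {m n} → m ℕ.< n → fromℕ m < fromℕ n
  fromℕ-mono-< m<n = <-≤-trans
    (by< 0<1 (solve 1 (λ m → num 1 := num 1 :+ m :- m) refl _)) (fromℕ-mono m<n)

  fromℕ-cancel-< : ∀ {m n} → fromℕ m < fromℕ n → m ℕ.< n
  fromℕ-cancel-< m<n = ℕP.≰⇒> λ n≤m → ≤⇒≯ (fromℕ-mono n≤m) m<n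

  fromℕ-cancel-≤ : ∀ {m n} → fromℕ m ≤ fromℕ n → m ℕ.≤ n
  fromℕ-cancel-≤ m≤n = ℕP.≮⇒≥ λ n<m → ≤⇒≯ m≤n (fromℕ-mono-< n<m)

  fromℤ-- : ∀ i j → fromℤ (i ℤ.- j) ≡ fromℤ i - fromℤ j
  fromℤ-- i j = trans (fromℤ-+ i (ℤ.- j)) (cong (fromℤ i +_) (fromℤ-neg j))

  fromℤ-mono : ∀ {i j} → i ℤ.≤ j → fromℤ i ≤ fromℤ j
  fromℤ-mono {i} {j} i≤j = by≤ (fromℕ-nonneg ℤ.∣ j ℤ.- i ∣)
    (trans (cong fromℤ (ℤP.0≤i⇒+∣i∣≡i (ℤP.i≤j⇒0≤j-i i≤j))) (fromℤ-- j i))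

  fromℤ-cancel-< : ∀ {i j} → fromℤ i < fromℤ j → i ℤ.< j
  fromℤ-cancel-< i<j = ℤP.≰⇒> λ j≤i → ≤⇒≯ (fromℤ-mono j≤i) i<j

  fromℤ-cancel-≤ : ∀ {i j} → fromℤ i ≤ fromℤ j → i ℤ.≤ j
  fromℤ-cancel-≤ {i} {j} i≤j = ℤP.≮⇒≥ λ j<i → ≤⇒≯ i≤j (<-≤-trans
    (by< 0<1 (solve 1 (λ j → num 1 := num 1 :+ j :- j) refl (fromℤ j)))
    (subst (_≤ fromℤ i) (trans (fromℤ-+ (ℤ.+ 1) j) (cong (_+ fromℤ j) (CR.+-identityʳ 1#)))
      (fromℤ-mono (ℤP.i<j⇒suc[i]≤j j<i))))

  x≢0 : ∀ {x} → 0# < x → x ≢ 0#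
  x≢0 0<x refl = <-irrefl 0<x

  ⁻¹-pos : ∀ {x} → 0# < x → 0# < x ⁻¹
  ⁻¹-pos {x} 0<x = ≰⇒> λ x⁻¹≤0 → by⊥
    (inj₁ 0<x ⊗ gap≤ x⁻¹≤0 ⊕ gap≤ (≡⇒≥ (⁻¹-inverseʳ x (x≢0 0<x))) ≤⊕< 0<1)
    (solve 2 (λ x y → x :* (num 0 :- y) :+ (x :* y :- num 1) :+ num 1 := num 0) refl x (x ⁻¹))

  ÷-* : ∀ x {y} → 0# < y → x ÷ y * y ≡ x
  ÷-* x {y} 0<y = begin
    x * y ⁻¹ * y    ≡⟨ CR.*-assoc x (y ⁻¹) y ⟩
    x * (y ⁻¹ * y)  ≡⟨ cong (x *_) (CR.*-comm (y ⁻¹) y) ⟩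
    x * (y * y ⁻¹)  ≡⟨ cong (x *_) (⁻¹-inverseʳ y (x≢0 0<y)) ⟩
    x * 1#          ≡⟨ CR.*-identityʳ x ⟩
    x               ∎
    where open ≡-Reasoning

  *-cancelʳ-≤ : ∀ {x y z} → 0# < z → x * z ≤ y * z → x ≤ y
  *-cancelʳ-≤ {x} {y} {z} 0<z xz≤yz = ≮⇒≥ λ y<x → by⊥ (gap≤ xz≤yz ≤⊕< *-pos (gap< y<x) 0<z)
    (solve 3 (λ x y z → (y :* z :- x :* z) :+ (x :- y) :* z := num 0) refl x y z)

  *-cancelʳ-< : ∀ {x y z} → 0# < z → x * z < y * z → x < y
  *-cancelʳ-< {x} {y} {z} 0<z xz<yz = ≰⇒> λ y≤x → by⊥ (gap< xz<yz <⊕≤ gap≤ y≤x ⊗ inj₁ 0<z)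
    (solve 3 (λ x y z → (y :* z :- x :* z) :+ (x :- y) :* z := num 0) refl x y z)

  ≤÷⇒*≤ : ∀ {x y z} → 0# < z → x ≤ y ÷ z → x * z ≤ y
  ≤÷⇒*≤ {x} {y} {z} 0<z x≤y÷z = by≤ (gap≤ x≤y÷z ⊗ inj₁ 0<z ⊕ gap≤ (≡⇒≤ (÷-* y 0<z)))
    (solve 4 (λ q x z y → (q :- x) :* z :+ (y :- q :* z) := y :- x :* z) refl (y ÷ z) x z y)

  ÷≤ : ∀ {x k} → 0# ≤ x → 1# ≤ k → x ÷ k ≤ x
  ÷≤ {x} {k} 0≤x 1≤k = let 0<k = <-≤-trans 0<1 1≤k in *-cancelʳ-≤ 0<k
    (by≤ (gap≤ (≡⇒≤ (÷-* x 0<k)) ⊕ 0≤x ⊗ gap≤ 1≤k)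
      (solve 3 (λ x k q → x :- q :* k :+ x :* (k :- num 1) := x :* k :- q :* k) refl x k (x ÷ k)))

  ≤÷ : ∀ {x y z} → 0# < z → x * z ≤ y → x ≤ y ÷ z
  ≤÷ {x} {y} {z} 0<z xz≤y = *-cancelʳ-≤ 0<z (≤-trans xz≤y (≡⇒≥ (÷-* y 0<z)))

  *-mono-≤ : ∀ {w x y z} → 0# ≤ w → 0# ≤ z → w ≤ x → y ≤ z → w * y ≤ x * z
  *-mono-≤ {w} {x} {y} {z} 0≤w 0≤z w≤x y≤z = by≤ (0≤w ⊗ gap≤ y≤z ⊕ gap≤ w≤x ⊗ 0≤z)
    (solve 4 (λ w x y z → w :* (z :- y) :+ (x :- w) :* z := x :* z :- w :* y) refl w x y z)

  ≤∣∣ : ∀ x → x ≤ ∣ x ∣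
  ≤∣∣ x with O.compare x 0#
  ... | tri< x<0 _ _ = by≤ (inj₁ (gap< x<0) ⊕ inj₁ (gap< x<0))
        (solve 1 (λ x → (num 0 :- x) :+ (num 0 :- x) := (:- x) :- x) refl x)
  ... | tri≈ _ _ _ = ≤-refl
  ... | tri> _ _ _ = ≤-refl

  -≤∣∣ : ∀ x → - x ≤ ∣ x ∣
  -≤∣∣ x with O.compare x 0#
  ... | tri< x<0 _ _ = ≤-refl
  ... | tri≈ _ refl _ = ≡⇒≤ RP.-0#≈0#
  ... | tri> _ _ 0<x = by≤ (inj₁ 0<x ⊕ inj₁ 0<x) (solve 1 (λ x → x :+ x := x :- (:- x)) refl x)

  ∣∣-< : ∀ {x b} → - b < x → x < b → ∣ x ∣ < b
  ∣∣-< {x} {b} -b<x x<b with O.compare x 0#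
  ... | tri< _ _ _ = by< (gap< -b<x) (solve 2 (λ x b → x :- (:- b) := b :- (:- x)) refl x b)
  ... | tri≈ _ _ _ = x<b
  ... | tri> _ _ _ = x<b

  ∣∣-≤ : ∀ {x b} → - b ≤ x → x ≤ b → ∣ x ∣ ≤ b
  ∣∣-≤ {x} {b} -b≤x x≤b with O.compare x 0#
  ... | tri< _ _ _ = by≤ (gap≤ -b≤x) (solve 2 (λ x b → x :- (:- b) := b :- (:- x)) refl x b)
  ... | tri≈ _ _ _ = x≤b
  ... | tri> _ _ _ = x≤b

  ∣∣<⇒< : ∀ {x b} → ∣ x ∣ < b → x < b
  ∣∣<⇒< = ≤-<-trans (≤∣∣ _)

  ∣∣<⇒-< : ∀ {x b} → ∣ x ∣ < b → - b < x
  ∣∣<⇒-< {x} {b} ∣x∣<b = by< (gap< (≤-<-trans (-≤∣∣ x) ∣x∣<b))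
    (solve 2 (λ x b → b :- (:- x) := x :- (:- b)) refl x b)

-- Consequences of completeness: integer parts, real induction, monotonicity from derivatives.

module Analysis (em : ExcludedMiddle 0ℓ) (R : CompleteOrderedField) where
  open RealAnalysis R
  open OrderedField R
  private
    module CR = CommutativeRing commutativeRing

  -- If the naturals had a supremum `s`, then `s - 1#` would bound them too, because the successor
  -- of each is again a natural.
  archimedean : ∀ x → ∃[ n ] x < fromℕ n
  archimedean x with em {∃[ n ] x < fromℕ n}
  ... | yes p = p
  ... | no ¬p = ⊥-elim (by⊥ (gap≤ (least (s - 1#) bound) ≤⊕< 0<1)
                  (solve 1 (λ s → s :- num 1 :- s :+ num 1 := num 0) refl s))
    where
    S : Pred ℝ 0ℓ
    S y = ∃[ n ] y ≡ fromℕ n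
    lub = complete S (0# , 0 , refl) (x , λ { _ (n , refl) → ≮⇒≥ λ x<n → ¬p (n , x<n) })
    s = proj₁ lub
    least = proj₂ (proj₂ lub)
    bound : IsUpperBound S (s - 1#)
    bound _ (n , refl) = by≤ (gap≤ (proj₁ (proj₂ lub) (fromℕ (suc n)) (suc n , refl)))
      (solve 2 (λ s n → s :- (num 1 :+ n) := s :- num 1 :- n) refl s (fromℕ n))

  abstract
    archimedean-* : ∀ {l} → 0# < l → ∀ x → ∃[ n ] x < fromℕ n * l
    archimedean-* {l} 0<l x with archimedean (x ÷ l)
    ... | n , lt = n , subst (_< fromℕ n * l) (÷-* x 0<l)
          (by< (*-pos (gap< lt) 0<l) (solve 3 (λ q l n → (n :- q) :* l := n :* l :- q :* l) refl _ _ _))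

  abstract
    -- `N` is a search bound: the search descends from it to the first multiple of `l` that does not
    -- exceed `x`.
    floorℕ : ∀ {l} N x → 0# ≤ x → x < fromℕ N * l →
             ∃[ k ] (k ℕ.< N × fromℕ k * l ≤ x × x < fromℕ k * l + l)
    floorℕ {l} zero x 0≤x x<0 = ⊥-elim (≤⇒≯ 0≤x (subst (x <_) (CR.zeroˡ l) x<0))
    floorℕ {l} (suc N) x 0≤x x<1+N with ≤-or-> (fromℕ N * l) x
    ... | inj₁ N≤x = N , ℕP.≤-refl , N≤x , subst (x <_)
          (solve 2 (λ n l → (num 1 :+ n) :* l := n :* l :+ l) refl (fromℕ N) l) x<1+N
    ... | inj₂ x<N with floorℕ N x 0≤x x<N
    ...   | k , k<N , lo , hi = k , ℕP.m<n⇒m<1+n k<N , lo , hi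

  private
    floor-shift : ∀ {l} x n N → - x < fromℕ n * l → x + fromℕ n * l < fromℕ N * l →
                  ∃[ k ] (fromℤ k * l ≤ x × x < fromℤ k * l + l)
    floor-shift {l} x n N -x<n x+n<N = ℤ.+ k ℤ.- ℤ.+ n
      , subst (λ z → z * l ≤ x) (sym (fromℤ-- (ℤ.+ k) (ℤ.+ n))) (by≤ (gap≤ lo)
          (solve 4 (λ x n k l → x :+ n :* l :- k :* l := x :- (k :- n) :* l) refl x (fromℕ n) (fromℕ k) l))
      , subst (λ z → x < z * l + l) (sym (fromℤ-- (ℤ.+ k) (ℤ.+ n))) (by< (gap< hi)
          (solve 4 (λ x n k l → k :* l :+ l :- (x :+ n :* l) := (k :- n) :* l :+ l :- x) refl x (fromℕ n) (fromℕ k) l))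
      where
      0≤x+n : 0# ≤ x + fromℕ n * l
      0≤x+n = by≤ (gap≤ (inj₁ -x<n)) (solve 2 (λ x y → y :- (:- x) := x :+ y :- num 0) refl x _)
      floor = floorℕ N (x + fromℕ n * l) 0≤x+n x+n<N
      k = proj₁ floor
      lo = proj₁ (proj₂ (proj₂ floor))
      hi = proj₂ (proj₂ (proj₂ floor))

  abstract
    floorℤ : ∀ {l} → 0# < l → ∀ x → ∃[ k ] (fromℤ k * l ≤ x × x < fromℤ k * l + l)
    floorℤ 0<l x =
      let n , -x<n = archimedean-* 0<l (- x)
          N , x+n<N = archimedean-* 0<l (x + fromℕ n * _)
      in floor-shift x n N -x<n x+n<N

  abstract
    upper : ∀ x y → ∃[ z ] (x ≤ z × y ≤ z)
    upper x y with ≤-total x y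
    ... | inj₁ x≤y = y , x≤y , ≤-refl
    ... | inj₂ y≤x = x , ≤-refl , y≤x

  abstract
    lowerPos : ∀ {x y} → 0# < x → 0# < y → ∃[ z ] (0# < z × z ≤ x × z ≤ y)
    lowerPos {x} {y} 0<x 0<y with ≤-total x y
    ... | inj₁ x≤y = x , 0<x , ≤-refl , x≤y
    ... | inj₂ y≤x = y , 0<y , y≤x , ≤-refl

  infixr 5 _∧∞_
  _∧∞_ : ∀ {P Q : Pred ℝ 0ℓ} → Eventually P → Eventually Q → Eventually (λ x → P x × Q x)
  (a , p) ∧∞ (b , q) with upper a b
  ... | c , a≤c , b≤c = c , λ x c<x → p x (≤-<-trans a≤c c<x) , q x (≤-<-trans b≤c c<x)

  map∞ : ∀ {P Q : Pred ℝ 0ℓ} → (∀ x → P x → Q x) → Eventually P → Eventually Q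
  map∞ f (a , p) = a , λ x a<x → f x (p x a<x)

  ½ : ℝ
  ½ = (1# + 1#) ⁻¹

  0<2 : 0# < 1# + 1#
  0<2 = 0<1 <⊕≤ 0≤1

  0<½ : 0# < ½
  0<½ = ⁻¹-pos 0<2

  ½+½ : ½ + ½ ≡ 1#
  ½+½ = trans (solve 1 (λ y → y :+ y := (num 1 :+ num 1) :* y) refl ½)
    (⁻¹-inverseʳ (1# + 1#) (x≢0 0<2))

  half< : ∀ {x} → 0# < x → x * ½ < x
  half< {x} 0<x = by< (*-pos 0<x 0<½) (trans
    (solve 2 (λ x h → x :* h := x :* (h :+ h) :- x :* h) refl x ½)
    (cong (_- x * ½) (trans (cong (x *_) ½+½) (CR.*-identityʳ x))))

  private
    module _ (_~_ : ℝ → ℝ → Set) (~-trans : ∀ {x y z} → x ~ y → y ~ z → x ~ z) {x y : ℝ} where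

      Reached : Pred ℝ 0ℓ
      Reached t = t ≤ y × x ~ t

      Neighbourhood : ℝ → ℝ → Set
      Neighbourhood s δ = (∀ t → s - δ < t → t ≤ s → t ~ s) × (∀ t → s ≤ t → t < s + δ → s ~ t)

      -- Some reached point lies within `δ` to the left of the supremum, and the left half of the
      -- neighbourhood carries the relation on to `s`.
      supremum-reached : ∀ {s δ} → IsLUB Reached s → 0# < δ → Neighbourhood s δ → x ~ s
      supremum-reached {s} {δ} (ub , least) 0<δ (left , _) with em {∃[ t ] (Reached t × s - δ < t)}
      ... | yes (t , t∈S , lt) = ~-trans (proj₂ t∈S) (left t lt (ub t t∈S))
      ... | no  none = ⊥-elim (by⊥
            (gap≤ (least (s - δ) λ t t∈S → ≮⇒≥ λ lt → none (t , t∈S , lt)) ≤⊕< 0<δ)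
            (solve 2 (λ s d → s :- d :- s :+ d := num 0) refl s δ))

      -- If `s < y`, a point beyond `s` would still be reached: `y` itself when it is within `δ` of
      -- `s`, and `s + δ * ½` otherwise.
      supremum-end : ∀ {s δ} → IsLUB Reached s → 0# < δ → Neighbourhood s δ → y ≤ s
      supremum-end {s} {δ} lub 0<δ nbhd = ≮⇒≥ λ s<y → advance s<y (≤-or-> (s + δ) y)
        where
        beyond : ∀ t → s < t → t ≤ y → t < s + δ → ⊥
        beyond t s<t t≤y t<s+δ = ≤⇒≯ (proj₁ lub t
          (t≤y , ~-trans (supremum-reached lub 0<δ nbhd) (proj₂ nbhd t (inj₁ s<t) t<s+δ))) s<t
        mid< : s + δ * ½ < s + δ
        mid< = +-monoʳ-< s (half< 0<δ)
        advance : s < y → s + δ ≤ y ⊎ y < s + δ → ⊥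
        advance s<y (inj₂ y<s+δ) = beyond y s<y ≤-refl y<s+δ
        advance s<y (inj₁ s+δ≤y) = beyond (s + δ * ½)
          (by< (*-pos 0<δ 0<½) (solve 2 (λ s e → e := s :+ e :- s) refl s (δ * ½)))
          (≤-trans (inj₁ mid<) s+δ≤y) mid<

  abstract
    -- "Real induction": the supremum of the points ≤ y related to x must be y.
    local⇒global : (_~_ : ℝ → ℝ → Set) → (∀ {x y z} → x ~ y → y ~ z → x ~ z) →
      ∀ {x y} → x ≤ y →
      (∀ s → x ≤ s → ∃[ δ ] (0# < δ × (∀ t → s - δ < t → t ≤ s → t ~ s)
                                     × (∀ t → s ≤ t → t < s + δ → s ~ t))) →
      x ~ y
    local⇒global _~_ ~-trans {x} {y} x≤y local =
      let δ₀ , 0<δ₀ , _ , right = local x ≤-refl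
          x∈S = x≤y , right x ≤-refl (by< 0<δ₀ (solve 2 (λ x d → d := x :+ d :- x) refl x δ₀))
          s , lub = complete (Reached _~_ ~-trans) (x , x∈S) (y , λ _ → proj₁)
          δ , 0<δ , nbhd = local s (proj₁ lub x x∈S)
          s≡y = ≤-antisym (proj₂ lub y λ _ → proj₁) (supremum-end _~_ ~-trans lub 0<δ nbhd)
      in subst (x ~_) s≡y (supremum-reached _~_ ~-trans lub 0<δ nbhd)

  abstract
    slope : ∀ {f d s} → HasDerivativeAt f d s → ∀ {ε} → 0# < ε →
      ∃[ δ ] (0# < δ × (∀ t → t ≢ s → ∣ t - s ∣ < δ →
        ∃[ k ] (∣ k - d ∣ < ε × f t - f s ≡ k * (t - s))))
    slope {f} {d} {s} D 0<ε with D _ 0<ε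
    ... | δ , 0<δ , near = δ , 0<δ , λ t t≢s lt →
      let h≢0 : t - s ≢ 0#
          h≢0 h≡0 = t≢s (trans (solve 2 (λ t s → t := s :+ (t :- s)) refl t s)
                      (trans (cong (s +_) h≡0) (CR.+-identityʳ s)))
          s+h : s + (t - s) ≡ t
          s+h = solve 2 (λ t s → s :+ (t :- s) := t) refl t s
          k = (f t - f s) ÷ (t - s)
      in k , subst (λ z → ∣ (f z - f s) ÷ (t - s) - d ∣ < _) s+h (near (t - s) h≢0 lt)
           , sym (trans (solve 3 (λ u h i → u :* i :* h := u :* (h :* i)) refl (f t - f s) (t - s) ((t - s) ⁻¹))
               (trans (cong ((f t - f s) *_) (⁻¹-inverseʳ (t - s) h≢0)) (CR.*-identityʳ _)))

  abstract
    near-left : ∀ {s t δ} → 0# < δ → s - δ < t → t ≤ s → ∣ t - s ∣ < δ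
    near-left {s} {t} {δ} 0<δ lt t≤s = ∣∣-<
      (by< (gap< lt) (solve 3 (λ s t d → t :- (s :- d) := t :- s :- (:- d)) refl s t δ))
      (by< (gap≤ t≤s ≤⊕< 0<δ) (solve 3 (λ s t d → s :- t :+ d := d :- (t :- s)) refl s t δ))

  abstract
    near-right : ∀ {s t δ} → 0# < δ → s ≤ t → t < s + δ → ∣ t - s ∣ < δ
    near-right {s} {t} {δ} 0<δ s≤t lt = ∣∣-<
      (by< (gap≤ s≤t ≤⊕< 0<δ) (solve 3 (λ s t d → t :- s :+ d := t :- s :- (:- d)) refl s t δ))
      (by< (gap< lt) (solve 3 (λ s t d → s :+ d :- t := d :- (t :- s)) refl s t δ))

  -- This takes the place of the mean value theorem. For fixed `ε > 0` the relation
  -- `f s ≤ f t + ε * (t - s)` is transitive, and it holds locally because the nearby slopes exceed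
  -- `- ε`; real induction extends it to all of `[x , y]`. Taking `ε = (f x - f y) ÷ (y - x + 1#)`
  -- then refutes `f y < f x`; the added `1#` keeps the divisor positive and leaves one `ε` for
  -- strictness.
  derivative-nonneg⇒mono : ∀ {f f′ : ℝ → ℝ} {a} →
    (∀ x → a < x → HasDerivativeAt f (f′ x) x) → (∀ x → a < x → 0# ≤ f′ x) →
    ∀ {x y} → a < x → x ≤ y → f x ≤ f y
  derivative-nonneg⇒mono {f} {f′} {a} D f′≥0 {x} {y} a<x x≤y = ≮⇒≥ λ fy<fx →
    let g = f x - f y
        K = y - x + 1#
        0<K = gap≤ x≤y ≤⊕< 0<1
        ε = g ÷ K
        0<ε = *-pos (gap< fy<fx) (⁻¹-pos 0<K)
    in by⊥ (gap≤ (almost ε 0<ε) ⊕ gap≤ (≡⇒≤ (÷-* g 0<K)) ≤⊕< 0<ε)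
        (solve 5 (λ a b x y e → (b :+ e :* (y :- x) :- a) :+ (a :- b :- e :* (y :- x :+ num 1)) :+ e := num 0)
          refl (f x) (f y) x y ε)
    where
    almost : ∀ ε → 0# < ε → f x ≤ f y + ε * (y - x)
    almost ε 0<ε = local⇒global (λ s t → f s ≤ f t + ε * (t - s))
      (λ {s} {t} {u} p q → by≤ (gap≤ p ⊕ gap≤ q)
        (solve 7 (λ a b c s t u e → b :+ e :* (t :- s) :- a :+ (c :+ e :* (u :- t) :- b)
          := c :+ e :* (u :- s) :- a) refl (f s) (f t) (f u) s t u ε))
      x≤y local
      where
      local : ∀ s → x ≤ s → ∃[ δ ] (0# < δ × (∀ t → s - δ < t → t ≤ s → f t ≤ f s + ε * (s - t))
                                            × (∀ t → s ≤ t → t < s + δ → f s ≤ f t + ε * (t - s)))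
      local s x≤s with slope {f} {f′ s} {s} (D s (<-≤-trans a<x x≤s)) 0<ε
      ... | δ , 0<δ , near = δ , 0<δ , left , right
        where
        flat : f s ≤ f s + ε * (s - s)
        flat = ≡⇒≤ (solve 3 (λ a e s → a := a :+ e :* (s :- s)) refl (f s) ε s)
        -ε≤ : ∀ {k} → ∣ k - f′ s ∣ < ε → 0# ≤ k + ε
        -ε≤ {k} lt = by≤ (gap≤ (inj₁ (∣∣<⇒-< lt)) ⊕ f′≥0 s (<-≤-trans a<x x≤s))
          (solve 3 (λ k d e → k :- d :- (:- e) :+ d := k :+ e :- num 0) refl k (f′ s) ε)
        left : ∀ t → s - δ < t → t ≤ s → f t ≤ f s + ε * (s - t)
        left t lt (inj₂ refl) = flat
        left t lt (inj₁ t<s) with near t (λ { refl → <-irrefl t<s }) (near-left 0<δ lt (inj₁ t<s))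
        ... | k , ∣k∣ , eq = by≤ (-ε≤ ∣k∣ ⊗ inj₁ (gap< t<s) ⊕ gap≤ (≡⇒≤ eq))
              (solve 6 (λ k e s t a b → (k :+ e) :* (s :- t) :+ (k :* (t :- s) :- (b :- a))
                := a :+ e :* (s :- t) :- b) refl k ε s t (f s) (f t))
        right : ∀ t → s ≤ t → t < s + δ → f s ≤ f t + ε * (t - s)
        right t (inj₂ refl) lt = flat
        right t (inj₁ s<t) lt with near t (λ { refl → <-irrefl s<t }) (near-right 0<δ (inj₁ s<t) lt)
        ... | k , ∣k∣ , eq = by≤ (-ε≤ ∣k∣ ⊗ inj₁ (gap< s<t) ⊕ gap≤ (≡⇒≥ eq))
              (solve 6 (λ k e s t a b → (k :+ e) :* (t :- s) :+ (b :- a :- k :* (t :- s))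
                := b :+ e :* (t :- s) :- a) refl k ε s t (f s) (f t))

-- Limits of difference quotients and rules of differentiation.

module HardyFields (em : ExcludedMiddle 0ℓ) (R : CompleteOrderedField) where
  open RealAnalysis R
  open OrderedField R
  open Analysis em R
  private
    module CR = CommutativeRing commutativeRing

  ∣+∣≤ : ∀ x y → ∣ x + y ∣ ≤ ∣ x ∣ + ∣ y ∣
  ∣+∣≤ x y = ∣∣-≤
    (by≤ (gap≤ (-≤∣∣ x) ⊕ gap≤ (-≤∣∣ y))
      (solve 4 (λ x y a b → a :- (:- x) :+ (b :- (:- y)) := x :+ y :- (:- (a :+ b))) refl x y ∣ x ∣ ∣ y ∣))
    (by≤ (gap≤ (≤∣∣ x) ⊕ gap≤ (≤∣∣ y))
      (solve 4 (λ x y a b → a :- x :+ (b :- y) := a :+ b :- (x :+ y)) refl x y ∣ x ∣ ∣ y ∣))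

  -- Each bound is half the sum of two products of the nonnegative numbers `∣ x ∣ ± x` and
  -- `∣ y ∣ ± y`, which avoids a case distinction on signs.
  ∣*∣≤ : ∀ x y → ∣ x * y ∣ ≤ ∣ x ∣ * ∣ y ∣
  ∣*∣≤ x y = ∣∣-≤
    (*-cancelʳ-≤ 0<2 (by≤ (gap≤ (-≤∣∣ x) ⊗ gap≤ (-≤∣∣ y) ⊕ gap≤ (≤∣∣ x) ⊗ gap≤ (≤∣∣ y))
      (solve 4 (λ x y a b → (a :- (:- x)) :* (b :- (:- y)) :+ (a :- x) :* (b :- y)
        := x :* y :* (num 1 :+ num 1) :- (:- (a :* b)) :* (num 1 :+ num 1)) refl x y ∣ x ∣ ∣ y ∣)))
    (*-cancelʳ-≤ 0<2 (by≤ (gap≤ (-≤∣∣ x) ⊗ gap≤ (≤∣∣ y) ⊕ gap≤ (≤∣∣ x) ⊗ gap≤ (-≤∣∣ y))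
      (solve 4 (λ x y a b → (a :- (:- x)) :* (b :- y) :+ (a :- x) :* (b :- (:- y))
        := a :* b :* (num 1 :+ num 1) :- x :* y :* (num 1 :+ num 1)) refl x y ∣ x ∣ ∣ y ∣)))

  ∣∣-nonneg : ∀ x → 0# ≤ ∣ x ∣
  ∣∣-nonneg x = *-cancelʳ-≤ 0<2 (by≤ (gap≤ (≤∣∣ x) ⊕ gap≤ (-≤∣∣ x))
    (solve 2 (λ x a → a :- x :+ (a :- (:- x)) := a :* (num 1 :+ num 1) :- num 0 :* (num 1 :+ num 1)) refl x ∣ x ∣))

  ∣0∣ : ∀ {x} → x ≡ 0# → ∀ {ε} → 0# < ε → ∣ x ∣ < ε
  ∣0∣ refl {ε} 0<ε = ∣∣-< (by< 0<ε (solve 1 (λ e → e := num 0 :- (:- e)) refl ε)) 0<ε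

  Lim₀ : (ℝ → ℝ) → ℝ → Set
  Lim₀ F ℓ = ∀ ε → 0# < ε → ∃[ δ ] (0# < δ × (∀ h → h ≢ 0# → ∣ h ∣ < δ → ∣ F h - ℓ ∣ < ε))

  lim-cong : ∀ {F G ℓ} → (∀ h → h ≢ 0# → F h ≡ G h) → Lim₀ F ℓ → Lim₀ G ℓ
  lim-cong {ℓ = ℓ} F≡G L ε 0<ε with L ε 0<ε
  ... | δ , 0<δ , near = δ , 0<δ , λ h h≢0 lt →
        subst (λ z → ∣ z - ℓ ∣ < ε) (F≡G h h≢0) (near h h≢0 lt)

  lim-const : ∀ c → Lim₀ (λ _ → c) c
  lim-const c ε 0<ε = 1# , 0<1 , λ h _ _ → ∣0∣ (CR.-‿inverseʳ c) 0<ε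

  lim-id : Lim₀ (λ h → h) 0#
  lim-id ε 0<ε = ε , 0<ε , λ h _ lt →
    subst (λ z → ∣ z ∣ < ε) (solve 1 (λ h → h := h :- num 0) refl h) lt

  lim₂ : ∀ {F G a b} (_∙_ : ℝ → ℝ → ℝ) → Lim₀ F a → Lim₀ G b →
    (∀ ε → 0# < ε → ∃[ η ] (0# < η × (∀ x y → ∣ x - a ∣ < η → ∣ y - b ∣ < η → ∣ (x ∙ y) - (a ∙ b) ∣ < ε))) →
    Lim₀ (λ h → F h ∙ G h) (a ∙ b)
  lim₂ _∙_ LF LG cont ε 0<ε =
    let η , 0<η , near = cont ε 0<ε
        δ₁ , 0<δ₁ , near₁ = LF η 0<η
        δ₂ , 0<δ₂ , near₂ = LG η 0<η
        δ , 0<δ , δ≤δ₁ , δ≤δ₂ = lowerPos 0<δ₁ 0<δ₂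
    in δ , 0<δ , λ h h≢0 lt →
      near _ _ (near₁ h h≢0 (<-≤-trans lt δ≤δ₁)) (near₂ h h≢0 (<-≤-trans lt δ≤δ₂))

  lim-+ : ∀ {F G a b} → Lim₀ F a → Lim₀ G b → Lim₀ (λ h → F h + G h) (a + b)
  lim-+ {a = a} {b} LF LG = lim₂ _+_ LF LG λ ε 0<ε → ε * ½ , *-pos 0<ε 0<½ , near ε
    where
    near : ∀ ε x y → ∣ x - a ∣ < ε * ½ → ∣ y - b ∣ < ε * ½ → ∣ x + y - (a + b) ∣ < ε
    near ε x y p q = ≤-<-trans
      (subst (λ z → ∣ z ∣ ≤ ∣ x - a ∣ + ∣ y - b ∣)
        (solve 4 (λ x y a b → x :- a :+ (y :- b) := x :+ y :- (a :+ b)) refl x y a b) (∣+∣≤ (x - a) (y - b)))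
      (subst (∣ x - a ∣ + ∣ y - b ∣ <_)
        (trans (solve 2 (λ e h → e :* h :+ e :* h := e :* (h :+ h)) refl ε ½)
          (trans (cong (ε *_) ½+½) (CR.*-identityʳ ε)))
        (by< (inj₁ (gap< p) ≤⊕< gap< q)
          (solve 3 (λ u v e → e :- u :+ (e :- v) := e :+ e :- (u :+ v)) refl ∣ x - a ∣ ∣ y - b ∣ (ε * ½))))

  private
    product-error : ∀ {U W A B η ε} → 0# ≤ U → 0# ≤ A → 0# ≤ B → U < η → W < η → 0# < η → η ≤ 1# →
                    η * (A + B + (1# + 1#)) ≤ ε → U * W + A * W + U * B < ε
    product-error {U} {W} {A} {B} {η} {ε} 0≤U 0≤A 0≤B U<η W<η 0<η η≤1 ηK≤ε = by<
      (gap≤ ηK≤ε ⊕ 0≤A ⊗ gap≤ (inj₁ W<η) ⊕ 0≤B ⊗ gap≤ (inj₁ U<η) ⊕ gap≤ (inj₁ U<η)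
       ⊕ 0≤U ⊗ gap≤ (inj₁ (<-≤-trans W<η η≤1)) ≤⊕< 0<η)
      (solve 6 (λ U W A B η ε →
          (ε :- η :* (A :+ B :+ (num 1 :+ num 1))) :+ A :* (η :- W) :+ B :* (η :- U) :+ (η :- U)
          :+ U :* (num 1 :- W) :+ η
          := ε :- (U :* W :+ A :* W :+ U :* B)) refl U W A B η ε)

  ∣*-*∣≤ : ∀ x y a b → ∣ x * y - a * b ∣ ≤ ∣ x - a ∣ * ∣ y - b ∣ + ∣ a ∣ * ∣ y - b ∣ + ∣ x - a ∣ * ∣ b ∣
  ∣*-*∣≤ x y a b = ≤-trans (≡⇒≤ (cong ∣_∣ regroup)) (≤-trans (∣+∣≤ (u * w + a * w) (u * b))
    (+-mono-≤ (≤-trans (∣+∣≤ (u * w) (a * w)) (+-mono-≤ (∣*∣≤ u w) (∣*∣≤ a w))) (∣*∣≤ u b)))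
    where
    u = x - a
    w = y - b
    regroup : x * y - a * b ≡ u * w + a * w + u * b
    regroup = solve 4 (λ x y a b → x :* y :- a :* b
      := (x :- a) :* (y :- b) :+ a :* (y :- b) :+ (x :- a) :* b) refl x y a b

  *-continuous : ∀ a b ε → 0# < ε →
    ∃[ η ] (0# < η × (∀ x y → ∣ x - a ∣ < η → ∣ y - b ∣ < η → ∣ x * y - a * b ∣ < ε))
  *-continuous a b ε 0<ε =
    -- The modulus is `η ≤ ε ÷ (∣ a ∣ + ∣ b ∣ + 2)`. The two absolute values pay for the mixed terms
    -- of the error; of the 2, one unit pays for the quadratic term, using `η ≤ 1#`, and one makes
    -- the estimate strict.
    let 0<K = ∣∣-nonneg a ⊕ ∣∣-nonneg b ≤⊕< 0<2
        η , 0<η , η≤1 , η≤ε÷K = lowerPos 0<1 (*-pos 0<ε (⁻¹-pos 0<K))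
    in η , 0<η , λ x y p q → ≤-<-trans (∣*-*∣≤ x y a b)
         (product-error (∣∣-nonneg (x - a)) (∣∣-nonneg a) (∣∣-nonneg b) p q 0<η η≤1 (≤÷⇒*≤ 0<K η≤ε÷K))

  lim-* : ∀ {F G a b} → Lim₀ F a → Lim₀ G b → Lim₀ (λ h → F h * G h) (a * b)
  lim-* {F} {G} {a} {b} LF LG = lim₂ {F} {G} _*_ LF LG (*-continuous a b)

  derivative-cong : ∀ f g {d x} → (∀ y → f y ≡ g y) → HasDerivativeAt f d x → HasDerivativeAt g d x
  derivative-cong f g f≡g = lim-cong λ h _ → cong₂ (λ u v → (u - v) ÷ h) (f≡g _) (f≡g _)

  derivative-const : ∀ c x → HasDerivativeAt (λ _ → c) 0# x
  derivative-const c x = lim-cong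
    (λ h _ → solve 2 (λ c i → num 0 := (c :- c) :* i) refl c (h ⁻¹)) (lim-const 0#)

  derivative-+ : ∀ f g {a b x} → HasDerivativeAt f a x → HasDerivativeAt g b x →
                 HasDerivativeAt (λ y → f y + g y) (a + b) x
  derivative-+ f g {x = x} Df Dg = lim-cong
    (λ h _ → solve 5 (λ f₁ f₀ g₁ g₀ i → (f₁ :- f₀) :* i :+ (g₁ :- g₀) :* i := (f₁ :+ g₁ :- (f₀ :+ g₀)) :* i)
      refl (f (x + h)) (f x) (g (x + h)) (g x) (h ⁻¹))
    (lim-+ Df Dg)

  derivative-neg : ∀ f {a x} → HasDerivativeAt f a x → HasDerivativeAt (λ y → - f y) (- a) x
  derivative-neg f {a} {x} Df = subst (λ d → HasDerivativeAt (λ y → - f y) d x)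
    (solve 1 (λ a → (:- num 1) :* a := :- a) refl a)
    (lim-cong (λ h _ → solve 3 (λ f₁ f₀ i → (:- num 1) :* ((f₁ :- f₀) :* i) := ((:- f₁) :- (:- f₀)) :* i)
        refl (f (x + h)) (f x) (h ⁻¹))
      (lim-* (lim-const (- 1#)) Df))

  -- The product rule for multiplication by the variable is the only one that Horner evaluation
  -- calls for.
  derivative-x* : ∀ f {a x} → HasDerivativeAt f a x → HasDerivativeAt (λ y → y * f y) (f x + x * a) x
  derivative-x* f {a} {x} Df = subst (λ d → HasDerivativeAt (λ y → y * f y) d x)
    (solve 3 (λ f₀ x a → f₀ :+ a :* num 0 :+ x :* a := f₀ :+ x :* a) refl (f x) x a)
    (lim-cong (λ h h≢0 → trans
        (solve 5 (λ x h i f₁ f₀ → f₀ :+ ((f₁ :- f₀) :* i) :* h :+ x :* ((f₁ :- f₀) :* i)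
          := ((x :+ h) :* f₁ :- x :* f₀) :* i :+ f₀ :* (num 1 :- h :* i))
          refl x h (h ⁻¹) (f (x + h)) (f x))
        (trans (cong (λ z → ((x + h) * f (x + h) - x * f x) ÷ h + f x * (1# - z)) (⁻¹-inverseʳ h h≢0))
          (solve 2 (λ y f₀ → y :+ f₀ :* (num 1 :- num 1) := y) refl (((x + h) * f (x + h) - x * f x) ÷ h) (f x))))
      (lim-+ (lim-+ (lim-const (f x)) (lim-* Df lim-id)) (lim-* (lim-const x) Df)))

  -- Polynomials are represented by a chain of derivatives that ends in zero after `k` steps.
  -- Coefficients do not appear, so real multiples such as `c * eval p x` are covered.
  PolynomialDegree< : ℕ → (ℝ → ℝ) → Set
  PolynomialDegree< zero    f = ∀ x → f x ≡ 0#
  PolynomialDegree< (suc k) f =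
    ∃[ f′ ] (PolynomialDegree< k f′ × (∀ x → HasDerivativeAt f (f′ x) x))

  degree<-cong : ∀ k {f g} → (∀ x → f x ≡ g x) → PolynomialDegree< k f → PolynomialDegree< k g
  degree<-cong zero    f≡g f≡0          = λ x → trans (sym (f≡g x)) (f≡0 x)
  degree<-cong (suc k) {f} {g} f≡g (f′ , p , D) = f′ , p , λ x → derivative-cong f g f≡g (D x)

  degree<-suc : ∀ k {f} → PolynomialDegree< k f → PolynomialDegree< (suc k) f
  degree<-suc zero {f} f≡0 = (λ _ → 0#) , (λ _ → refl) ,
    λ x → derivative-cong (λ _ → 0#) f (λ y → sym (f≡0 y)) (derivative-const 0# x)
  degree<-suc (suc k) (f′ , p , D) = f′ , degree<-suc k p , D

  degree<-+ : ∀ k {f g} → PolynomialDegree< k f → PolynomialDegree< k g →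
              PolynomialDegree< k (λ x → f x + g x)
  degree<-+ zero    f≡0 g≡0 = λ x → trans (cong₂ _+_ (f≡0 x) (g≡0 x)) (CR.+-identityʳ 0#)
  degree<-+ (suc k) {f} {g} (f′ , p , Df) (g′ , q , Dg) =
    (λ x → f′ x + g′ x) , degree<-+ k p q , λ x → derivative-+ f g (Df x) (Dg x)

  degree<-x* : ∀ k {f} → PolynomialDegree< k f → PolynomialDegree< (suc k) (λ x → x * f x)
  degree<-x* zero    f≡0 = degree<-suc zero λ x → trans (cong (x *_) (f≡0 x)) (CR.zeroʳ x)
  degree<-x* (suc k) {f} (f′ , p , D) =
    (λ x → f x + x * f′ x) , degree<-+ (suc k) (f′ , p , D) (degree<-x* k p) , λ x → derivative-x* f (D x)

  degree<-const : ∀ k c → PolynomialDegree< (suc k) (λ _ → c)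
  degree<-const zero    c = (λ _ → 0#) , (λ _ → refl) , derivative-const c
  degree<-const (suc k) c = degree<-suc (suc k) (degree<-const k c)

  degree<-eval : ∀ c p → PolynomialDegree< (length p) (λ x → c * eval p x)
  degree<-eval c []      = λ x → CR.zeroʳ c
  degree<-eval c (a ∷ p) = degree<-cong (suc (length p))
    (λ x → solve 4 (λ c a x v → c :* a :+ x :* (c :* v) := c :* (a :+ x :* v)) refl c (fromℤ a) x (eval p x))
    (degree<-+ (suc (length p)) (degree<-const (length p) (c * fromℤ a))
      (degree<-x* (length p) (degree<-eval c p)))

  -- Eventual sign and monotonicity of a Hardy field element plus a polynomial.

  EventuallySigned EventuallyMonotone : (ℝ → ℝ) → Set
  EventuallySigned f = Eventually (λ x → 0# ≤ f x) ⊎ Eventually (λ x → f x ≤ 0#)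
  EventuallyMonotone f = (∃[ a ] ∀ {x y} → a < x → x ≤ y → f x ≤ f y)
                       ⊎ (∃[ a ] ∀ {x y} → a < x → x ≤ y → f y ≤ f x)

  <+1 : ∀ a → a < a + 1#
  <+1 a = by< 0<1 (solve 1 (λ a → num 1 := a :+ num 1 :- a) refl a)

  -- A monotone function crosses zero at most once: either it reaches the side towards which it
  -- moves and stays there, or it is on the other side throughout.
  monotone⇒signed : ∀ {f} → EventuallyMonotone f → EventuallySigned f
  monotone⇒signed {f} (inj₁ (a , mono)) with em {∃[ x ] (a < x × 0# ≤ f x)}
  ... | yes (x , a<x , 0≤fx) = inj₁ (x , λ y x<y → ≤-trans 0≤fx (mono a<x (inj₁ x<y)))
  ... | no  none = inj₂ (a , λ x a<x → inj₁ (≰⇒> λ 0≤fx → none (x , a<x , 0≤fx)))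
  monotone⇒signed {f} (inj₂ (a , mono)) with em {∃[ x ] (a < x × f x ≤ 0#)}
  ... | yes (x , a<x , fx≤0) = inj₂ (x , λ y x<y → ≤-trans (mono a<x (inj₁ x<y)) fx≤0)
  ... | no  none = inj₁ (a , λ x a<x → inj₁ (≰⇒> λ fx≤0 → none (x , a<x , fx≤0)))

  signed-derivative⇒monotone : ∀ {f f′ : ℝ → ℝ} → Eventually (λ x → HasDerivativeAt f (f′ x) x) →
                               EventuallySigned f′ → EventuallyMonotone f
  signed-derivative⇒monotone {f} {f′} D (inj₁ f′≥0) =
    let a , both = D ∧∞ f′≥0
    in inj₁ (a , λ a<x x≤y → derivative-nonneg⇒mono {f} {f′}
         (λ x a<x → proj₁ (both x a<x)) (λ x a<x → proj₂ (both x a<x)) a<x x≤y)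
  signed-derivative⇒monotone {f} {f′} D (inj₂ f′≤0) =
    let a , both = D ∧∞ f′≤0
    in inj₂ (a , λ {x} {y} a<x x≤y → by≤
         (gap≤ (derivative-nonneg⇒mono {λ x → - f x} {λ x → - f′ x}
           (λ x a<x → derivative-neg f (proj₁ (both x a<x)))
           (λ x a<x → by≤ (gap≤ (proj₂ (both x a<x))) (solve 1 (λ d → num 0 :- d := (:- d) :- num 0) refl (f′ x)))
           a<x x≤y))
         (solve 2 (λ u v → (:- v) :- (:- u) := u :- v) refl (f x) (f y)))

  -- An intermediate value argument by real induction on the implication `0# < f s → 0# < f t`,
  -- which is transitive and holds near every point where `f` is continuous and nonzero.
  continuous-nonzero⇒positive : ∀ {f x y} → x ≤ y → (∀ s → x ≤ s → ContinuousAt f s × f s ≢ 0#) →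
                                0# < f x → 0# < f y
  continuous-nonzero⇒positive {f} {x} x≤y good = local⇒global (λ s t → 0# < f s → 0# < f t)
    (λ p q z → q (p z)) x≤y local
    where
    local : ∀ s → x ≤ s → ∃[ δ ] (0# < δ × (∀ t → s - δ < t → t ≤ s → 0# < f t → 0# < f s)
                                          × (∀ t → s ≤ t → t < s + δ → 0# < f s → 0# < f t))
    local s x≤s with ≤-or-> (f s) 0#
    ... | inj₂ 0<fs =
          let δ , 0<δ , near = proj₁ (good s x≤s) (f s) 0<fs
          in δ , 0<δ , (λ _ _ _ _ → 0<fs)
           , λ t s≤t t<s+δ _ → by< (gap< (∣∣<⇒-< (near t (near-right 0<δ s≤t t<s+δ))))
               (solve 2 (λ a b → b :- a :- (:- a) := b :- num 0) refl (f s) (f t))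
    ... | inj₁ (inj₂ fs≡0) = ⊥-elim (proj₂ (good s x≤s) fs≡0)
    ... | inj₁ (inj₁ fs<0) =
          let δ , 0<δ , near = proj₁ (good s x≤s) (- f s)
                (by< (gap< fs<0) (solve 1 (λ a → num 0 :- a := (:- a) :- num 0) refl (f s)))
          in δ , 0<δ
           , (λ t lt t≤s 0<ft → ⊥-elim (by⊥ (0<ft <⊕≤ gap≤ (inj₁ (∣∣<⇒< (near t (near-left 0<δ lt t≤s)))))
               (solve 2 (λ a b → b :+ ((:- a) :- (b :- a)) := num 0) refl (f s) (f t))))
           , λ t _ _ 0<fs → ⊥-elim (≤⇒≯ (inj₁ fs<0) 0<fs)

  module _ {H : Pred (ℝ → ℝ) 0ℓ} (hardy : IsHardyField H) where
    open IsHardyField hardy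

    private
      eventually-nonzero : ∀ {f} → f ∈ H → ¬ (f ≈∞ λ _ → 0#) →
                           Eventually (λ s → ContinuousAt f s × f s ≢ 0#)
      eventually-nonzero {f} f∈H f≉0 =
        let g , _ , fg≈1 = inv-closed f∈H f≉0
        in continuous f∈H ∧∞ map∞ (λ x fg≡1 fx≡0 → 0≢1
             (trans (sym (trans (cong (_* g x) fx≡0) (CR.zeroˡ (g x)))) fg≡1)) fg≈1

      positive : ∀ {f} → (e : Eventually (λ s → ContinuousAt f s × f s ≢ 0#)) →
                 ∀ {x} → proj₁ e < x → 0# < f x → Eventually (λ y → 0# < f y)
      positive (a , good) {x} a<x 0<fx = x , λ y x<y →
        continuous-nonzero⇒positive (inj₁ x<y) (λ s x≤s → good s (<-≤-trans a<x x≤s)) 0<fx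

    -- A nonzero germ is invertible in `H`, so it eventually has no zeros, and continuity preserves
    -- the sign found at a single point beyond the thresholds for `f` and `- f`.
    hardy-signed : ∀ {f} → f ∈ H → EventuallySigned f
    hardy-signed {f} f∈H with em {f ≈∞ λ _ → 0#}
    ... | yes f≈0 = inj₁ (map∞ (λ x fx≡0 → ≡⇒≥ fx≡0) f≈0)
    ... | no  f≉0 =
          let good = eventually-nonzero f∈H f≉0
              -good = eventually-nonzero (neg-closed f∈H) λ -f≈0 → f≉0 (map∞ (λ x -fx≡0 →
                trans (solve 1 (λ a → a := :- (:- a)) refl (f x)) (trans (cong -_ -fx≡0)
                  (solve 0 (:- num 0 := num 0) refl))) -f≈0)
              b , a≤b , a′≤b = upper (proj₁ good) (proj₁ -good)
              b<b+1 = <+1 b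
          in decide good -good (≤-<-trans a≤b b<b+1) (≤-<-trans a′≤b b<b+1)
      where
      decide : (e : Eventually (λ s → ContinuousAt f s × f s ≢ 0#)) →
               (e′ : Eventually (λ s → ContinuousAt (λ x → - f x) s × - f s ≢ 0#)) →
               ∀ {x} → proj₁ e < x → proj₁ e′ < x → EventuallySigned f
      decide e e′ {x} lt lt′ with ≤-or-> (f x) 0#
      ... | inj₂ 0<fx = inj₁ (map∞ (λ _ → inj₁) (positive e lt 0<fx))
      ... | inj₁ (inj₂ fx≡0) = ⊥-elim (proj₂ (proj₂ e x lt) fx≡0)
      ... | inj₁ (inj₁ fx<0) = inj₂ (map∞
            (λ y 0<-fy → inj₁ (by< 0<-fy (solve 1 (λ a → :- a := num 0 :- a) refl (f y))))
            (positive e′ lt′ (by< (gap< fx<0) (solve 1 (λ a → num 0 :- a := (:- a) :- num 0) refl (f x)))))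

    -- The sum may lie outside `H`, so `hardy-signed` does not apply to it. After `k`
    -- differentiations only an element of `H` is left, whose sign is known; on the way back, a
    -- signed derivative gives monotonicity and monotonicity gives a sign.
    hardy+polynomial-signed : ∀ k {f g} → f ∈ H → PolynomialDegree< k g →
                              EventuallySigned (λ x → f x + g x)
    hardy+polynomial-monotone : ∀ k {f g} → f ∈ H → PolynomialDegree< (suc k) g →
                                EventuallyMonotone (λ x → f x + g x)
    hardy+polynomial-signed zero {f} f∈H g≡0 with hardy-signed f∈H
    ... | inj₁ f≥0 = inj₁ (map∞ (λ x → subst (0# ≤_) (sym (trans (cong (f x +_) (g≡0 x)) (CR.+-identityʳ _)))) f≥0)
    ... | inj₂ f≤0 = inj₂ (map∞ (λ x → subst (_≤ 0#) (sym (trans (cong (f x +_) (g≡0 x)) (CR.+-identityʳ _)))) f≤0)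
    hardy+polynomial-signed (suc k) f∈H g∈P = monotone⇒signed (hardy+polynomial-monotone k f∈H g∈P)
    hardy+polynomial-monotone k {f} {g} f∈H (g′ , p , Dg) =
      let f′ , f′∈H , Df = der-closed f∈H
      in signed-derivative⇒monotone (map∞ (λ x D → derivative-+ f g D (Dg x)) Df)
           (hardy+polynomial-signed k f′∈H p)

-- Eventual growth of integer polynomials along the natural numbers.

module Growth (em : ExcludedMiddle 0ℓ) (R : CompleteOrderedField) where
  open RealAnalysis R
  open OrderedField R
  open Analysis em R
  open HardyFields em R

  Eventuallyℕ : Pred ℕ 0ℓ → Set
  Eventuallyℕ P = ∃[ N ] ∀ n → N ℕ.≤ n → P n

  infixr 5 _∧ℕ_
  _∧ℕ_ : ∀ {P Q : Pred ℕ 0ℓ} → Eventuallyℕ P → Eventuallyℕ Q → Eventuallyℕ (λ n → P n × Q n)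
  (M , p) ∧ℕ (N , q) = M ℕ.⊔ N ,
    λ n le → p n (ℕP.≤-trans (ℕP.m≤m⊔n M N) le) , q n (ℕP.≤-trans (ℕP.m≤n⊔m M N) le)

  mapℕ : ∀ {P Q : Pred ℕ 0ℓ} → (∀ n → P n → Q n) → Eventuallyℕ P → Eventuallyℕ Q
  mapℕ f (N , p) = N , λ n N≤n → f n (p n N≤n)

  eventually-large : ∀ x → Eventuallyℕ (λ n → x ≤ fromℕ n)
  eventually-large x = let N , x<N = archimedean x in
    N , λ n N≤n → ≤-trans (inj₁ x<N) (fromℕ-mono N≤n)

  eventually⇒ℕ : ∀ {P : Pred ℝ 0ℓ} → Eventually P → Eventuallyℕ (λ n → P (fromℕ n))
  eventually⇒ℕ (a , good) = let N , a<N = archimedean a in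
    N , λ n N≤n → good (fromℕ n) (<-≤-trans a<N (fromℕ-mono N≤n))

  monotone⇒ℕ : ∀ {f} → EventuallyMonotone f →
               (∃[ N ] ∀ {m n} → N ℕ.≤ m → m ℕ.≤ n → f (fromℕ m) ≤ f (fromℕ n))
             ⊎ (∃[ N ] ∀ {m n} → N ℕ.≤ m → m ℕ.≤ n → f (fromℕ n) ≤ f (fromℕ m))
  monotone⇒ℕ (inj₁ (a , mono)) = let N , a<N = archimedean a in
    inj₁ (N , λ N≤m m≤n → mono (<-≤-trans a<N (fromℕ-mono N≤m)) (fromℕ-mono m≤n))
  monotone⇒ℕ (inj₂ (a , anti)) = let N , a<N = archimedean a in
    inj₂ (N , λ N≤m m≤n → anti (<-≤-trans a<N (fromℕ-mono N≤m)) (fromℕ-mono m≤n))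

  infix 9 _⟨_⟩
  _⟨_⟩ : List ℤ → ℕ → ℝ
  p ⟨ n ⟩ = eval p (fromℕ n)

  -- A positive integer leading coefficient is at least 1, and in this form it enters real estimates
  -- directly. The vanishing condition permits trailing zeros in the list.
  PositiveLead : List ℤ → ℕ → Set
  PositiveLead p d = 1# ≤ fromℤ (coeff p d) × (∀ k → d ℕ.< k → coeff p k ≡ ℤ.+ 0)

  tail-lead : ∀ {a p d} → PositiveLead (a ∷ p) (suc d) → PositiveLead p d
  tail-lead (1≤lead , above) = 1≤lead , λ k d<k → above (suc k) (ℕ.s≤s d<k)

  []-no-lead : ∀ {d} → ¬ PositiveLead [] d
  []-no-lead (1≤0 , _) = ≤⇒≯ 1≤0 0<1

  eval-zero : ∀ p x → (∀ k → coeff p k ≡ ℤ.+ 0) → eval p x ≡ 0#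
  eval-zero []      x zeros = refl
  eval-zero (a ∷ p) x zeros = trans
    (cong₂ (λ a v → fromℤ a + x * v) (zeros 0) (eval-zero p x (λ k → zeros (suc k))))
    (solve 1 (λ x → num 0 :+ x :* num 0 := num 0) refl x)

  eval-constant : ∀ a p → (∀ k → 0 ℕ.< k → coeff (a ∷ p) k ≡ ℤ.+ 0) → ∀ x → eval (a ∷ p) x ≡ fromℤ a
  eval-constant a p above x = trans
    (cong (λ v → fromℤ a + x * v) (eval-zero p x (λ k → above (suc k) (ℕ.s≤s ℕ.z≤n))))
    (solve 2 (λ a x → a :+ x :* num 0 := a) refl (fromℤ a) x)

  private
    ≥1-step : ∀ {a n g} → 1# - a ≤ n → 0# ≤ n → 1# ≤ g → 1# ≤ a + n * g
    ≥1-step {a} {n} {g} 1-a≤n 0≤n 1≤g = by≤ (gap≤ 1-a≤n ⊕ 0≤n ⊗ gap≤ 1≤g)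
      (solve 3 (λ a n g → n :- (num 1 :- a) :+ n :* (g :- num 1) := a :+ n :* g :- num 1) refl a n g)

    -- With `g` and `g′` the values of the tail at `n` and `n + 1`, the increment of `a + n * g` is
    -- `g′ + n * (g′ - g)`. This identity drives the inductions on the degree.
    increment : ∀ {a n g g′ e} → 0# ≤ n → 0# ≤ g′ + n * (g′ - g) - e →
                a + n * g + e ≤ a + (1# + n) * g′
    increment {a} {n} {g} {g′} {e} 0≤n 0≤Δ = by≤ 0≤Δ
      (solve 5 (λ a n g g′ e → g′ :+ n :* (g′ :- g) :- e := a :+ (num 1 :+ n) :* g′ :- (a :+ n :* g :+ e))
        refl a n g g′ e)

    increment-1 : ∀ {n g g′} → 0# ≤ n → g ≤ g′ → 1# ≤ g′ → 0# ≤ g′ + n * (g′ - g) - 1#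
    increment-1 {n} {g} {g′} 0≤n g≤g′ 1≤g′ = by≤ (gap≤ 1≤g′ ⊕ 0≤n ⊗ gap≤ g≤g′)
      (solve 3 (λ n g g′ → g′ :- num 1 :+ n :* (g′ :- g) := g′ :+ n :* (g′ :- g) :- num 1 :- num 0) refl n g g′)

    increment-n : ∀ {n g g′} → 0# ≤ n → g + 1# ≤ g′ → 1# ≤ g′ → 0# ≤ g′ + n * (g′ - g) - n
    increment-n {n} {g} {g′} 0≤n g≤g′ 1≤g′ = by≤ (0≤1 ⊕ gap≤ 1≤g′ ⊕ 0≤n ⊗ gap≤ g≤g′)
      (solve 3 (λ n g g′ → num 1 :+ (g′ :- num 1) :+ n :* (g′ :- (g :+ num 1))
        := g′ :+ n :* (g′ :- g) :- n :- num 0) refl n g g′)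

    drop-1 : ∀ {x y} → x + 1# ≤ y → x ≤ y
    drop-1 {x} {y} x+1≤y = by≤ (gap≤ x+1≤y ⊕ 0≤1) (solve 2 (λ x y → y :- (x :+ num 1) :+ num 1 := y :- x) refl x y)

  PositiveIncreasing : List ℤ → Pred ℕ 0ℓ
  PositiveIncreasing p n = 1# ≤ p ⟨ n ⟩ × p ⟨ n ⟩ ≤ p ⟨ suc n ⟩

  -- The two statements are proved by a joint induction on the degree: a positive nondecreasing tail
  -- gives increments at least 1, and these give the monotonicity needed one degree higher.
  eventually-positiveIncreasing : ∀ p d → PositiveLead p d → Eventuallyℕ (PositiveIncreasing p)
  eventually-strictlyIncreasing : ∀ p d → PositiveLead p (suc d) →
                                  Eventuallyℕ (λ n → p ⟨ n ⟩ + 1# ≤ p ⟨ suc n ⟩)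

  eventually-positiveIncreasing [] d lead = ⊥-elim ([]-no-lead lead)
  eventually-positiveIncreasing (a ∷ p) zero (1≤a , above) = 0 , λ n _ →
    subst (1# ≤_) (sym (const (fromℕ n))) 1≤a , ≡⇒≤ (trans (const (fromℕ n)) (sym (const (fromℕ (suc n)))))
    where
    const : ∀ x → eval (a ∷ p) x ≡ fromℤ a
    const = eval-constant a p above
  eventually-positiveIncreasing (a ∷ p) (suc d) lead =
    mapℕ (λ n ((large , (1≤g , _)) , increasing) → ≥1-step large (fromℕ-nonneg n) 1≤g , drop-1 increasing)
      ((eventually-large (1# - fromℤ a) ∧ℕ eventually-positiveIncreasing p d (tail-lead {a} {p} {d} lead))
        ∧ℕ eventually-strictlyIncreasing (a ∷ p) d lead)

  eventually-strictlyIncreasing [] d lead = ⊥-elim ([]-no-lead {suc d} lead)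
  eventually-strictlyIncreasing (a ∷ p) d lead =
    let N , good = eventually-positiveIncreasing p d (tail-lead {a} {p} {d} lead) in N , λ n N≤n →
      increment {fromℤ a} {fromℕ n} {p ⟨ n ⟩} {p ⟨ suc n ⟩} (fromℕ-nonneg n) (increment-1 (fromℕ-nonneg n)
        (proj₂ (good n N≤n)) (proj₁ (good (suc n) (ℕP.m≤n⇒m≤1+n N≤n))))

  -- The tail has positive degree and hence increments at least 1, which Horner's rule multiplies by
  -- `n`. The unbounded increments are what the search for gaps modulo `q` needs.
  eventually-superlinear-increment : ∀ p d → PositiveLead p (suc (suc d)) →
                                     Eventuallyℕ (λ n → p ⟨ n ⟩ + fromℕ n ≤ p ⟨ suc n ⟩)
  eventually-superlinear-increment [] d lead = ⊥-elim ([]-no-lead {suc (suc d)} lead)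
  eventually-superlinear-increment (a ∷ p) d lead =
    let lead′ = tail-lead {a} {p} {suc d} lead
        N , good = eventually-positiveIncreasing p (suc d) lead′ ∧ℕ eventually-strictlyIncreasing p d lead′
    in N , λ n N≤n → increment {fromℤ a} {fromℕ n} {p ⟨ n ⟩} {p ⟨ suc n ⟩} (fromℕ-nonneg n)
         (increment-n (fromℕ-nonneg n) (proj₂ (good n N≤n))
           (proj₁ (proj₁ (good (suc n) (ℕP.m≤n⇒m≤1+n N≤n)))))

  mono-from : ∀ (f : ℕ → ℝ) N → (∀ n → N ℕ.≤ n → f n ≤ f (suc n)) →
              ∀ {m n} → N ℕ.≤ m → m ℕ.≤ n → f m ≤ f n
  mono-from f N step {m} N≤m m≤n = go (ℕP.≤⇒≤′ m≤n)
    where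
    go : ∀ {n} → m ℕ.≤′ n → f m ≤ f n
    go ℕ.≤′-refl = ≤-refl
    go (ℕ.≤′-step m≤n) = ≤-trans (go m≤n) (step _ (ℕP.≤-trans N≤m (ℕP.≤′⇒≤ m≤n)))

  private
    large-step : ∀ {a n g b} → b - a ≤ n → 0# ≤ n → 1# ≤ g → b ≤ a + n * g
    large-step {a} {n} {g} {b} b-a≤n 0≤n 1≤g = by≤ (gap≤ b-a≤n ⊕ 0≤n ⊗ gap≤ 1≤g)
      (solve 4 (λ a n g b → n :- (b :- a) :+ n :* (g :- num 1) := a :+ n :* g :- b) refl a n g b)

    superlinear-step : ∀ {a n g b} → - a ≤ n → 0# ≤ n → b + 1# ≤ g → b * n ≤ a + n * g
    superlinear-step {a} {n} {g} {b} -a≤n 0≤n b+1≤g = by≤ (gap≤ -a≤n ⊕ 0≤n ⊗ gap≤ b+1≤g)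
      (solve 4 (λ a n g b → n :- (:- a) :+ n :* (g :- (b :+ num 1)) := a :+ n :* g :- b :* n) refl a n g b)

    double-step₁ : ∀ {a n g g′} → a + 1# ≤ n → 0# ≤ n → g ≤ g′ → 1# ≤ g′ →
                   fromℕ 3 * (a + n * g) + 1# ≤ fromℕ 2 * (a + (n + n) * g′)
    double-step₁ {a} {n} {g} {g′} a+1≤n 0≤n g≤g′ 1≤g′ = by≤
      (gap≤ a+1≤n ⊕ 0≤n ⊗ gap≤ 1≤g′ ⊕ fromℕ-nonneg 3 ⊗ (0≤n ⊗ gap≤ g≤g′))
      (solve 4 (λ a n g g′ → n :- (a :+ num 1) :+ n :* (g′ :- num 1) :+ num 3 :* (n :* (g′ :- g))
        := num 2 :* (a :+ (n :+ n) :* g′) :- (num 3 :* (a :+ n :* g) :+ num 1)) refl a n g g′)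

    double-step₂ : ∀ {a n g g′} → fromℕ 2 * a ≤ n → 0# ≤ n → fromℕ 3 * g + 1# ≤ fromℕ 2 * g′ →
                   fromℕ 3 * (a + n * g) ≤ a + (n + n) * g′
    double-step₂ {a} {n} {g} {g′} 2a≤n 0≤n 3g≤2g′ = by≤ (gap≤ 2a≤n ⊕ 0≤n ⊗ gap≤ 3g≤2g′)
      (solve 4 (λ a n g g′ → n :- num 2 :* a :+ n :* (num 2 :* g′ :- (num 3 :* g :+ num 1))
        := a :+ (n :+ n) :* g′ :- num 3 :* (a :+ n :* g)) refl a n g g′)

  eventually-unbounded : ∀ p d → PositiveLead p (suc d) → ∀ b → Eventuallyℕ (λ n → b ≤ p ⟨ n ⟩)
  eventually-unbounded [] d lead = ⊥-elim ([]-no-lead {suc d} lead)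
  eventually-unbounded (a ∷ p) d lead b =
    mapℕ (λ n (large , (1≤g , _)) → large-step large (fromℕ-nonneg n) 1≤g)
      (eventually-large (b - fromℤ a) ∧ℕ eventually-positiveIncreasing p d (tail-lead {a} {p} {d} lead))

  eventually-superlinear : ∀ p d → PositiveLead p (suc (suc d)) →
                           ∀ b → Eventuallyℕ (λ n → b * fromℕ n ≤ p ⟨ n ⟩)
  eventually-superlinear [] d lead = ⊥-elim ([]-no-lead {suc (suc d)} lead)
  eventually-superlinear (a ∷ p) d lead b =
    mapℕ (λ n (large , b+1≤g) → superlinear-step large (fromℕ-nonneg n) b+1≤g)
      (eventually-large (- fromℤ a) ∧ℕ eventually-unbounded p d (tail-lead {a} {p} {suc d} lead) (b + 1#))

  -- Doubling the argument multiplies `p` by about `2^deg`. In degree 1 a factor 3/2 is enough; the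
  -- extra `1#`, once multiplied by `n`, absorbs the next coefficient in `eventually-doubling`.
  eventually-doubling₁ : ∀ p d → PositiveLead p (suc d) →
    Eventuallyℕ (λ n → fromℕ 3 * p ⟨ n ⟩ + 1# ≤ fromℕ 2 * p ⟨ n ℕ.+ n ⟩)
  eventually-doubling₁ [] d lead = ⊥-elim ([]-no-lead {suc d} lead)
  eventually-doubling₁ (a ∷ p) d lead =
    let N , good = eventually-positiveIncreasing p d (tail-lead {a} {p} {d} lead)
        M , large = eventually-large (fromℤ a + 1#) ∧ℕ (N , λ n N≤n → N≤n)
    in M , λ n M≤n →
      let N≤n = proj₂ (large n M≤n)
          n≤2n = ℕP.m≤m+n n n
      in subst (λ x → fromℕ 3 * (a ∷ p) ⟨ n ⟩ + 1# ≤ fromℕ 2 * (fromℤ a + x * p ⟨ n ℕ.+ n ⟩))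
           (sym (fromℕ-+ n n))
           (double-step₁ {fromℤ a} {fromℕ n} {p ⟨ n ⟩} {p ⟨ n ℕ.+ n ⟩} (proj₁ (large n M≤n)) (fromℕ-nonneg n)
             (mono-from (p ⟨_⟩) N (λ k N≤k → proj₂ (good k N≤k)) N≤n n≤2n)
             (proj₁ (good (n ℕ.+ n) (ℕP.≤-trans N≤n n≤2n))))

  eventually-doubling : ∀ p d → PositiveLead p (suc (suc d)) →
    Eventuallyℕ (λ n → fromℕ 3 * p ⟨ n ⟩ ≤ p ⟨ n ℕ.+ n ⟩)
  eventually-doubling [] d lead = ⊥-elim ([]-no-lead {suc (suc d)} lead)
  eventually-doubling (a ∷ p) d lead =
    mapℕ (λ n (large , 3g≤2g′) →
        subst (λ x → fromℕ 3 * (a ∷ p) ⟨ n ⟩ ≤ fromℤ a + x * p ⟨ n ℕ.+ n ⟩) (sym (fromℕ-+ n n))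
          (double-step₂ {fromℤ a} {fromℕ n} {p ⟨ n ⟩} {p ⟨ n ℕ.+ n ⟩} large (fromℕ-nonneg n) 3g≤2g′))
      (eventually-large (fromℕ 2 * fromℤ a) ∧ℕ eventually-doubling₁ p d (tail-lead {a} {p} {suc d} lead))

  coeff-neg : ∀ p k → coeff (map (λ a → ℤ.- a) p) k ≡ ℤ.- coeff p k
  coeff-neg []      k       = refl
  coeff-neg (a ∷ p) zero    = refl
  coeff-neg (a ∷ p) (suc k) = coeff-neg p k

  eval-neg : ∀ p x → eval (map (λ a → ℤ.- a) p) x ≡ - eval p x
  eval-neg []      x = solve 0 (num 0 := :- num 0) refl
  eval-neg (a ∷ p) x = trans (cong₂ (λ a v → a + x * v) (fromℤ-neg a) (eval-neg p x))
    (solve 3 (λ a x v → (:- a) :+ x :* (:- v) := :- (a :+ x :* v)) refl (fromℤ a) x (eval p x))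

  positive-lead : ∀ p d → HasDegree p d → PositiveLead p d ⊎ PositiveLead (map (λ a → ℤ.- a) p) d
  positive-lead p d (lead≢0 , above) = decide (coeff p d) refl
    where
    decide : ∀ a → coeff p d ≡ a → PositiveLead p d ⊎ PositiveLead (map (λ a → ℤ.- a) p) d
    decide (ℤ.+ zero) eq = ⊥-elim (lead≢0 eq)
    decide (ℤ.+ suc k) eq = inj₁ (subst (λ a → 1# ≤ fromℤ a) (sym eq) (fromℕ-1≤ {suc k} (ℕ.s≤s ℕ.z≤n)) , above)
    decide -[1+ k ] eq = inj₂
      ( subst (λ a → 1# ≤ fromℤ a) (sym (trans (coeff-neg p d) (cong ℤ.-_ eq))) (fromℕ-1≤ {suc k} (ℕ.s≤s ℕ.z≤n))
      , λ k d<k → trans (coeff-neg p k) (cong ℤ.-_ (above k d<k)))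

  -- A negative leading coefficient would eventually push `c p` below `- C n`, so that `g` could not
  -- make the sum positive.
  negative-contradiction : ∀ {p d c C} {a g : ℕ → ℝ} → PositiveLead (map (λ a → ℤ.- a) p) (suc (suc d)) → 0# < c →
    (∀ n → a n ≡ c * p ⟨ n ⟩ + g n) → Eventuallyℕ (λ n → ∣ g n ∣ ≤ C * fromℕ n) → ¬ Eventuallyℕ (λ n → 0# < a n)
  negative-contradiction {p} {d} {c} {C} {a} {g} lead 0<c a≡ g-linear a-positive =
    let N , facts = eventually-superlinear (map (λ a → ℤ.- a) p) d lead (C ÷ c) ∧ℕ g-linear ∧ℕ a-positive
        superlinear , linear , positive = facts N ℕP.≤-refl
    in impossible (subst (C ÷ c * fromℕ N ≤_) (eval-neg p (fromℕ N)) superlinear) linear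
         (subst (0# <_) (a≡ N) positive)
    where
    impossible : ∀ {n P g} → C ÷ c * n ≤ - P → ∣ g ∣ ≤ C * n → 0# < c * P + g → ⊥
    impossible {n} {P} {g} q*n≤-P ∣g∣≤ 0< = by⊥
      (inj₁ 0<c ⊗ gap≤ q*n≤-P ⊕ gap≤ (≤-trans (≤∣∣ g) ∣g∣≤) ≤⊕< 0<)
      (trans (solve 6 (λ c P q n C g → c :* ((:- P) :- q :* n) :+ (C :* n :- g) :+ (c :* P :+ g)
          := (C :- q :* c) :* n) refl c P (C ÷ c) n C g)
        (trans (cong (λ w → (C - w) * n) (÷-* C 0<c)) (solve 2 (λ C n → (C :- C) :* n := num 0) refl C n)))

-- Long gaps among the residues of the values of an integer polynomial.

module IntegerPolynomialGaps (em : ExcludedMiddle 0ℓ) where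
  open import Data.Integer.Base using (_+_; _*_; _-_; -_)
  open import Data.Integer.Divisibility.Signed using (_∣_; divides; ∣⇒∣ᵤ)
  open ℤSolver.+-*-Solver using (solve; con; _:+_; _:*_; :-_; _:-_; _:=_)

  evalℤ : List ℤ → ℤ → ℤ
  evalℤ p x = foldr (λ a v → a + x * v) (ℤ.+ 0) p

  infix 4 _≅_⟨mod_⟩
  record _≅_⟨mod_⟩ (x y q : ℤ) : Set where
    constructor congruent
    field
      quotient   : ℤ
      difference : x - y ≡ quotient * q

  mod⇒∣ : ∀ {x y q} → x ≅ y ⟨mod q ⟩ → q ∣ x - y
  mod⇒∣ (congruent k eq) = divides k eq

  mod-sym : ∀ {x y q} → x ≅ y ⟨mod q ⟩ → y ≅ x ⟨mod q ⟩
  mod-sym {x} {y} {q} (congruent k eq) = congruent (- k) (begin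
    y - x      ≡⟨ solve 2 (λ x y → y :- x := :- (x :- y)) refl x y ⟩
    - (x - y)  ≡⟨ cong -_ eq ⟩
    - (k * q)  ≡⟨ ℤP.neg-distribˡ-* k q ⟩
    - k * q    ∎)
    where open ≡-Reasoning

  mod-trans : ∀ {x y z q} → x ≅ y ⟨mod q ⟩ → y ≅ z ⟨mod q ⟩ → x ≅ z ⟨mod q ⟩
  mod-trans {x} {y} {z} {q} (congruent k eq) (congruent l eq′) = congruent (k + l) (begin
    x - z            ≡⟨ solve 3 (λ x y z → x :- z := x :- y :+ (y :- z)) refl x y z ⟩
    x - y + (y - z)  ≡⟨ cong₂ _+_ eq eq′ ⟩
    k * q + l * q    ≡⟨ ℤP.*-distribʳ-+ q k l ⟨
    (k + l) * q      ∎)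
    where open ≡-Reasoning

  evalℤ-cong : ∀ p {x y q} → x ≅ y ⟨mod q ⟩ → evalℤ p x ≅ evalℤ p y ⟨mod q ⟩
  evalℤ-cong [] _ = congruent (ℤ.+ 0) refl
  evalℤ-cong (a ∷ p) {x} {y} {q} x≡y@(congruent k eq) with evalℤ-cong p x≡y
  ... | congruent l eq′ = congruent (k * evalℤ p x + y * l) (begin
    a + x * u - (a + y * v)        ≡⟨ solve 5 (λ a x u y v → a :+ x :* u :- (a :+ y :* v)
                                        := (x :- y) :* u :+ y :* (u :- v)) refl a x u y v ⟩
    (x - y) * u + y * (u - v)      ≡⟨ cong₂ (λ s t → s * u + y * t) eq eq′ ⟩
    k * q * u + y * (l * q)        ≡⟨ solve 5 (λ k q u y l → k :* q :* u :+ y :* (l :* q)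
                                        := (k :* u :+ y :* l) :* q) refl k q u y l ⟩
    (k * u + y * l) * q            ∎)
    where
    open ≡-Reasoning
    u = evalℤ p x
    v = evalℤ p y

  small-residues : ∀ {q i j} → i ℕ.< q → j ℕ.< q → ℤ.+ i ≅ ℤ.+ j ⟨mod ℤ.+ q ⟩ → i ≡ j
  small-residues {q} {i} {j} i<q j<q q∣ with ℤ.∣ ℤ.+ i - ℤ.+ j ∣ in eq
  ... | zero  = ℤP.+-injective (ℤP.i-j≡0⇒i≡j (ℤ.+ i) (ℤ.+ j) (ℤP.∣i∣≡0⇒i≡0 eq))
  ... | suc n = ⊥-elim (ℕP.<⇒≱ small (ℕD.∣⇒≤ (subst (q ℕD.∣_) eq (∣⇒∣ᵤ (mod⇒∣ q∣)))))
    where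
    ∣i⊖j∣<q : ℤ.∣ i ℤ.⊖ j ∣ ℕ.< q
    ∣i⊖j∣<q with ℕP.≤-total i j
    ... | inj₁ i≤j = subst (ℕ._< q) (sym (ℤP.∣⊖∣-≤ i≤j)) (ℕP.≤-<-trans (ℕP.m∸n≤m j i) j<q)
    ... | inj₂ j≤i = subst (ℕ._< q) (sym (trans (ℤP.∣m⊖n∣≡∣n⊖m∣ i j) (ℤP.∣⊖∣-≤ j≤i)))
                       (ℕP.≤-<-trans (ℕP.m∸n≤m i j) i<q)
    small : suc n ℕ.< q
    small = subst (ℕ._< q) (trans (cong ℤ.∣_∣ (sym (ℤP.m-n≡m⊖n i j))) eq) ∣i⊖j∣<q

  -- A missed value could be punched out of the codomain, leaving an injection into a smaller finite
  -- set.
  injective⇒surjective : ∀ {n} (g : Fin n → Fin n) → (∀ {i j} → g i ≡ g j → i ≡ j) → ∀ b → ∃[ i ] g i ≡ b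
  injective⇒surjective {suc n} g injective b = decidable-stable (FinP.any? (λ i → g i FinP.≟ b))
    λ missed → ℕP.1+n≰n (FinP.injective⇒≤
      {f = λ i → punchOut {i = b} {g i} (λ b≡gi → missed (i , sym b≡gi))}
      (λ {i} {j} eq → injective (FinP.punchOut-injective
        (λ b≡gi → missed (i , sym b≡gi)) (λ b≡gj → missed (j , sym b≡gj)) eq)))

  -- If f attained every residue modulo q, choosing preimages would give an injective, hence
  -- surjective, map of residues, although f identifies the distinct residues of n and n + 1.
  missed-residue : ∀ q (f : ℕ → ℤ) → (∀ {m n} → ℤ.+ m ≅ ℤ.+ n ⟨mod ℤ.+ q ⟩ → f m ≅ f n ⟨mod ℤ.+ q ⟩) →
                   1 ℕ.< q → ∀ n → f (suc n) ≅ f n ⟨mod ℤ.+ q ⟩ →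
                   ∃[ u ] ∀ m → ¬ (f m ≅ u ⟨mod ℤ.+ q ⟩)
  missed-residue q@(suc _) f f-cong 1<q n f[1+n]≡f[n] with em {∃[ u ] ∀ m → ¬ (f m ≅ u ⟨mod ℤ.+ q ⟩)}
  ... | yes missed = missed
  ... | no  none   = ⊥-elim (1+n≢n (f-reflects f[1+n]≡f[n]))
    where
    attained : ∀ u → ∃[ m ] f m ≅ u ⟨mod ℤ.+ q ⟩
    attained u with em {∃[ m ] f m ≅ u ⟨mod ℤ.+ q ⟩}
    ... | yes p = p
    ... | no ¬p = ⊥-elim (none (u , λ m eq → ¬p (m , eq)))

    residue : ℕ → Fin q
    residue m = fromℕ< (ℕM.m%n<n m q)

    residue-mod : ∀ m → ℤ.+ m ≅ ℤ.+ toℕ (residue m) ⟨mod ℤ.+ q ⟩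
    residue-mod m = congruent (ℤ.+ (m ℕ./ q)) (begin
      ℤ.+ m - ℤ.+ toℕ (residue m)                                   ≡⟨ cong (λ r → ℤ.+ m - ℤ.+ r) (FinP.toℕ-fromℕ< (ℕM.m%n<n m q)) ⟩
      ℤ.+ m - ℤ.+ (m ℕ.% q)                                         ≡⟨ cong (λ z → ℤ.+ z - ℤ.+ (m ℕ.% q)) (ℕM.m≡m%n+[m/n]*n m q) ⟩
      ℤ.+ (m ℕ.% q ℕ.+ m ℕ./ q ℕ.* q) - ℤ.+ (m ℕ.% q)               ≡⟨ cong (_- ℤ.+ (m ℕ.% q)) (ℤP.pos-+ (m ℕ.% q) (m ℕ./ q ℕ.* q)) ⟩
      ℤ.+ (m ℕ.% q) + ℤ.+ (m ℕ./ q ℕ.* q) - ℤ.+ (m ℕ.% q)           ≡⟨ solve 2 (λ r x → r :+ x :- r := x) refl (ℤ.+ (m ℕ.% q)) _ ⟩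
      ℤ.+ (m ℕ./ q ℕ.* q)                                           ≡⟨ ℤP.pos-* (m ℕ./ q) q ⟩
      ℤ.+ (m ℕ./ q) * ℤ.+ q                                         ∎)
      where open ≡-Reasoning

    residue-injective : ∀ m m′ → residue m ≡ residue m′ → ℤ.+ m ≅ ℤ.+ m′ ⟨mod ℤ.+ q ⟩
    residue-injective m m′ eq = mod-trans (residue-mod m)
      (subst (λ r → ℤ.+ toℕ r ≅ ℤ.+ m′ ⟨mod ℤ.+ q ⟩) (sym eq) (mod-sym (residue-mod m′)))

    preimage : Fin q → ℕ
    preimage i = proj₁ (attained (ℤ.+ toℕ i))

    preimage-injective : ∀ {i j} → f (preimage i) ≅ f (preimage j) ⟨mod ℤ.+ q ⟩ → i ≡ j
    preimage-injective {i} {j} eq = FinP.toℕ-injective (small-residues (FinP.toℕ<n i) (FinP.toℕ<n j)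
      (mod-trans (mod-sym (proj₂ (attained (ℤ.+ toℕ i))))
        (mod-trans eq (proj₂ (attained (ℤ.+ toℕ j))))))

    preimages-cover : ∀ m → ∃[ i ] ℤ.+ preimage i ≅ ℤ.+ m ⟨mod ℤ.+ q ⟩
    preimages-cover m =
      let i , eq = injective⇒surjective (λ i → residue (preimage i))
            (λ {i} {j} eq → preimage-injective (f-cong (residue-injective (preimage i) (preimage j) eq))) (residue m)
      in i , residue-injective (preimage i) m eq

    f-reflects : ∀ {m m′} → f m ≅ f m′ ⟨mod ℤ.+ q ⟩ → ℤ.+ m ≅ ℤ.+ m′ ⟨mod ℤ.+ q ⟩
    f-reflects {m} {m′} eq =
      let i , i≡m = preimages-cover m
          j , j≡m′ = preimages-cover m′
          i≡j = preimage-injective {i} {j} (mod-trans (f-cong i≡m)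
                  (mod-trans eq (mod-sym (f-cong j≡m′))))
      in mod-trans (mod-sym i≡m)
           (subst (λ k → ℤ.+ preimage k ≅ ℤ.+ m′ ⟨mod ℤ.+ q ⟩) (sym i≡j) j≡m′)

    1+n≢n : ¬ (ℤ.+ suc n ≅ ℤ.+ n ⟨mod ℤ.+ q ⟩)
    1+n≢n q∣1 = ℕP.<⇒≱ 1<q (ℕD.∣⇒≤ (∣⇒∣ᵤ (subst (ℤ.+ q ∣_)
      (solve 1 (λ n → con (ℤ.+ 1) :+ n :- n := con (ℤ.+ 1)) refl (ℤ.+ n)) (mod⇒∣ q∣1))))

  -- The interval is open, so length `suc W` means `W` consecutive missed residues, and the case
  -- `W = 0` is free.
  HasGap : List ℤ → ℕ → Set
  HasGap p W = ∃[ Q ] ∃[ v ] (0 ℕ.< Q × (∀ n κ →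
    ¬ (v + κ * ℤ.+ Q ℤ.< evalℤ p (ℤ.+ n) × evalℤ p (ℤ.+ n) ℤ.< v + κ * ℤ.+ Q + ℤ.+ suc W)))

  gap-zero : ∀ p → HasGap p 0
  gap-zero p = 1 , ℤ.+ 0 , ℕ.s≤s ℕ.z≤n , λ n κ (lo , hi) →
    ℤP.<⇒≱ hi (subst (ℤ._≤ evalℤ p (ℤ.+ n)) (ℤP.+-comm (ℤ.+ 1) (ℤ.+ 0 + κ * ℤ.+ 1)) (ℤP.i<j⇒suc[i]≤j lo))

  module _ (p : List ℤ) (n₀ : ℕ)
           (growth : ∀ n → n₀ ℕ.≤ n → evalℤ p (ℤ.+ n) + ℤ.+ n ℤ.≤ evalℤ p (ℤ.+ suc n)) where
    private
      P : ℕ → ℤ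
      P n = evalℤ p (ℤ.+ n)

      P-cong : ∀ {m n q} → ℤ.+ m ≅ ℤ.+ n ⟨mod q ⟩ → P m ≅ P n ⟨mod q ⟩
      P-cong = evalℤ-cong p

      increment≥ : ∀ n → n₀ ℕ.≤ n → ℤ.+ n ℤ.≤ P (suc n) - P n
      increment≥ n n₀≤n = subst (ℤ._≤ P (suc n) - P n)
        (solve 2 (λ x n → x :+ n :- x := n) refl (P n) (ℤ.+ n)) (ℤP.+-monoˡ-≤ (- P n) (growth n n₀≤n))

      shifted : ∀ b m → ℤ.+ (b ℕ.+ m) ≅ ℤ.+ b ⟨mod ℤ.+ m ⟩
      shifted b m = congruent (ℤ.+ 1) (trans (cong (_- ℤ.+ b) (ℤP.pos-+ b m))
        (solve 2 (λ b m → b :+ m :- b := con (ℤ.+ 1) :* m) refl (ℤ.+ b) (ℤ.+ m)))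

      shifted-increment : ∀ b a Q → P (suc b) - P b ≡ ℤ.+ a →
        ∃[ k ] P (suc (b ℕ.+ a ℕ.* Q)) - P (b ℕ.+ a ℕ.* Q) ≡ ℤ.+ a * (ℤ.+ 1 + k * ℤ.+ Q)
      shifted-increment b a Q Db≡a with P-cong (shifted (suc b) (a ℕ.* Q)) | P-cong (shifted b (a ℕ.* Q))
      ... | congruent k eq | congruent l eq′ = k - l , (begin
        P (suc n) - P n
          ≡⟨ solve 4 (λ x y z w → x :- y := z :- w :+ (x :- z) :- (y :- w)) refl (P (suc n)) (P n) (P (suc b)) (P b) ⟩
        P (suc b) - P b + (P (suc n) - P (suc b)) - (P n - P b)
          ≡⟨ cong₂ (λ x y → x - y) (cong₂ _+_ Db≡a eq) eq′ ⟩
        ℤ.+ a + k * ℤ.+ (a ℕ.* Q) - l * ℤ.+ (a ℕ.* Q)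
          ≡⟨ cong (λ m → ℤ.+ a + k * m - l * m) (ℤP.pos-* a Q) ⟩
        ℤ.+ a + k * (ℤ.+ a * ℤ.+ Q) - l * (ℤ.+ a * ℤ.+ Q)
          ≡⟨ solve 4 (λ a k l Q → a :+ k :* (a :* Q) :- l :* (a :* Q)
               := a :* (con (ℤ.+ 1) :+ (k :- l) :* Q)) refl (ℤ.+ a) k l (ℤ.+ Q) ⟩
        ℤ.+ a * (ℤ.+ 1 + (k - l) * ℤ.+ Q) ∎)
        where
        open ≡-Reasoning
        n = b ℕ.+ a ℕ.* Q

      -- With a = P (b + 1) - P b, the increment at b + aQ is a multiple of a congruent to a
      -- modulo aQ, which yields a divisor q = 1 + kQ coprime to Q.
      increment-divisor : ∀ Q → 0 ℕ.< Q → ∃[ k ] ∃[ q ] ∃[ n ]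
        (1 ℕ.< q × ℤ.+ q ≡ ℤ.+ 1 + k * ℤ.+ Q × P (suc n) ≅ P n ⟨mod ℤ.+ q ⟩)
      increment-divisor Q 0<Q = k , q , n , 1<q , +q≡ , congruent (ℤ.+ a) (trans Dn≡ (cong (ℤ.+ a *_) (sym +q≡)))
        where
        b = suc n₀
        Db = P (suc b) - P b
        b≤Db : ℤ.+ b ℤ.≤ Db
        b≤Db = increment≥ b (ℕP.n≤1+n n₀)
        a = ℤ.∣ Db ∣
        +a≡Db : ℤ.+ a ≡ Db
        +a≡Db = ℤP.0≤i⇒+∣i∣≡i (ℤP.≤-trans (ℤ.+≤+ ℕ.z≤n) b≤Db)
        n = b ℕ.+ a ℕ.* Q
        k = proj₁ (shifted-increment b a Q (sym +a≡Db))
        Dn≡ = proj₂ (shifted-increment b a Q (sym +a≡Db))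
        -- The increment at `n` is at least `n`, which exceeds `a`; so the cofactor `1 + kQ` is
        -- greater than 1 and not merely nonzero.
        a<n : a ℕ.< n
        a<n = ℕ.s≤s (ℕP.≤-trans (ℕP.≤-trans (ℕP.≤-reflexive (sym (ℕP.*-identityʳ a))) (ℕP.*-monoʳ-≤ a 0<Q))
                (ℕP.m≤n+m (a ℕ.* Q) n₀))
        a<a[1+kQ] : ℤ.+ a * ℤ.+ 1 ℤ.< ℤ.+ a * (ℤ.+ 1 + k * ℤ.+ Q)
        a<a[1+kQ] = subst₂ ℤ._<_ (sym (ℤP.*-identityʳ (ℤ.+ a))) Dn≡
          (ℤP.<-≤-trans (ℤ.+<+ a<n) (increment≥ n (ℕP.≤-trans (ℕP.n≤1+n n₀) (ℕP.m≤m+n b (a ℕ.* Q)))))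
        1<1+kQ : ℤ.+ 1 ℤ.< ℤ.+ 1 + k * ℤ.+ Q
        1<1+kQ = ℤP.*-cancelˡ-<-nonNeg (ℤ.+ a) a<a[1+kQ]
        q = ℤ.∣ ℤ.+ 1 + k * ℤ.+ Q ∣
        +q≡ : ℤ.+ q ≡ ℤ.+ 1 + k * ℤ.+ Q
        +q≡ = ℤP.0≤i⇒+∣i∣≡i (ℤP.<⇒≤ (ℤP.<-trans (ℤ.+<+ (ℕ.s≤s ℕ.z≤n)) 1<1+kQ))
        1<q : 1 ℕ.< q
        1<q = ℤP.drop‿+<+ (subst (ℤ.+ 1 ℤ.<_) (sym +q≡) 1<1+kQ)

      module _ (W Q : ℕ) (v : ℤ) (gap : ∀ n κ → ¬ (v + κ * ℤ.+ Q ℤ.< P n × P n ℤ.< v + κ * ℤ.+ Q + ℤ.+ suc W))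
               (k : ℤ) (q : ℕ) (+q≡ : ℤ.+ q ≡ ℤ.+ 1 + k * ℤ.+ Q)
               (u : ℤ) (missed : ∀ m → ¬ (P m ≅ u ⟨mod ℤ.+ q ⟩)) where

        -- The translate of the old gap whose right end point is congruent to u modulo q;
        -- since kQ ≡ -1 modulo q, the multiplier of Q is explicit.
        z : ℤ
        z = k * (v + ℤ.+ suc W - u)

        extended-start : ∀ κ → v + z * ℤ.+ Q + κ * ℤ.+ (Q ℕ.* q) ≡ v + (z + κ * ℤ.+ q) * ℤ.+ Q
        extended-start κ = trans (cong (λ m → v + z * ℤ.+ Q + κ * m) (ℤP.pos-* Q q))
          (solve 5 (λ v z Q κ q → v :+ z :* Q :+ κ :* (Q :* q) := v :+ (z :+ κ :* q) :* Q)
            refl v z (ℤ.+ Q) κ (ℤ.+ q))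

        right-end : ∀ κ → v + z * ℤ.+ Q + κ * ℤ.+ (Q ℕ.* q) + ℤ.+ suc W ≅ u ⟨mod ℤ.+ q ⟩
        right-end κ = congruent (w + κ * ℤ.+ Q) (begin
          v + z * ℤ.+ Q + κ * ℤ.+ (Q ℕ.* q) + ℤ.+ suc W - u
            ≡⟨ cong (λ m → v + z * ℤ.+ Q + κ * m + ℤ.+ suc W - u) (ℤP.pos-* Q q) ⟩
          v + k * w * ℤ.+ Q + κ * (ℤ.+ Q * ℤ.+ q) + ℤ.+ suc W - u
            ≡⟨ solve 7 (λ v k Q κ q S u → v :+ k :* (v :+ S :- u) :* Q :+ κ :* (Q :* q) :+ S :- u
                 := (v :+ S :- u) :* (con (ℤ.+ 1) :+ k :* Q) :+ κ :* Q :* q)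
                 refl v k (ℤ.+ Q) κ (ℤ.+ q) (ℤ.+ suc W) u ⟩
          w * (ℤ.+ 1 + k * ℤ.+ Q) + κ * ℤ.+ Q * ℤ.+ q
            ≡⟨ cong (λ m → w * m + κ * ℤ.+ Q * ℤ.+ q) +q≡ ⟨
          w * ℤ.+ q + κ * ℤ.+ Q * ℤ.+ q
            ≡⟨ ℤP.*-distribʳ-+ (ℤ.+ q) w (κ * ℤ.+ Q) ⟨
          (w + κ * ℤ.+ Q) * ℤ.+ q ∎)
          where
          open ≡-Reasoning
          w = v + ℤ.+ suc W - u

        -- Lengthening the open interval by one adds a single integer, the old right end point. It
        -- is congruent to the missed residue `u`; everything to its left lies in a translate of the
        -- old gap.
        extended-gap : ∀ n κ → ¬ (v + z * ℤ.+ Q + κ * ℤ.+ (Q ℕ.* q) ℤ.< P n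
                                × P n ℤ.< v + z * ℤ.+ Q + κ * ℤ.+ (Q ℕ.* q) + ℤ.+ suc (suc W))
        extended-gap n κ (lo , hi) with P n ℤP.<? v + z * ℤ.+ Q + κ * ℤ.+ (Q ℕ.* q) + ℤ.+ suc W
        ... | yes Pn< = gap n (z + κ * ℤ.+ q)
              (subst (ℤ._< P n) (extended-start κ) lo , subst (λ s → P n ℤ.< s + ℤ.+ suc W) (extended-start κ) Pn<)
        ... | no  Pn≮ = missed n (subst (_≅ u ⟨mod ℤ.+ q ⟩) (sym Pn≡) (right-end κ))
          where
          s = v + z * ℤ.+ Q + κ * ℤ.+ (Q ℕ.* q)
          next : s + ℤ.+ suc (suc W) ≡ ℤ.suc (s + ℤ.+ suc W)
          next = solve 2 (λ s W → s :+ (con (ℤ.+ 1) :+ W) := con (ℤ.+ 1) :+ (s :+ W)) refl s (ℤ.+ suc W)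
          Pn≡ : P n ≡ s + ℤ.+ suc W
          Pn≡ = ℤP.≤-antisym (subst (P n ℤ.≤_) (trans (cong ℤ.pred next) (ℤP.pred-suc _)) (ℤP.i<j⇒i≤pred[j] hi)) (ℤP.≮⇒≥ Pn≮)

    polynomial-gaps : ∀ W → HasGap p W
    polynomial-gaps zero = gap-zero p
    polynomial-gaps (suc W) =
      let Q , v , 0<Q , gap = polynomial-gaps W
          k , q , n , 1<q , +q≡ , eq = increment-divisor Q 0<Q
          u , missed = missed-residue q P P-cong 1<q n eq
      in Q ℕ.* q , v + z W Q v gap k q +q≡ u missed * ℤ.+ Q , ℕP.*-mono-≤ 0<Q (ℕP.<⇒≤ 1<q)
         , extended-gap W Q v gap k q +q≡ u missed

-- Bounds for the logarithm from partial sums of the exponential series.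

module LogarithmBounds (em : ExcludedMiddle 0ℓ) (R : CompleteOrderedField) where
  open RealAnalysis R
  open OrderedField R
  open Analysis em R
  private
    module CR = CommutativeRing commutativeRing
    module O = IsStrictTotalOrder isStrictTotalOrder

  log⁺-≤ : ∀ {x b} → 1# < x → (∀ y → ExpBelow x y → y ≤ b) → log⁺ x ≤ b
  log⁺-≤ {x} {b} 1<x bound with O.compare 1# x
  ... | tri< lt _ _  = proj₂ (proj₂ (logFrom1 x (inj₁ lt))) b bound
  ... | tri≈ _ 1≡x _ = proj₂ (proj₂ (logFrom1 x (inj₂ 1≡x))) b bound
  ... | tri> ≮ _ _   = ⊥-elim (≮ 1<x)

  log⁺-≥ : ∀ {x y} → 1# < x → ExpBelow x y → y ≤ log⁺ x
  log⁺-≥ {x} {y} 1<x below with O.compare 1# x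
  ... | tri< lt _ _  = proj₁ (proj₂ (logFrom1 x (inj₁ lt))) y below
  ... | tri≈ _ 1≡x _ = proj₁ (proj₂ (logFrom1 x (inj₂ 1≡x))) y below
  ... | tri> ≮ _ _   = ⊥-elim (≮ 1<x)

  log⁺-zero : ∀ {x} → x < 1# → log⁺ x ≡ 0#
  log⁺-zero {x} x<1 with O.compare 1# x
  ... | tri< _ _ ≯   = ⊥-elim (≯ x<1)
  ... | tri≈ _ _ ≯   = ⊥-elim (≯ x<1)
  ... | tri> _ _ _   = refl

  ⁻¹<1 : ∀ {x} → 1# < x → x ⁻¹ < 1#
  ⁻¹<1 {x} 1<x = let 0<x = <-trans 0<1 1<x in *-cancelʳ-< 0<x
    (by< (gap< 1<x <⊕≤ gap≤ (≡⇒≤ (⁻¹-inverseʳ x (x≢0 0<x))))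
      (solve 2 (λ x i → x :- num 1 :+ (num 1 :- x :* i) := num 1 :* x :- i :* x) refl x (x ⁻¹)))

  log≡log⁺ : ∀ {x} → 1# < x → log x ≡ log⁺ x
  log≡log⁺ {x} 1<x = trans (cong (λ z → log⁺ x - z) (log⁺-zero (⁻¹<1 1<x)))
    (solve 1 (λ l → l :- num 0 := l) refl (log⁺ x))

  log-≤ : ∀ {x b} → 1# < x → (∀ y → ExpBelow x y → y ≤ b) → log x ≤ b
  log-≤ {x} {b} 1<x bound = subst (_≤ b) (sym (log≡log⁺ 1<x)) (log⁺-≤ 1<x bound)

  log-≥ : ∀ {x y} → 1# < x → ExpBelow x y → y ≤ log x
  log-≥ {x} {y} 1<x below = subst (y ≤_) (sym (log≡log⁺ 1<x)) (log⁺-≥ 1<x below)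

  log≤id : ∀ {x} → 1# < x → log x ≤ x
  log≤id {x} 1<x = log-≤ 1<x λ y (_ , below) →
    by≤ (gap≤ (subst (_≤ x) (expSum-1 y) (below 1)) ⊕ 0≤1)
      (solve 2 (λ x y → x :- (num 1 :+ y) :+ num 1 := x :- y) refl x y)

  1≤n! : ∀ n → 1 ℕ.≤ n !
  1≤n! zero    = ℕP.≤-refl
  1≤n! (suc n) = ℕP.*-mono-≤ {1} {suc n} {1} {n !} (ℕ.s≤s ℕ.z≤n) (1≤n! n)

  -- The summand `½ ^ n` bounds the remaining tail by a geometric series and lets the induction
  -- close. It shows that the exponential of `½` is at most 2, hence that `log` is at least `½` from
  -- 2 on.
  expSum-½ : ∀ n → expSum ½ n + ½ ^ n ≤ 1# + 1#
  expSum-½ zero    = ≤-refl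
  expSum-½ (suc n) = ≤-trans
    (by≤ (gap≤ (÷≤ (^-nonneg (inj₁ 0<½) (suc n)) (fromℕ-1≤ (1≤n! (suc n)))) ⊕ gap≤ (≡⇒≤ doubled))
      (solve 4 (λ e q h p → h :- q :+ (p :- (h :+ h)) := e :+ p :- (e :+ q :+ h))
        refl (expSum ½ n) (½ ^ suc n ÷ fromℕ (suc n !)) (½ ^ suc n) (½ ^ n)))
    (expSum-½ n)
    where
    doubled : ½ ^ suc n + ½ ^ suc n ≡ ½ ^ n
    doubled = trans (solve 2 (λ h p → h :* p :+ h :* p := (h :+ h) :* p) refl ½ (½ ^ n))
      (trans (cong (_* ½ ^ n) ½+½) (CR.*-identityˡ (½ ^ n)))

  log-pos : ∀ {x} → 1# + 1# ≤ x → 0# < log x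
  log-pos {x} 2≤x = <-≤-trans 0<½ (log-≥ (<-≤-trans 1<2 2≤x)
    (inj₁ 0<½ , λ n → ≤-trans (by≤ (^-nonneg (inj₁ 0<½) n)
      (solve 2 (λ e p → p := e :+ p :- e) refl (expSum ½ n) (½ ^ n))) (≤-trans (expSum-½ n) 2≤x)))
    where
    1<2 : 1# < 1# + 1#
    1<2 = by< 0<1 (solve 0 (num 1 := num 1 :+ num 1 :- num 1) refl)

  expSum-≥1 : ∀ {y} → 0# ≤ y → ∀ n → 1# ≤ expSum y n
  expSum-≥1 0≤y zero    = ≤-refl
  expSum-≥1 {y} 0≤y (suc n) = ≤-trans (expSum-≥1 0≤y n)
    (by≤ (^-nonneg 0≤y (suc n) ⊗ inj₁ (⁻¹-pos (<-≤-trans 0<1 (fromℕ-1≤ (1≤n! (suc n))))))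
      (solve 2 (λ e q → q := e :+ q :- e) refl (expSum y n) (y ^ suc n ÷ fromℕ (suc n !))))

  -- Each of the `k` factors `y` dominates one of `2`, `4`, ..., `2k`, because `k ≤ m`.
  factorial-power : ∀ {m y} → fromℕ (2 ℕ.* m) ≤ y → ∀ k → k ℕ.≤ m → fromℕ (2 ℕ.^ k) * fromℕ (k !) ≤ y ^ k
  factorial-power {m} {y} 2m≤y zero    _    = ≡⇒≤ (solve 0 ((num 1 :+ num 0) :* (num 1 :+ num 0) := num 1) refl)
  factorial-power {m} {y} 2m≤y (suc k) 1+k≤m = ≤-trans
    (≡⇒≤ (trans (sym (fromℕ-* (2 ℕ.^ suc k) (suc k !))) (trans (cong fromℕ regroup)
      (trans (fromℕ-* (2 ℕ.* suc k) (2 ℕ.^ k ℕ.* k !)) (cong (fromℕ (2 ℕ.* suc k) *_) (fromℕ-* (2 ℕ.^ k) (k !)))))))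
    (*-mono-≤ (fromℕ-nonneg (2 ℕ.* suc k)) (^-nonneg (≤-trans (fromℕ-nonneg (2 ℕ.* m)) 2m≤y) k)
      (≤-trans (fromℕ-mono (ℕP.*-monoʳ-≤ 2 1+k≤m)) 2m≤y)
      (factorial-power 2m≤y k (ℕP.≤-trans (ℕP.n≤1+n k) 1+k≤m)))
    where
    open ℕSolver.+-*-Solver using () renaming (solve to solveℕ; con to conℕ; _:+_ to _+ℕ_; _:*_ to _*ℕ_; _:=_ to _=ℕ_)
    regroup : 2 ℕ.^ suc k ℕ.* suc k ! ≡ 2 ℕ.* suc k ℕ.* (2 ℕ.^ k ℕ.* k !)
    regroup = solveℕ 3 (λ k t f → conℕ 2 *ℕ t *ℕ ((conℕ 1 +ℕ k) *ℕ f) =ℕ conℕ 2 *ℕ (conℕ 1 +ℕ k) *ℕ (t *ℕ f))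
      refl k (2 ℕ.^ k) (k !)

  -- If y > 2m, then the single term y^m / m! of the exponential series is at least 2^m.
  log-2^ : ∀ m → 1 ℕ.≤ m → 1# < fromℕ (2 ℕ.^ m) → log (fromℕ (2 ℕ.^ m)) ≤ fromℕ (2 ℕ.* m)
  log-2^ m@(suc k) _ 1<2^m = log-≤ 1<2^m λ y (0≤y , below) → ≮⇒≥ λ 2m<y →
    let x = fromℕ (2 ℕ.^ m)
        0<m! = fromℕ-pos (1≤n! m)
        x≤term : x ≤ y ^ m ÷ fromℕ (m !)
        x≤term = *-cancelʳ-≤ 0<m! (≤-trans (factorial-power (inj₁ 2m<y) m ℕP.≤-refl) (≡⇒≥ (÷-* (y ^ m) 0<m!)))
    -- The earlier terms of the partial sum contribute at least 1 in addition to `y^m / m!`, so the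
    -- sum strictly exceeds `2^m`.
    in by⊥ (gap≤ (below m) ⊕ gap≤ x≤term ⊕ gap≤ (expSum-≥1 0≤y k) ≤⊕< 0<1)
         (solve 3 (λ x e q → x :- (e :+ q) :+ (q :- x) :+ (e :- num 1) :+ num 1 := num 0) refl
           x (expSum y k) (y ^ m ÷ fromℕ (m !)))

  -- The quotient is eventually below `L + 1`; positivity of `log` from 2 on allows the division to
  -- be cleared.
  logarithmic-bound : ∀ (r : ℝ → ℝ) {L} → Lim∞ (λ x → ∣ r x ∣ ÷ log x) L →
                      Eventually (λ x → 1# + 1# ≤ x × ∣ r x ∣ ≤ (∣ L ∣ + 1#) * log x)
  logarithmic-bound r {L} lim = map∞ (λ x (near , 2≤x) → 2≤x ,
      bound (log-pos 2≤x) (∣∣<⇒< near)) (lim 1# 0<1 ∧∞ (1# + 1# , λ x 2<x → inj₁ 2<x))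
    where
    bound : ∀ {y l} → 0# < l → y ÷ l - L < 1# → y ≤ (∣ L ∣ + 1#) * l
    bound {y} {l} 0<l near = by≤
      ((gap≤ (inj₁ near) ⊕ gap≤ (≤∣∣ L)) ⊗ inj₁ 0<l ⊕ gap≤ (≡⇒≥ (÷-* y 0<l)))
      (solve 5 (λ y l L B q → (num 1 :- (q :- L) :+ (B :- L)) :* l :+ (q :* l :- y) := (B :+ num 1) :* l :- y)
        refl y l L ∣ L ∣ (y ÷ l))

-- Scales at which a function of linear growth increases little.

module DyadicScales (em : ExcludedMiddle 0ℓ) (R : CompleteOrderedField) where
  open RealAnalysis R
  open OrderedField R
  open Analysis em R

  n≤2^n : ∀ n → n ℕ.≤ 2 ℕ.^ n
  n≤2^n zero    = ℕ.z≤n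
  n≤2^n (suc n) = ℕP.≤-trans (ℕP.+-mono-≤ (ℕP.m^n>0 2 n) (n≤2^n n))
    (ℕP.≤-reflexive (cong (2 ℕ.^ n ℕ.+_) (sym (ℕP.+-identityʳ (2 ℕ.^ n)))))

  private
    telescope : (f : ℕ → ℝ) (c : ℝ) (M : ℕ) → (∀ m → M ℕ.≤ m → f m + c ≤ f (suc m)) →
                ∀ j → f M + fromℕ j * c ≤ f (j ℕ.+ M)
    telescope f c M step zero    = ≡⇒≤ (solve 2 (λ x c → x :+ num 0 :* c := x) refl (f M) c)
    telescope f c M step (suc j) = ≤-trans
      (by≤ (gap≤ (telescope f c M step j))
        (solve 4 (λ x c j y → y :- (x :+ j :* c) := y :+ c :- (x :+ (num 1 :+ j) :* c)) refl (f M) c (fromℕ j) (f (j ℕ.+ M))))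
      (step (j ℕ.+ M) (ℕP.m≤n+m M j))

  -- If all increments from `M` on exceeded `C + 1#`, telescoping would overtake the bound
  -- `C * fromℕ m`. As `M` is arbitrary, small increments recur infinitely often.
  small-increment : (f : ℕ → ℝ) (C : ℝ) (M : ℕ) → (∀ m → M ℕ.≤ m → f m ≤ C * fromℕ m) →
                    ∃[ m ] (M ℕ.≤ m × f (suc m) ≤ f m + (C + 1#))
  small-increment f C M bound with em {∃[ m ] (M ℕ.≤ m × f (suc m) ≤ f m + (C + 1#))}
  ... | yes found = found
  ... | no  none  =
    let j , large = archimedean (C * fromℕ M - f M)
        below = telescope f (C + 1#) M (λ m M≤m → inj₁ (≰⇒> λ le → none (m , M≤m , le))) j
        above = subst (λ z → f (j ℕ.+ M) ≤ C * z) (fromℕ-+ j M) (bound (j ℕ.+ M) (ℕP.m≤n+m M j))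
    in ⊥-elim (by⊥ (gap≤ below ⊕ gap≤ above ≤⊕< gap< large)
         (solve 5 (λ x c m j y → y :- (x :+ j :* (c :+ num 1)) :+ (c :* (j :+ m) :- y) :+ (j :- (c :* m :- x)) := num 0)
           refl (f M) C (fromℕ M) (fromℕ j) (f (j ℕ.+ M))))

-- Positive upper density, and sets supported on windows.

module UpperDensity (em : ExcludedMiddle 0ℓ) (R : CompleteOrderedField) where
  open RealAnalysis R
  open OrderedField R
  open Analysis em R
  private
    module CR = CommutativeRing commutativeRing

  module _ {A : Pred ℕ 0ℓ} (A? : Decidable A) where

    private
      filter-suc : ∀ N → filter A? (applyUpTo suc (suc N)) ≡ filter A? (applyUpTo suc N) ++ filter A? [ suc N ]
      filter-suc N = trans (cong (filter A?) (sym (ListP.applyUpTo-∷ʳ suc N)))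
        (ListP.filter-++ A? (applyUpTo suc N) [ suc N ])

      count-suc : ∀ N → count A? (suc N) ≡ count A? N ℕ.+ length (filter A? [ suc N ])
      count-suc N = trans (cong length (filter-suc N)) (ListP.length-++ (filter A? (applyUpTo suc N)))

    count-mono : ∀ {m n} → m ℕ.≤ n → count A? m ℕ.≤ count A? n
    count-mono m≤n = go (ℕP.≤⇒≤′ m≤n)
      where
      go : ∀ {m n} → m ℕ.≤′ n → count A? m ℕ.≤ count A? n
      go ℕ.≤′-refl = ℕP.≤-refl
      go (ℕ.≤′-step {n} m≤n) = ℕP.≤-trans (go m≤n)
        (ℕP.≤-trans (ℕP.m≤m+n _ _) (ℕP.≤-reflexive (sym (count-suc n))))

    count-member : ∀ {N x} → A x → N ℕ.< x → suc (count A? N) ℕ.≤ count A? x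
    count-member {N} {suc x} x∈A (ℕ.s≤s N≤x) = ℕP.≤-trans (ℕ.s≤s (count-mono N≤x)) (ℕP.≤-reflexive (sym (trans
      (count-suc x) (trans (cong (λ l → count A? x ℕ.+ length l) (ListP.filter-accept A? {xs = []} x∈A))
        (ℕP.+-comm (count A? x) 1)))))

    count≤ : ∀ N → count A? N ℕ.≤ N
    count≤ N = ℕP.≤-trans (ListP.length-filter A? (applyUpTo suc N)) (ℕP.≤-reflexive (ListP.length-applyUpTo suc N))

    count-blocks : ∀ L s h → (∀ k → k ℕ.< h → ∃[ x ] (A x × s ℕ.+ k ℕ.* L ℕ.< x × x ℕ.≤ s ℕ.+ suc k ℕ.* L)) →
                   ∀ k → k ℕ.≤ h → k ℕ.≤ count A? (s ℕ.+ k ℕ.* L)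
    count-blocks L s h blocks zero    _   = ℕ.z≤n
    count-blocks L s h blocks (suc k) k<h =
      let x , x∈A , lo , hi = blocks k k<h
      in ℕP.≤-trans (ℕ.s≤s (count-blocks L s h blocks k (ℕP.<⇒≤ k<h)))
           (ℕP.≤-trans (count-member x∈A lo) (count-mono hi))

    frequency : ℕ → ℝ
    frequency N = fromℕ (count A? N) ÷ fromℕ N

    frequency≤1 : ∀ N → frequency N ≤ 1#
    frequency≤1 zero    = subst (_≤ 1#) (sym (CR.zeroˡ _)) 0≤1
    frequency≤1 (suc N) = let 0<N = fromℕ-pos {suc N} (ℕ.s≤s ℕ.z≤n) in *-cancelʳ-≤ 0<N
      (≤-trans (≡⇒≤ (÷-* _ 0<N)) (≤-trans (fromℕ-mono (count≤ (suc N))) (≡⇒≥ (CR.*-identityˡ _))))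

    -- Completeness supplies suprema, so the infimum of the tail suprema is obtained as the supremum
    -- of their lower bounds. One of these is `δ`, which gives positivity.
    upperDensity-positive : ∀ {δ} → 0# < δ → (∀ M → ∃[ N ] (M ℕ.≤ N × δ ≤ frequency N)) →
                            ∃[ d ] (IsUpperDensity A? d × 0# < d)
    upperDensity-positive {δ} 0<δ frequent =
      d , (d-lower , λ b b-lower → proj₁ (proj₂ lub) b b-lower)
        , <-≤-trans 0<δ (proj₁ (proj₂ lub) δ δ-lower)
      where
      Tail : ℕ → Pred ℝ 0ℓ
      Tail M s = ∃[ N ] (M ℕ.≤ N × s ≡ frequency N)
      TailSup : Pred ℝ 0ℓ
      TailSup t = ∃[ M ] IsLUB (Tail M) t
      δ-lower : IsLowerBound TailSup δ
      δ-lower t (M , t-lub) = let N , M≤N , δ≤ = frequent M in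
        ≤-trans δ≤ (proj₁ t-lub (frequency N) (N , M≤N , refl))
      tailSup₀ : ∃ TailSup
      tailSup₀ = let t , t-lub = complete (Tail 0) (frequency 0 , 0 , ℕ.z≤n , refl)
                       (1# , λ { _ (N , _ , refl) → frequency≤1 N })
                 in t , 0 , t-lub
      lub : ∃ (IsLUB (IsLowerBound TailSup))
      lub = complete (IsLowerBound TailSup) (δ , δ-lower)
              (proj₁ tailSup₀ , λ b b-lower → b-lower (proj₁ tailSup₀) (proj₂ tailSup₀))
      d = proj₁ lub
      d-lower : IsLowerBound TailSup d
      d-lower t t∈ = proj₂ (proj₂ lub) t λ b b-lower → b-lower t t∈

  -- The set consists of the members of C in windows (12hL , 13hL]: the larger of two of its
  -- elements determines a window h for which the sum lies in (12hL , 26hL].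
  sum-avoiding-set : (S C : Pred ℕ 0ℓ) (L : ℕ) → 0 ℕ.< L →
    (∀ N → ∃[ x ] (C x × N ℕ.< x × x ℕ.≤ N ℕ.+ L)) →
    (∀ M → ∃[ h ] (M ℕ.≤ h × (∀ x y → C x → C y → 12 ℕ.* (h ℕ.* L) ℕ.< x ℕ.+ y →
                                x ℕ.+ y ℕ.≤ 26 ℕ.* (h ℕ.* L) → ¬ S (x ℕ.+ y)))) →
    ∃[ A ] ∃[ A? ] (A ⊆ NonZero × (∃[ δ ] (IsUpperDensity {A} A? δ × 0# < δ))
      × ¬ (∃[ x ] ∃[ y ] (x ∈ A × y ∈ A × S (x ℕ.+ y))))
  sum-avoiding-set S C L 0<L syndetic avoiding =
    A , A? , nonZero , upperDensity-positive A? (⁻¹-pos 0<13L) frequent , sums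
    where
    Avoiding : Pred ℕ 0ℓ
    Avoiding h = ∀ x y → C x → C y → 12 ℕ.* (h ℕ.* L) ℕ.< x ℕ.+ y →
                 x ℕ.+ y ℕ.≤ 26 ℕ.* (h ℕ.* L) → ¬ S (x ℕ.+ y)
    A : Pred ℕ 0ℓ
    A x = C x × (∃[ h ] (Avoiding h × 12 ℕ.* (h ℕ.* L) ℕ.< x × x ℕ.≤ 13 ℕ.* (h ℕ.* L)))
    A? : Decidable A
    A? x = em
    nonZero : A ⊆ NonZero
    nonZero (_ , _ , _ , lt , _) = ℕ.>-nonZero (ℕP.≤-<-trans ℕ.z≤n lt)
    0<13L : 0# < fromℕ (13 ℕ.* L)
    0<13L = fromℕ-pos (ℕP.*-mono-≤ {1} {13} {1} {L} (ℕ.s≤s ℕ.z≤n) 0<L)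

    window : ∀ h → 12 ℕ.* (h ℕ.* L) ℕ.+ h ℕ.* L ≡ 13 ℕ.* (h ℕ.* L)
    window h = ℕP.+-comm (12 ℕ.* (h ℕ.* L)) (h ℕ.* L)

    count-window : ∀ h → Avoiding h → h ℕ.≤ count A? (13 ℕ.* (h ℕ.* L))
    count-window h avoid = subst (λ N → h ℕ.≤ count A? N) (window h)
      (count-blocks A? L (12 ℕ.* (h ℕ.* L)) h block h ℕP.≤-refl)
      where
      block : ∀ k → k ℕ.< h → ∃[ x ] (A x × 12 ℕ.* (h ℕ.* L) ℕ.+ k ℕ.* L ℕ.< x
                                          × x ℕ.≤ 12 ℕ.* (h ℕ.* L) ℕ.+ suc k ℕ.* L)
      block k k<h =
        let x , x∈C , lo , hi = syndetic (12 ℕ.* (h ℕ.* L) ℕ.+ k ℕ.* L)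
            hi′ = ℕP.≤-trans hi (ℕP.≤-reflexive (trans (ℕP.+-assoc (12 ℕ.* (h ℕ.* L)) (k ℕ.* L) L)
                    (cong (12 ℕ.* (h ℕ.* L) ℕ.+_) (ℕP.+-comm (k ℕ.* L) L))))
        in x , (x∈C , h , avoid , ℕP.≤-<-trans (ℕP.m≤m+n _ _) lo
                  , ℕP.≤-trans hi′ (ℕP.≤-trans (ℕP.+-monoʳ-≤ (12 ℕ.* (h ℕ.* L)) (ℕP.*-monoˡ-≤ L k<h))
                      (ℕP.≤-reflexive (window h))))
             , lo , hi′

    frequent : ∀ M → ∃[ N ] (M ℕ.≤ N × fromℕ (13 ℕ.* L) ⁻¹ ≤ frequency A? N)
    frequent M =
      -- Asking for `suc M` forces `h ≥ 1`, so the end point `13hL` is positive and can serve as a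
      -- divisor.
      let h , 1+M≤h , avoid = avoiding (suc M)
          h≤13hL = ℕP.≤-trans (ℕP.≤-trans (ℕP.≤-reflexive (sym (ℕP.*-identityʳ h))) (ℕP.*-monoʳ-≤ h 0<L))
                     (ℕP.m≤m+n (h ℕ.* L) (12 ℕ.* (h ℕ.* L)))
          0<N = fromℕ-pos (ℕP.≤-trans (ℕP.≤-trans (ℕ.s≤s ℕ.z≤n) 1+M≤h) h≤13hL)
      in 13 ℕ.* (h ℕ.* L) , ℕP.≤-trans (ℕP.≤-trans (ℕP.n≤1+n M) 1+M≤h) h≤13hL
         , ≤÷ 0<N (≤-trans (≡⇒≤ (proportion h)) (fromℕ-mono (count-window h avoid)))
      where
      proportion : ∀ h → fromℕ (13 ℕ.* L) ⁻¹ * fromℕ (13 ℕ.* (h ℕ.* L)) ≡ fromℕ h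
      proportion h = trans (cong (fromℕ (13 ℕ.* L) ⁻¹ *_) (trans (cong fromℕ swap) (fromℕ-* h (13 ℕ.* L))))
        (trans (solve 3 (λ i h l → i :* (h :* l) := h :* (l :* i)) refl (fromℕ (13 ℕ.* L) ⁻¹) (fromℕ h) (fromℕ (13 ℕ.* L)))
          (trans (cong (fromℕ h *_) (⁻¹-inverseʳ (fromℕ (13 ℕ.* L)) (x≢0 0<13L))) (CR.*-identityʳ (fromℕ h))))
        where
        swap : 13 ℕ.* (h ℕ.* L) ≡ h ℕ.* (13 ℕ.* L)
        swap = trans (sym (ℕP.*-assoc 13 h L)) (trans (cong (ℕ._* L) (ℕP.*-comm 13 h)) (ℕP.*-assoc h 13 L))

    double-window : ∀ {x y h h′} → x ℕ.≤ 13 ℕ.* (h ℕ.* L) → y ℕ.≤ 13 ℕ.* (h′ ℕ.* L) → h ℕ.≤ h′ →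
                    x ℕ.+ y ℕ.≤ 26 ℕ.* (h′ ℕ.* L)
    double-window {h′ = h′} x≤ y≤ h≤h′ = ℕP.≤-trans
      (ℕP.+-mono-≤ (ℕP.≤-trans x≤ (ℕP.*-monoʳ-≤ 13 (ℕP.*-monoˡ-≤ L h≤h′))) y≤)
      (ℕP.≤-reflexive (sym (ℕP.*-distribʳ-+ (h′ ℕ.* L) 13 13)))

    sums : ¬ (∃[ x ] ∃[ y ] (x ∈ A × y ∈ A × S (x ℕ.+ y)))
    sums (x , y , (x∈C , h , avoid , lo , hi) , (y∈C , h′ , avoid′ , lo′ , hi′) , x+y∈S) with ℕP.≤-total h h′
    ... | inj₁ h≤h′ = avoid′ x y x∈C y∈C (ℕP.<-≤-trans lo′ (ℕP.m≤n+m y x)) (double-window hi hi′ h≤h′) x+y∈S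
    ... | inj₂ h′≤h = avoid x y x∈C y∈C (ℕP.<-≤-trans lo (ℕP.m≤m+n x y))
          (ℕP.≤-trans (ℕP.≤-reflexive (ℕP.+-comm x y)) (double-window hi′ hi h′≤h)) x+y∈S

-- The sum-avoiding set, from tame scales and polynomial gaps.

module Avoidance (em : ExcludedMiddle 0ℓ) (R : CompleteOrderedField) where
  open RealAnalysis R
  open OrderedField R
  open Analysis em R
  open HardyFields em R
  open Growth em R
  open IntegerPolynomialGaps em
  open LogarithmBounds em R
  open DyadicScales em R
  open UpperDensity em R
  private
    module CR = CommutativeRing commutativeRing

  eval-fromℤ : ∀ p i → eval p (fromℤ i) ≡ fromℤ (evalℤ p i)
  eval-fromℤ []      i = refl
  eval-fromℤ (a ∷ p) i = sym (trans (fromℤ-+ a (i ℤ.* evalℤ p i))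
    (cong (fromℤ a +_) (trans (fromℤ-* i (evalℤ p i)) (cong (fromℤ i *_) (sym (eval-fromℤ p i))))))

  -- Induction on the number of classes: if the last class does not recur forever, it is absent
  -- beyond some `M₀` and the others carry all later occurrences.
  frequently-pigeonhole : ∀ T {X : ℕ → Pred ℕ 0ℓ} →
    (∀ M → ∃[ m ] (M ℕ.≤ m × (∃[ t ] (t ℕ.< T × X t m)))) →
    ∃[ t ] ∀ M → ∃[ m ] (M ℕ.≤ m × X t m)
  frequently-pigeonhole zero frequent with () ← proj₁ (proj₂ (proj₂ (proj₂ (frequent 0))))
  frequently-pigeonhole (suc T) {X} frequent with em {∀ M → ∃[ m ] (M ℕ.≤ m × X T m)}
  ... | yes always = T , always
  ... | no  ¬always with em {∃[ M ] ∀ m → M ℕ.≤ m → ¬ X T m}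
  ...   | no  ¬never = ⊥-elim (¬always λ M → decide M em)
    where
    decide : ∀ M → Dec (∃[ m ] (M ℕ.≤ m × X T m)) → ∃[ m ] (M ℕ.≤ m × X T m)
    decide M (yes found) = found
    decide M (no  none)  = ⊥-elim (¬never (M , λ m M≤m XTm → none (m , M≤m , XTm)))
  ...   | yes (M₀ , never) = frequently-pigeonhole T λ M →
    let m , le , t , t<1+T , Xtm = frequent (M ℕ.⊔ M₀)
        M₀≤m = ℕP.≤-trans (ℕP.m≤n⊔m M M₀) le
    in m , ℕP.≤-trans (ℕP.m≤m⊔n M M₀) le , t
         , ℕP.≤∧≢⇒< (ℕP.≤-pred t<1+T) (λ t≡T → never m M₀≤m (subst (λ t → X t m) t≡T Xtm)) , Xtm

  -- In the name, "below" refers to the indices; the bound on the values is an upper one.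
  bounded-below : (f : ℕ → ℝ) (N : ℕ) → ∃[ B ] ∀ n → n ℕ.< N → f n ≤ B
  bounded-below f zero    = 0# , λ n ()
  bounded-below f (suc N) =
    let B , bound = bounded-below f N
        B′ , B≤B′ , fN≤B′ = upper B (f N)
    in B′ , λ n n<1+N → extend B≤B′ fN≤B′ (bound n) (ℕP.m≤n⇒m<n∨m≡n (ℕP.≤-pred n<1+N))
    where
    extend : ∀ {B B′ n} → B ≤ B′ → f N ≤ B′ → (n ℕ.< N → f n ≤ B) → n ℕ.< N ⊎ n ≡ N → f n ≤ B′
    extend B≤B′ _ bound (inj₁ n<N) = ≤-trans (bound n<N) B≤B′
    extend _ fN≤B′ _ (inj₂ refl) = fN≤B′

  -- The hypotheses give `120hl < 10w ≤ 11U < 110(h + 1)l`, which fails for `h ≥ 11`; this is the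
  -- origin of the threshold 11.
  too-small : ∀ {a U w h l} → fromℕ 10 * a ≤ fromℕ 11 * U → U < h * (fromℕ 10 * l) + fromℕ 10 * l →
              w ≤ a → fromℕ 12 * (h * l) < w → fromℕ 11 ≤ h → 0# ≤ l → ⊥
  too-small {a} {U} {w} {h} {l} 10a≤ U< w≤a 12hl<w 11≤h 0≤l = by⊥
    (fromℕ-nonneg 10 ⊗ gap≤ w≤a ⊕ gap≤ 10a≤ ⊕ fromℕ-nonneg 11 ⊗ gap≤ (inj₁ U<) ⊕ fromℕ-nonneg 10 ⊗ (0≤l ⊗ gap≤ 11≤h)
     ≤⊕< *-pos (fromℕ-pos {10} (ℕ.s≤s ℕ.z≤n)) (gap< 12hl<w))
    (solve 5 (λ a U w h l → num 10 :* (a :- w) :+ (num 11 :* U :- num 10 :* a)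
        :+ num 11 :* (h :* (num 10 :* l) :+ num 10 :* l :- U) :+ num 10 :* (l :* (h :- num 11))
        :+ num 10 :* (w :- num 12 :* (h :* l)) := num 0) refl a U w h l)

  -- Here `10a ≥ 27U ≥ 270hl`, while `10a < 10w + 10 ≤ 260hl + 10`; the margin `10hl` exceeds 10.
  too-large : ∀ {a U w h l} → fromℕ 27 * U ≤ fromℕ 10 * a → h * (fromℕ 10 * l) ≤ U →
              a < w + 1# → w ≤ fromℕ 26 * (h * l) → fromℕ 11 ≤ h → 1# ≤ l → ⊥
  too-large {a} {U} {w} {h} {l} 27U≤ ≤U a<w+1 w≤ 11≤h 1≤l = by⊥
    (gap≤ 27U≤ ⊕ fromℕ-nonneg 27 ⊗ gap≤ ≤U ⊕ fromℕ-nonneg 10 ⊗ gap≤ w≤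
     ⊕ fromℕ-nonneg 10 ⊗ (≤-trans (fromℕ-nonneg 11) 11≤h ⊗ gap≤ 1≤l) ⊕ fromℕ-nonneg 10 ⊗ gap≤ 11≤h ⊕ fromℕ-nonneg 100
     ≤⊕< *-pos (fromℕ-pos {10} (ℕ.s≤s ℕ.z≤n)) (gap< a<w+1))
    (solve 5 (λ a U w h l → num 10 :* a :- num 27 :* U :+ num 27 :* (U :- h :* (num 10 :* l))
        :+ num 10 :* (num 26 :* (h :* l) :- w) :+ num 10 :* (h :* (l :- num 1)) :+ num 10 :* (h :- num 11) :+ num 100
        :+ num 10 :* (w :+ num 1 :- a) := num 0) refl a U w h l)

  upper-estimate : ∀ {u g U} → u ≤ U → fromℕ 10 * ∣ g ∣ ≤ u → fromℕ 10 * (u + g) ≤ fromℕ 11 * U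
  upper-estimate {u} {g} {U} u≤U 10g≤u = by≤
    (fromℕ-nonneg 11 ⊗ gap≤ u≤U ⊕ gap≤ 10g≤u ⊕ fromℕ-nonneg 10 ⊗ gap≤ (≤∣∣ g))
    (solve 4 (λ u g U b → num 11 :* (U :- u) :+ (u :- num 10 :* b) :+ num 10 :* (b :- g)
      := num 11 :* U :- num 10 :* (u :+ g)) refl u g U ∣ g ∣)

  lower-estimate : ∀ {u g U} → fromℕ 3 * U ≤ u → fromℕ 10 * ∣ g ∣ ≤ u → fromℕ 27 * U ≤ fromℕ 10 * (u + g)
  lower-estimate {u} {g} {U} 3U≤u 10g≤u = by≤
    (fromℕ-nonneg 9 ⊗ gap≤ 3U≤u ⊕ gap≤ 10g≤u ⊕ fromℕ-nonneg 10 ⊗ gap≤ (-≤∣∣ g))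
    (solve 4 (λ u g U b → num 9 :* (u :- num 3 :* U) :+ (u :- num 10 :* b) :+ num 10 :* (b :- (:- g))
      := num 10 :* (u :+ g) :- num 27 :* U) refl u g U ∣ g ∣)

  bounded-estimate : ∀ {a U} → a ≤ U → 0# ≤ U → fromℕ 10 * a ≤ fromℕ 11 * U
  bounded-estimate {a} {U} a≤U 0≤U = by≤ (fromℕ-nonneg 10 ⊗ gap≤ a≤U ⊕ 0≤U)
    (solve 2 (λ a U → num 10 :* (U :- a) :+ U := num 11 :* U :- num 10 :* a) refl a U)

  private
    -- Here `b` is the left end of the gap and `ρ` the value of `g` at the start of the scale. The
    -- offset `2 + V` in `z + z` pays `V` for the drift of `g`, 1 for the width of the phase
    -- interval of `ρ`, and 1 for strictness.
    gap-lower : ∀ {x y u g ρ V t K J J′ z b} → x + y ≤ u + g → g - ρ ≤ V → ρ ≤ K + t + 1# →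
                z + J ≤ x → z + J′ ≤ y → z + z ≡ t + fromℕ 2 + V + b → b + (J + J′ - K) < u
    gap-lower {x} {y} {u} {g} {ρ} {V} {t} {K} {J} {J′} {z} {b} w≤ g≤ ρ≤ x≥ y≥ 2z≡ = by<
      (gap≤ w≤ ⊕ gap≤ g≤ ⊕ gap≤ ρ≤ ⊕ gap≤ x≥ ⊕ gap≤ y≥ ⊕ gap≤ (≡⇒≥ 2z≡) ≤⊕< 0<1)
      (solve 12 (λ x y u g ρ V t K J J′ z b →
          u :+ g :- (x :+ y) :+ (V :- (g :- ρ)) :+ (K :+ t :+ num 1 :- ρ) :+ (x :- (z :+ J)) :+ (y :- (z :+ J′))
          :+ (z :+ z :- (t :+ num 2 :+ V :+ b)) :+ num 1 := u :- (b :+ (J :+ J′ :- K)))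
        refl x y u g ρ V t K J J′ z b)

    -- The largest excess over the left end consists of the offset `2 + V`, the drift `V`, 1 for the
    -- position of each of `x` and `y`, and 1 for the floor. This is the required gap length
    -- `5 + 2V`.
    gap-upper : ∀ {x y u g ρ V t K J J′ z b s} → u + g < x + y + 1# → - V ≤ g - ρ → K + t ≤ ρ →
                x ≤ z + J + 1# → y ≤ z + J′ + 1# → z + z ≡ t + fromℕ 2 + V + b → fromℕ 5 + (V + V) ≤ s →
                u < b + (J + J′ - K) + s
    gap-upper {x} {y} {u} {g} {ρ} {V} {t} {K} {J} {J′} {z} {b} {s} <w+1 g≥ ρ≥ x≤ y≤ 2z≡ s≥ = by<
      (gap≤ g≥ ⊕ gap≤ ρ≥ ⊕ gap≤ x≤ ⊕ gap≤ y≤ ⊕ gap≤ (≡⇒≤ 2z≡) ⊕ gap≤ s≥ ≤⊕< gap< <w+1)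
      (solve 13 (λ x y u g ρ V t K J J′ z b s →
          g :- ρ :- (:- V) :+ (ρ :- (K :+ t)) :+ (z :+ J :+ num 1 :- x) :+ (z :+ J′ :+ num 1 :- y)
          :+ (t :+ num 2 :+ V :+ b :- (z :+ z)) :+ (s :- (num 5 :+ (V :+ V))) :+ (x :+ y :+ num 1 :- (u :+ g))
          := b :+ (J :+ J′ :- K) :+ s :- u)
        refl x y u g ρ V t K J J′ z b s)

  module _ (p : List ℤ) (d : ℕ) (lead : PositiveLead p (suc (suc d))) (c : ℝ) (0<c : 0# < c)
           (a g : ℕ → ℝ) (a≡ : ∀ n → a n ≡ c * p ⟨ n ⟩ + g n)
           (C : ℝ) (g-linear : Eventuallyℕ (λ n → ∣ g n ∣ ≤ C * fromℕ n))
           (g-logarithmic : Eventuallyℕ (λ m → ∣ g (2 ℕ.^ m) ∣ ≤ C * fromℕ m))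
           (g-monotone : (∃[ N ] ∀ {m n} → N ℕ.≤ m → m ℕ.≤ n → g m ≤ g n)
                       ⊎ (∃[ N ] ∀ {m n} → N ℕ.≤ m → m ℕ.≤ n → g n ≤ g m)) where

    V : ℝ
    V = C + 1#

    Tame : Pred ℕ 0ℓ
    Tame m = ∀ n → 2 ℕ.^ m ℕ.≤ n → n ℕ.≤ 2 ℕ.^ suc m → ∣ g n - g (2 ℕ.^ m) ∣ ≤ V

    0≤V-from : ∀ {x y} → x ≤ y → y ≤ x + V → 0# ≤ V
    0≤V-from {x} {y} x≤y y≤x+V = by≤ (gap≤ x≤y ⊕ gap≤ y≤x+V)
      (solve 3 (λ x y V → y :- x :+ (x :+ V :- y) := V :- num 0) refl x y V)

    between : ∀ {x y z} → x ≤ y → y ≤ z → z ≤ x + V → ∣ y - x ∣ ≤ V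
    between {x} {y} {z} x≤y y≤z z≤x+V = ∣∣-≤
      (by≤ (gap≤ x≤y ⊕ 0≤V-from (≤-trans x≤y y≤z) z≤x+V) (solve 3 (λ x y V → y :- x :+ V := y :- x :- (:- V)) refl x y V))
      (by≤ (gap≤ y≤z ⊕ gap≤ z≤x+V) (solve 4 (λ x y z V → z :- y :+ (x :+ V :- z) := V :- (y :- x)) refl x y z V))

    between-neg : ∀ {x y z} → y ≤ x → z ≤ y → - z ≤ - x + V → ∣ y - x ∣ ≤ V
    between-neg {x} {y} {z} y≤x z≤y z≥x-V = ∣∣-≤
      (by≤ (gap≤ z≤y ⊕ gap≤ z≥x-V) (solve 4 (λ x y z V → y :- z :+ ((:- x) :+ V :- (:- z)) := y :- x :- (:- V)) refl x y z V))
      (by≤ (gap≤ y≤x ⊕ gap≤ y≤x ⊕ gap≤ z≤y ⊕ gap≤ z≥x-V)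
        (solve 4 (λ x y z V → x :- y :+ (x :- y) :+ (y :- z) :+ ((:- x) :+ V :- (:- z)) := V :- (y :- x)) refl x y z V))

    -- By monotonicity the variation over a dyadic block is the difference of its end values.
    -- `small-increment` bounds it for `g`, or for `- g` in the decreasing case, which is why `V` is
    -- `C + 1#`.
    frequently-tame : ∀ M → ∃[ m ] (M ℕ.≤ m × Tame m)
    frequently-tame M = choose g-monotone
      where
      M₀ = proj₁ g-logarithmic
      module _ (N : ℕ) where
        M₁ = M ℕ.⊔ (M₀ ℕ.⊔ N)
        M≤ : ∀ {m} → M₁ ℕ.≤ m → M ℕ.≤ m
        M≤ = ℕP.≤-trans (ℕP.m≤m⊔n M (M₀ ℕ.⊔ N))
        M₀≤ : ∀ {m} → M₁ ℕ.≤ m → M₀ ℕ.≤ m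
        M₀≤ = ℕP.≤-trans (ℕP.≤-trans (ℕP.m≤m⊔n M₀ N) (ℕP.m≤n⊔m M (M₀ ℕ.⊔ N)))
        N≤2^ : ∀ {m} → M₁ ℕ.≤ m → N ℕ.≤ 2 ℕ.^ m
        N≤2^ {m} le = ℕP.≤-trans (ℕP.≤-trans (ℕP.≤-trans (ℕP.m≤n⊔m M₀ N) (ℕP.m≤n⊔m M (M₀ ℕ.⊔ N))) le) (n≤2^n m)
      choose : (∃[ N ] ∀ {m n} → N ℕ.≤ m → m ℕ.≤ n → g m ≤ g n)
             ⊎ (∃[ N ] ∀ {m n} → N ℕ.≤ m → m ℕ.≤ n → g n ≤ g m) → ∃[ m ] (M ℕ.≤ m × Tame m)
      choose (inj₁ (N , mono)) =
        let m , le , inc = small-increment (λ m → g (2 ℕ.^ m)) C (M₁ N)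
              (λ m le → ≤-trans (≤∣∣ _) (proj₂ g-logarithmic m (M₀≤ N le)))
        in m , M≤ N le , λ n lo hi →
             between (mono (N≤2^ N le) lo) (mono (ℕP.≤-trans (N≤2^ N le) lo) hi) inc
      choose (inj₂ (N , anti)) =
        let m , le , inc = small-increment (λ m → - g (2 ℕ.^ m)) C (M₁ N)
              (λ m le → ≤-trans (-≤∣∣ _) (proj₂ g-logarithmic m (M₀≤ N le)))
        in m , M≤ N le , λ n lo hi →
             between-neg (anti (N≤2^ N le) lo) (anti (ℕP.≤-trans (N≤2^ N le) lo) hi) inc

    u : ℕ → ℝ
    u n = c * p ⟨ n ⟩

    scale-≤ : ∀ {x y} → x ≤ y → c * x ≤ c * y
    scale-≤ {x} {y} x≤y = by≤ (inj₁ 0<c ⊗ gap≤ x≤y) (solve 3 (λ c x y → c :* (y :- x) := c :* y :- c :* x) refl c x y)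

    Dominated : Pred ℕ 0ℓ
    Dominated n = fromℕ 10 * ∣ g n ∣ ≤ u n

    -- `g` is at most linear and `p` superlinear; the slope `10C ÷ c` is chosen so that
    -- multiplication by `c` turns it into `10C`.
    eventually-dominated : Eventuallyℕ Dominated
    eventually-dominated = mapℕ (λ n (linear , superlinear) → ≤-trans
        (by≤ (fromℕ-nonneg 10 ⊗ gap≤ linear ⊕ gap≤ (≡⇒≤ (÷-* (fromℕ 10 * C) 0<c)) ⊗ fromℕ-nonneg n
              ⊕ gap≤ (≡⇒≥ (÷-* (fromℕ 10 * C) 0<c)) ⊗ fromℕ-nonneg n)
          (solve 5 (λ b C n c q → num 10 :* (C :* n :- b) :+ (num 10 :* C :- q :* c) :* n
              :+ (q :* c :- num 10 :* C) :* n := num 10 :* (C :* n) :- num 10 :* b)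
            refl ∣ g n ∣ C (fromℕ n) c (fromℕ 10 * C ÷ c)))
        (≤-trans (≡⇒≤ (trans (solve 2 (λ C n → num 10 :* (C :* n) := num 10 :* C :* n) refl C (fromℕ n))
            (trans (cong (_* fromℕ n) (sym (÷-* (fromℕ 10 * C) 0<c)))
              (solve 3 (λ q c n → q :* c :* n := c :* (q :* n)) refl (fromℕ 10 * C ÷ c) c (fromℕ n)))))
          (scale-≤ superlinear)))
      (g-linear ∧ℕ eventually-superlinear p d lead (fromℕ 10 * C ÷ c))

    eventually-increasing : Eventuallyℕ (PositiveIncreasing p)
    eventually-increasing = eventually-positiveIncreasing p (suc (suc d)) lead

    regular : Eventuallyℕ (λ n → Dominated n × fromℕ 3 * p ⟨ n ⟩ ≤ p ⟨ n ℕ.+ n ⟩ × PositiveIncreasing p n)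
    regular = eventually-dominated ∧ℕ eventually-doubling p d lead ∧ℕ eventually-increasing

    n₁ : ℕ
    n₁ = proj₁ regular

    dominated : ∀ {n} → n₁ ℕ.≤ n → Dominated n
    dominated {n} le = proj₁ (proj₂ regular n le)

    doubling : ∀ {n} → n₁ ℕ.≤ n → fromℕ 3 * u n ≤ u (n ℕ.+ n)
    doubling {n} le = ≤-trans
      (≡⇒≤ (solve 2 (λ c x → num 3 :* (c :* x) := c :* (num 3 :* x)) refl c (p ⟨ n ⟩)))
      (scale-≤ (proj₁ (proj₂ (proj₂ regular n le))))

    u-mono : ∀ {m n} → n₁ ℕ.≤ m → m ℕ.≤ n → u m ≤ u n
    u-mono = mono-from u n₁ λ n le → scale-≤ (proj₂ (proj₂ (proj₂ (proj₂ regular n le))))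

    u-nonneg : ∀ {n} → n₁ ℕ.≤ n → 0# ≤ u n
    u-nonneg {n} le = inj₁ 0<c ⊗ ≤-trans 0≤1 (proj₁ (proj₂ (proj₂ (proj₂ regular n le))))

    initial-bound : ∃[ B ] ∀ n → n ℕ.< n₁ → a n ≤ B
    initial-bound = bounded-below a n₁

    -- Up to one tenth, a n is u n, and u triples between 2^m and 2^(m+1).  So if u (2^m) is
    -- close to 10hL, then values of a in the window (12hL , 26hL] are attained only in between.
    module Scale (m : ℕ) (n₁≤2^m : n₁ ℕ.≤ 2 ℕ.^ m) (B≤u : proj₁ initial-bound ≤ u (2 ℕ.^ m)) where

      early : ∀ n → n ℕ.≤ 2 ℕ.^ m → fromℕ 10 * a n ≤ fromℕ 11 * u (2 ℕ.^ m)
      early n n≤2^m = decide (ℕP.≤-<-connex n₁ n)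
        where
        decide : n₁ ℕ.≤ n ⊎ n ℕ.< n₁ → fromℕ 10 * a n ≤ fromℕ 11 * u (2 ℕ.^ m)
        decide (inj₁ n₁≤n) = subst (λ z → fromℕ 10 * z ≤ fromℕ 11 * u (2 ℕ.^ m)) (sym (a≡ n))
          (upper-estimate (u-mono n₁≤n n≤2^m) (dominated n₁≤n))
        decide (inj₂ n<n₁) = bounded-estimate (≤-trans (proj₂ initial-bound n n<n₁) B≤u) (u-nonneg n₁≤2^m)

      late : ∀ n → 2 ℕ.^ suc m ℕ.≤ n → fromℕ 27 * u (2 ℕ.^ m) ≤ fromℕ 10 * a n
      late n 2^≤n = subst (λ z → fromℕ 27 * u (2 ℕ.^ m) ≤ fromℕ 10 * z) (sym (a≡ n))
        (lower-estimate (≤-trans (doubling n₁≤2^m) (u-mono (ℕP.≤-trans n₁≤2^m (ℕP.m≤m+n _ _)) 2+2≤n))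
          (dominated (ℕP.≤-trans n₁≤2^m (ℕP.≤-trans (ℕP.m≤m+n _ _) 2+2≤n))))
        where
        2+2≤n : 2 ℕ.^ m ℕ.+ 2 ℕ.^ m ℕ.≤ n
        2+2≤n = subst (ℕ._≤ n) (cong (2 ℕ.^ m ℕ.+_) (ℕP.+-identityʳ (2 ℕ.^ m))) 2^≤n

      located : ∀ {h L w n} → fromℕ h * (fromℕ 10 * fromℕ L) ≤ u (2 ℕ.^ m) →
                u (2 ℕ.^ m) < fromℕ h * (fromℕ 10 * fromℕ L) + fromℕ 10 * fromℕ L →
                11 ℕ.≤ h → 1 ℕ.≤ L → 12 ℕ.* (h ℕ.* L) ℕ.< w → w ℕ.≤ 26 ℕ.* (h ℕ.* L) →
                fromℕ w ≤ a n → a n < fromℕ w + 1# → 2 ℕ.^ m ℕ.≤ n × n ℕ.≤ 2 ℕ.^ suc m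
      located {h} {L} {w} {n} ≤U U< 11≤h 1≤L lo hi w≤a a<w+1 =
          ℕP.≮⇒≥ (λ n<2^m → too-small (early n (ℕP.<⇒≤ n<2^m)) U< w≤a
            (subst (_< fromℕ w) (fromℕ-*³ 12) (fromℕ-mono-< lo)) (fromℕ-mono 11≤h) (fromℕ-nonneg L))
        , ℕP.≮⇒≥ (λ 2^<n → too-large (late n (ℕP.<⇒≤ 2^<n)) ≤U a<w+1
            (subst (fromℕ w ≤_) (fromℕ-*³ 26) (fromℕ-mono hi)) (fromℕ-mono 11≤h) (fromℕ-1≤ 1≤L))
        where
        fromℕ-*³ : ∀ k → fromℕ (k ℕ.* (h ℕ.* L)) ≡ fromℕ k * (fromℕ h * fromℕ L)
        fromℕ-*³ k = trans (fromℕ-* k (h ℕ.* L)) (cong (fromℕ k *_) (fromℕ-* h L))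

    Value : Pred ℕ 0ℓ
    Value w = ∃[ n ] (NonZero n × ⌊ a n ⌋≡ ℤ.+ w)

    eventually-u≥ : ∀ b → Eventuallyℕ (λ n → b ≤ u n)
    eventually-u≥ b = mapℕ
      (λ n le → ≤-trans (≡⇒≤ (trans (sym (÷-* b 0<c)) (CR.*-comm (b ÷ c) c))) (scale-≤ le))
      (eventually-unbounded p (suc d) lead (b ÷ c))

    module Gap (W Q : ℕ) (v : ℤ) (0<Q : 0 ℕ.< Q) (wide : fromℕ 5 + (V + V) ≤ c * fromℕ (suc W))
               (gap : ∀ n κ → ¬ (v ℤ.+ κ ℤ.* ℤ.+ Q ℤ.< evalℤ p (ℤ.+ n)
                                × evalℤ p (ℤ.+ n) ℤ.< v ℤ.+ κ ℤ.* ℤ.+ Q ℤ.+ ℤ.+ suc W)) where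

      period : ℝ
      period = c * fromℕ Q

      0<period : 0# < period
      0<period = *-pos 0<c (fromℕ-pos 0<Q)

      fromℤ-start : ∀ κ → fromℤ (v ℤ.+ κ ℤ.* ℤ.+ Q) ≡ fromℤ v + fromℤ κ * fromℕ Q
      fromℤ-start κ = trans (fromℤ-+ v (κ ℤ.* ℤ.+ Q)) (cong (fromℤ v +_) (fromℤ-* κ (ℤ.+ Q)))

      u-avoids-gap : ∀ n κ → c * fromℤ v + fromℤ κ * period < u n →
                     u n < c * fromℤ v + fromℤ κ * period + c * fromℕ (suc W) → ⊥
      u-avoids-gap n κ lo hi = gap n κ
        ( fromℤ-cancel-< (subst₂ _<_ (sym (fromℤ-start κ)) (eval-fromℤ p (ℤ.+ n)) (*-cancelʳ-< 0<c
            (by< (gap< lo) (solve 5 (λ c P v κ Q → c :* P :- (c :* v :+ κ :* (c :* Q)) := P :* c :- (v :+ κ :* Q) :* c)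
              refl c (p ⟨ n ⟩) (fromℤ v) (fromℤ κ) (fromℕ Q)))))
        , fromℤ-cancel-< (subst₂ _<_ (eval-fromℤ p (ℤ.+ n))
            (sym (trans (fromℤ-+ (v ℤ.+ κ ℤ.* ℤ.+ Q) (ℤ.+ suc W)) (cong (_+ fromℕ (suc W)) (fromℤ-start κ))))
            (*-cancelʳ-< 0<c
              (by< (gap< hi) (solve 6 (λ c P v κ Q S → c :* v :+ κ :* (c :* Q) :+ c :* S :- c :* P
                  := (v :+ κ :* Q :+ S) :* c :- P :* c)
                refl c (p ⟨ n ⟩) (fromℤ v) (fromℤ κ) (fromℕ Q) (fromℕ (suc W)))))))

      Anchored : ℕ → Pred ℕ 0ℓ
      Anchored t m = ∃[ k ] (fromℤ k * period + fromℕ t ≤ g (2 ℕ.^ m)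
                           × g (2 ℕ.^ m) ≤ fromℤ k * period + fromℕ t + 1#)

      -- The phase is `g (2^m)` reduced modulo the period and rounded down to an integer `t`. There
      -- are at most `T` possible values, so the pigeonhole principle applies.
      anchor : ∀ T → period < fromℕ T * 1# → ∀ m → ∃[ t ] (t ℕ.< T × Anchored t m)
      anchor T period<T m =
        let ρ = g (2 ℕ.^ m)
            k , lo , hi = floorℤ 0<period ρ
            K = fromℤ k * period
            t , t<T , lo′ , hi′ = floorℕ T (ρ - K) (gap≤ lo) (<-trans
              (by< (gap< hi) (solve 3 (λ ρ K l → K :+ l :- ρ := l :- (ρ :- K)) refl ρ K period)) period<T)
        in t , t<T , k
           , by≤ (gap≤ lo′) (solve 3 (λ ρ K t → ρ :- K :- t :* num 1 := ρ :- (K :+ t)) refl ρ K (fromℕ t))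
           , by≤ (inj₁ (gap< hi′)) (solve 3 (λ ρ K t → t :* num 1 :+ num 1 :- (ρ :- K) := K :+ t :+ num 1 :- ρ)
               refl ρ K (fromℕ t))

      frequently-anchored : ∃[ t ] ∀ M → ∃[ m ] (M ℕ.≤ m × Tame m × Anchored t m)
      frequently-anchored =
        let T , period<T = archimedean-* 0<1 period
        in frequently-pigeonhole T λ M →
             let m , M≤m , tame = frequently-tame M
                 t , t<T , anchored = anchor T period<T m
             in m , M≤m , t , t<T , tame , anchored

      module Residue (t : ℕ) where

        -- If g is within V of an element of [t , t + 1] + period ℤ, then any x and y near z + period ℤ
        -- with x + y ≤ u + g < x + y + 1 would put u into one of the gaps above c v + period ℤ.
        z : ℝ
        z = (fromℕ t + fromℕ 2 + V + c * fromℤ v) * ½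

        z+z : z + z ≡ fromℕ t + fromℕ 2 + V + c * fromℤ v
        z+z = trans (solve 2 (λ x h → x :* h :+ x :* h := x :* (h :+ h)) refl (fromℕ t + fromℕ 2 + V + c * fromℤ v) ½)
          (trans (cong ((fromℕ t + fromℕ 2 + V + c * fromℤ v) *_) ½+½) (CR.*-identityʳ _))

        Near : Pred ℕ 0ℓ
        Near x = ∃[ j ] (z + fromℤ j * period ≤ fromℕ x × fromℕ x ≤ z + fromℤ j * period + 1#)

        no-sum : ∀ {m x y n} → Tame m → Anchored t m → Near x → Near y → 2 ℕ.^ m ℕ.≤ n → n ℕ.≤ 2 ℕ.^ suc m →
                 fromℕ (x ℕ.+ y) ≤ a n → a n < fromℕ (x ℕ.+ y) + 1# → ⊥
        no-sum {m} {x} {y} {n} tame (k , ρ≥ , ρ≤) (j , x≥ , x≤) (j′ , y≥ , y≤) lo hi w≤a a<w+1 =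
          -- The translate of the gap is determined by adding the periods of the two summands and
          -- subtracting that of the phase of `g`.
          u-avoids-gap n (j ℤ.+ j′ ℤ.- k)
            (subst (λ s → c * fromℤ v + s < u n) multiple
              (gap-lower {V = V} (subst₂ _≤_ (fromℕ-+ x y) (a≡ n) w≤a) (≤-trans (≤∣∣ _) (tame n lo hi)) ρ≤ x≥ y≥ z+z))
            (subst (λ s → u n < c * fromℤ v + s + c * fromℕ (suc W)) multiple
              (gap-upper {V = V} (subst₂ (λ s w → s < w + 1#) (a≡ n) (fromℕ-+ x y) a<w+1)
                (negated (tame n lo hi)) ρ≥ x≤ y≤ z+z wide))
          where
          multiple : fromℤ j * period + fromℤ j′ * period - fromℤ k * period ≡ fromℤ (j ℤ.+ j′ ℤ.- k) * period
          multiple = trans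
            (solve 4 (λ j j′ k l → j :* l :+ j′ :* l :- k :* l := (j :+ j′ :- k) :* l)
              refl (fromℤ j) (fromℤ j′) (fromℤ k) period)
            (cong (_* period) (sym (trans (fromℤ-- (j ℤ.+ j′) k) (cong (_- fromℤ k) (fromℤ-+ j j′)))))
          negated : ∀ {x} → ∣ x ∣ ≤ V → - V ≤ x
          negated {x} ∣x∣≤V = by≤ (gap≤ ∣x∣≤V ⊕ gap≤ (-≤∣∣ x))
            (solve 3 (λ x V b → V :- b :+ (b :- (:- x)) := x :- (:- V)) refl x V ∣ x ∣)

        near-above : ∀ {y} → 0# ≤ y → ∃[ x ] (y ≤ fromℕ x × fromℕ x ≤ y + 1# × y < fromℕ x)
        near-above {y} 0≤y =
          let T , y<T = archimedean-* 0<1 y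
              k , _ , lo , hi = floorℕ T y 0≤y y<T
              y<1+k : y < fromℕ (suc k)
              y<1+k = by< (gap< hi) (solve 2 (λ k y → k :* num 1 :+ num 1 :- y := num 1 :+ k :- y) refl (fromℕ k) y)
          in suc k , inj₁ y<1+k
             , by≤ (gap≤ lo) (solve 2 (λ k y → y :- k :* num 1 := y :+ num 1 :- (num 1 :+ k)) refl (fromℕ k) y)
             , y<1+k

        near-syndetic : ∀ L → period + 1# ≤ fromℕ L → ∀ N → ∃[ x ] (Near x × N ℕ.< x × x ℕ.≤ N ℕ.+ L)
        near-syndetic L L-large N =
          let j₀ , lo , hi = floorℤ 0<period (fromℕ N - z)
              J₀ = fromℤ j₀ * period
              -- The next period places the target `y` strictly above `N` and at most one period
              -- away; rounding up to an integer costs at most 1 more, hence the length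
              -- `period + 1#`.
              j = ℤ.+ 1 ℤ.+ j₀
              J≡ : fromℤ j * period ≡ period + J₀
              J≡ = trans (cong (_* period) (fromℤ-+ (ℤ.+ 1) j₀))
                (solve 2 (λ j l → (num 1 :+ num 0 :+ j) :* l := l :+ j :* l) refl (fromℤ j₀) period)
              y = z + (period + J₀)
              N<y : fromℕ N < y
              N<y = by< (gap< hi) (solve 4 (λ N z l J → J :+ l :- (N :- z) := z :+ (l :+ J) :- N) refl (fromℕ N) z period J₀)
              x , y≤x , x≤y+1 , y<x = near-above (≤-trans (fromℕ-nonneg N) (inj₁ N<y))
          in x , (j , subst (λ J → z + J ≤ fromℕ x) (sym J≡) y≤x , subst (λ J → fromℕ x ≤ z + J + 1#) (sym J≡) x≤y+1)
             , fromℕ-cancel-< (<-trans N<y y<x)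
             , fromℕ-cancel-≤ (subst (fromℕ x ≤_) (sym (fromℕ-+ N L))
                 (by≤ (gap≤ x≤y+1 ⊕ gap≤ lo ⊕ gap≤ L-large)
                   (solve 6 (λ x z l J N L → z :+ (l :+ J) :+ num 1 :- x :+ (N :- z :- J) :+ (L :- (l :+ num 1)) := N :+ L :- x)
                     refl (fromℕ x) z period J₀ (fromℕ N) (fromℕ L))))

        frequently-avoiding : (∀ M → ∃[ m ] (M ℕ.≤ m × Tame m × Anchored t m)) → ∀ L → 1 ℕ.≤ L → ∀ M →
          ∃[ h ] (M ℕ.≤ h × (∀ x y → Near x → Near y → 12 ℕ.* (h ℕ.* L) ℕ.< x ℕ.+ y →
                               x ℕ.+ y ℕ.≤ 26 ℕ.* (h ℕ.* L) → ¬ Value (x ℕ.+ y)))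
        frequently-avoiding frequent L 1≤L M =
          let X = fromℕ 10 * fromℕ L
              0<X = *-pos (fromℕ-pos {10} (ℕ.s≤s ℕ.z≤n)) (fromℕ-pos 1≤L)
              -- The scale is taken so large that `u (2^m)` dominates the finitely many irregular
              -- early values of `a`, and that its quotient `h` by `10L` is at least `M + 11`: `M`
              -- for the frequency, 11 for the window estimates.
              b , B≤b , large≤b = upper (proj₁ initial-bound) (fromℕ (suc (M ℕ.+ 11)) * X)
              N₃ , u-large = eventually-u≥ b
              m , le , tame , anchored = frequent (N₃ ℕ.⊔ n₁)
              N₃≤2^m = ℕP.≤-trans (ℕP.≤-trans (ℕP.m≤m⊔n N₃ n₁) le) (n≤2^n m)
              n₁≤2^m = ℕP.≤-trans (ℕP.≤-trans (ℕP.m≤n⊔m N₃ n₁) le) (n≤2^n m)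
              b≤U = u-large (2 ℕ.^ m) N₃≤2^m
              T , U<T = archimedean-* 0<X (u (2 ℕ.^ m))
              h , _ , hX≤U , U<hX+X = floorℕ T (u (2 ℕ.^ m)) (u-nonneg n₁≤2^m) U<T
              M+11≤h = ℕP.≤-pred (ℕP.≤-pred (ℕP.m≤n⇒m≤1+n (fromℕ-cancel-< (*-cancelʳ-< 0<X (≤-<-trans (≤-trans large≤b b≤U)
                (<-≤-trans U<hX+X (≡⇒≤ (solve 2 (λ h X → h :* X :+ X := (num 1 :+ h) :* X) refl (fromℕ h) X))))))))
          in h , ℕP.≤-trans (ℕP.m≤m+n M 11) M+11≤h , λ { x y x-near y-near lo hi (n , _ , w≤a , a<w+1) →
               let 2^≤n , n≤2^ = Scale.located m n₁≤2^m (≤-trans B≤b b≤U) hX≤U U<hX+X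
                                   (ℕP.≤-trans (ℕP.m≤n+m 11 M) M+11≤h) 1≤L lo hi w≤a a<w+1
               in no-sum {m} {x} {y} {n} tame anchored x-near y-near 2^≤n n≤2^ w≤a a<w+1 }

    avoiding-set : ∃[ A ] ∃[ A? ] (A ⊆ NonZero × (∃[ δ ] (IsUpperDensity {A} A? δ × 0# < δ))
                     × ¬ (∃[ x ] ∃[ y ] (x ∈ A × y ∈ A × Value (x ℕ.+ y))))
    avoiding-set =
      let n₂ , increments = eventually-superlinear-increment p d lead
          growth : ∀ n → n₂ ℕ.≤ n → evalℤ p (ℤ.+ n) ℤ.+ ℤ.+ n ℤ.≤ evalℤ p (ℤ.+ suc n)
          growth n n₂≤n = fromℤ-cancel-≤ (subst₂ _≤_
            (trans (cong (_+ fromℕ n) (eval-fromℤ p (ℤ.+ n))) (sym (fromℤ-+ (evalℤ p (ℤ.+ n)) (ℤ.+ n))))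
            (eval-fromℤ p (ℤ.+ suc n)) (increments n n₂≤n))
          W , wide = archimedean-* 0<c (fromℕ 5 + (V + V))
          Q , v , 0<Q , gap = polynomial-gaps p n₂ growth W
          wide′ : fromℕ 5 + (V + V) ≤ c * fromℕ (suc W)
          wide′ = by≤ (inj₁ (gap< wide <⊕≤ inj₁ 0<c))
            (solve 3 (λ b W c → W :* c :- b :+ c := c :* (num 1 :+ W) :- b) refl (fromℕ 5 + (V + V)) (fromℕ W) c)
          t , frequent = Gap.frequently-anchored W Q v 0<Q wide′ gap
          L₀ , L₀-large = archimedean (c * fromℕ Q + 1#)
          L = suc L₀
          L-large = ≤-trans (inj₁ L₀-large) (fromℕ-mono (ℕP.n≤1+n L₀))
      in sum-avoiding-set Value (Gap.Residue.Near W Q v 0<Q wide′ gap t) L (ℕ.s≤s ℕ.z≤n)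
           (Gap.Residue.near-syndetic W Q v 0<Q wide′ gap t L L-large)
           (Gap.Residue.frequently-avoiding W Q v 0<Q wide′ gap t frequent L (ℕ.s≤s ℕ.z≤n))

theorem1p4 : ExcludedMiddle 0ℓ →
    (R : CompleteOrderedField) → let open RealAnalysis R in
    (α : ℝ → ℝ) → Eventually (λ x → 0# < α x) → SubPolynomial α →
    (c : ℝ) → 0# < c →
    (p : List ℤ) → (∃[ d ] (2 ℕ.≤ d × HasDegree p d)) →
    (r : ℝ → ℝ) → (∃[ L ] Lim∞ (λ x → ∣ r x ∣ ÷ log x) L) →
    α ≈∞ (λ x → c * eval p x + r x) →
    ∃[ A ] ∃[ A? ] (A ⊆ NonZero
    × (∃[ δ ] (IsUpperDensity {A} A? δ × 0# < δ))
    × ¬ (∃[ x ] ∃[ y ] ∃[ n ] (x ∈ A × y ∈ A × NonZero n × ⌊ α (fromℕ n) ⌋≡ ℤ.+ (x ℕ.+ y))))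
theorem1p4 em R α α>0 ((H , hardy , α∈H) , _) c 0<c p (suc (suc d) , ℕ.s≤s (ℕ.s≤s _) , degree) r (L , lim) α≈ =
  conclude (positive-lead p (suc (suc d)) degree)
  where
  open RealAnalysis R
  open OrderedField R
  open Analysis em R
  open HardyFields em R
  open Growth em R
  open LogarithmBounds em R
  open DyadicScales em R
  open Avoidance em R

  -- This function replaces `r`, with which it agrees only eventually: it is an element of the Hardy
  -- field plus a polynomial, and the decomposition `α≡` holds at every point.
  g : ℝ → ℝ
  g x = α x + - c * eval p x

  α≡ : ∀ x → α x ≡ c * eval p x + g x
  α≡ x = solve 3 (λ a c P → a := c :* P :+ (a :+ (:- c) :* P)) refl (α x) c (eval p x)

  g-bound : Eventually (λ x → 1# + 1# ≤ x × ∣ g x ∣ ≤ (∣ L ∣ + 1#) * log x)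
  g-bound = map∞ (λ x (eq , 2≤x , bound) → 2≤x , subst (λ y → ∣ y ∣ ≤ (∣ L ∣ + 1#) * log x)
      (trans (solve 3 (λ c P r → r := c :* P :+ r :+ (:- c) :* P) refl c (eval p x) (r x))
        (cong (_+ - c * eval p x) (sym eq))) bound)
    (α≈ ∧∞ logarithmic-bound r lim)

  0≤C₀ : 0# ≤ ∣ L ∣ + 1#
  0≤C₀ = ∣∣-nonneg L ⊕ 0≤1

  -- The factor 2 comes from the bound `2m` for `log (2^m)`; the same constant also covers the
  -- linear bound.
  C : ℝ
  C = (∣ L ∣ + 1#) * fromℕ 2

  C₀*≤ : ∀ {x y} → x ≤ y → (∣ L ∣ + 1#) * x ≤ (∣ L ∣ + 1#) * y
  C₀*≤ {x} {y} x≤y = by≤ (0≤C₀ ⊗ gap≤ x≤y) (solve 3 (λ C x y → C :* (y :- x) := C :* y :- C :* x) refl _ x y)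

  1<2+ : ∀ {x} → 1# + 1# ≤ x → 1# < x
  1<2+ {x} 2≤x = by< (gap≤ 2≤x ≤⊕< 0<1) (solve 1 (λ x → x :- (num 1 :+ num 1) :+ num 1 := x :- num 1) refl x)

  linear : Eventuallyℕ (λ n → ∣ g (fromℕ n) ∣ ≤ C * fromℕ n)
  linear = mapℕ (λ n (2≤n , bound) → ≤-trans bound (≤-trans (C₀*≤ (log≤id (1<2+ 2≤n)))
      (by≤ (0≤C₀ ⊗ fromℕ-nonneg n) (solve 2 (λ C n → C :* n := C :* num 2 :* n :- C :* n) refl _ (fromℕ n)))))
    (eventually⇒ℕ g-bound)

  dyadic : Eventuallyℕ (λ m → ∣ g (fromℕ (2 ℕ.^ m)) ∣ ≤ C * fromℕ m)
  -- The threshold `suc N` guarantees `m ≥ 1`, which `log-2^` requires.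
  dyadic = let N , bounds = eventually⇒ℕ g-bound in suc N , λ m N<m →
    let 2≤2^m , bound = bounds (2 ℕ.^ m) (ℕP.≤-trans (ℕP.<⇒≤ N<m) (n≤2^n m))
    in ≤-trans bound (≤-trans (C₀*≤ (log-2^ m (ℕP.≤-trans (ℕ.s≤s ℕ.z≤n) N<m) (1<2+ 2≤2^m)))
         (≡⇒≤ (trans (cong ((∣ L ∣ + 1#) *_) (fromℕ-* 2 m))
           (solve 2 (λ C m → C :* (num 2 :* m) := C :* num 2 :* m) refl _ (fromℕ m)))))

  monotone : EventuallyMonotone g
  -- The number of differentiations is governed by `length p`, which trailing zeros can make larger
  -- than the degree plus one; `degree<-suc` gives the bound its successor shape.
  monotone = hardy+polynomial-monotone hardy (length p) α∈H (degree<-suc (length p) (degree<-eval (- c) p))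

  conclude : PositiveLead p (suc (suc d)) ⊎ PositiveLead (map (λ a → ℤ.- a) p) (suc (suc d)) →
    ∃[ A ] ∃[ A? ] (A ⊆ NonZero
    × (∃[ δ ] (IsUpperDensity {A} A? δ × 0# < δ))
    × ¬ (∃[ x ] ∃[ y ] ∃[ n ] (x ∈ A × y ∈ A × NonZero n × ⌊ α (fromℕ n) ⌋≡ ℤ.+ (x ℕ.+ y))))
  conclude (inj₂ lead) = ⊥-elim (negative-contradiction {p} {d} {c} {C} {λ n → α (fromℕ n)} {λ n → g (fromℕ n)}
    lead 0<c (λ n → α≡ (fromℕ n)) linear (eventually⇒ℕ α>0))
  conclude (inj₁ lead) =
    let A , A? , A⊆NonZero , density , avoids = avoiding-set p d lead c 0<c (λ n → α (fromℕ n)) (λ n → g (fromℕ n))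
          (λ n → α≡ (fromℕ n)) C linear dyadic (monotone⇒ℕ monotone)
    in A , A? , A⊆NonZero , density
       , λ { (x , y , n , x∈A , y∈A , value) → avoids (x , y , x∈A , y∈A , n , value) }
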